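{- Assume the Strong Exponential Time Hypothesis (SETH). Then for every constant $\varepsilon>0$ there is no dynamic algorithm which, for an undirected planar graph on $n$ vertices with nonnegative integer edge weights bounded by a polynomial in $n$, maintains the diameter of the graph under a sequence of edge-weight changes with $O(n^{1-\varepsilon})$ amortized time per weight change. This holds even if the algorithm may preprocess the initial graph in $\mathrm{poly}(n)$ time, and even in the partially dynamic settings in which all weight changes are decreases, or all weight changes are increases. -}

module Defs where

open import Data.Bool.Base using (Bool; true; false; if_then_else_)
open import Data.Fin.Base as Fin using (Fin; toℕ)
open import Data.Integer.Base using (∣_∣)
open import Data.List.Base using (List; []; _∷_; _++_; length; map; concatMap; allFin)
open import Data.List.Relation.Unary.All using (All)
open import Data.List.Relation.Unary.Any using (Any)
open import Data.Nat.Base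
open import Data.Nat.Logarithm using (⌊log₂_⌋)
open import Data.Nat.Properties using (_≟_)
open import Data.Product.Base using (_×_; _,_; proj₁; proj₂; ∃; ∃-syntax; ∃₂)
open import Data.Rational.Base as ℚ using (ℚ; 0ℚ; 1ℚ; ↥_; ↧ₙ_)
open import Data.Sum.Base using (_⊎_)
open import Data.Unit.Base using (⊤)
open import Data.Empty using (⊥)
open import Data.Vec.Functional using (Vector; updateAt)
open import Function.Base using (const)
open import Function.Bundles using (_⇔_)
open import Function.Definitions using (Injective)
open import Relation.Binary.PropositionalEquality.Core using (_≡_; _≢_)
open import Relation.Nullary using (¬_; does)

------------------------------------------------------------------------
-- Random access machines with logarithmic cost
--
-- Programs are structured instead of using jumps, which changes running
-- times by constant factors only.  Registers and memory cells hold
-- arbitrary naturals, but an operation costs the bit lengths of the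
-- numbers and addresses it handles, so no parallelism can be hidden in
-- long numbers.  On computations with numbers of O(log n) bits this
-- agrees with the word RAM up to polylogarithmic factors.

data Op : Set where
  plus monus times quot : Op

⟦_⟧ : Op → ℕ → ℕ → ℕ
⟦ plus  ⟧ x y       = x + y
⟦ monus ⟧ x y       = x ∸ y
⟦ times ⟧ x y       = x * y
⟦ quot  ⟧ x zero    = 0
⟦ quot  ⟧ x (suc y) = x / suc y

Reg : Set
Reg = ℕ

infixr 5 _⨾_

data Cmd : Set where
  skip        : Cmd
  _≔_         : Reg → ℕ → Cmd
  _≔_⟨_⟩_     : Reg → Reg → Op → Reg → Cmd
  load store  : Reg → Reg → Cmd
  _⨾_         : Cmd → Cmd → Cmd
  ifnz_then_else_ : Reg → Cmd → Cmd → Cmd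
  whilenz_loop_   : Reg → Cmd → Cmd

record State : Set where
  constructor ⟪_,_⟫
  field
    reg : ℕ → ℕ
    mem : ℕ → ℕ

open State public

_[_↦_] : (ℕ → ℕ) → ℕ → ℕ → (ℕ → ℕ)
(f [ a ↦ x ]) b = if does (b ≟ a) then x else f b

bits : ℕ → ℕ
bits x = suc ⌊log₂ x ⌋

-- Run c σ σ′ t: started in σ, the program c halts in σ′ at cost t.
data Run : Cmd → State → State → ℕ → Set where
  skip  : ∀ {σ} → Run skip σ σ 1
  set   : ∀ {r x ρ μ} →
          Run (r ≔ x) ⟪ ρ , μ ⟫ ⟪ ρ [ r ↦ x ] , μ ⟫ (bits x)
  op    : ∀ {r s o s′ ρ μ} →
          Run (r ≔ s ⟨ o ⟩ s′) ⟪ ρ , μ ⟫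
              ⟪ ρ [ r ↦ ⟦ o ⟧ (ρ s) (ρ s′) ] , μ ⟫
              (bits (ρ s) + bits (ρ s′))
  -- r := mem[a]
  load  : ∀ {r a ρ μ} →
          Run (load r a) ⟪ ρ , μ ⟫ ⟪ ρ [ r ↦ μ (ρ a) ] , μ ⟫
              (bits (ρ a) + bits (μ (ρ a)))
  -- mem[a] := r
  store : ∀ {a r ρ μ} →
          Run (store a r) ⟪ ρ , μ ⟫ ⟪ ρ , μ [ ρ a ↦ ρ r ] ⟫
              (bits (ρ a) + bits (ρ r))
  seq   : ∀ {c c′ σ σ′ σ″ t t′} → Run c σ σ′ t → Run c′ σ′ σ″ t′ →
          Run (c ⨾ c′) σ σ″ (t + t′)
  if-nz : ∀ {r c c′ σ σ′ t} → reg σ r ≢ 0 → Run c σ σ′ t →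
          Run (ifnz r then c else c′) σ σ′ (bits (reg σ r) + t)
  if-z  : ∀ {r c c′ σ σ′ t} → reg σ r ≡ 0 → Run c′ σ σ′ t →
          Run (ifnz r then c else c′) σ σ′ (bits (reg σ r) + t)
  while-nz : ∀ {r c σ σ′ σ″ t t′} → reg σ r ≢ 0 → Run c σ σ′ t →
             Run (whilenz r loop c) σ′ σ″ t′ →
             Run (whilenz r loop c) σ σ″ (bits (reg σ r) + t + t′)
  while-z  : ∀ {r c σ} → reg σ r ≡ 0 →
             Run (whilenz r loop c) σ σ (bits (reg σ r))

contents : List ℕ → ℕ → ℕ
contents []       _       = 0
contents (x ∷ xs) zero    = x
contents (x ∷ xs) (suc a) = contents xs a

start : List ℕ → State
start input = ⟪ const 0 , contents input ⟫

-- For b > 0 and ε = p / q this is  t ≤ a · b ^ (1 - ε),  that is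
-- t ^ q · b ^ p ≤ (a · b) ^ q.
infix 4 _≤_·_^[1-_]

_≤_·_^[1-_] : ℕ → ℕ → ℕ → ℚ → Set
t ≤ a · b ^[1- ε ] = t ^ ↧ₙ ε * b ^ ∣ ↥ ε ∣ ≤ (a * b) ^ ↧ₙ ε

------------------------------------------------------------------------
-- The Strong Exponential Time Hypothesis

Literal : ℕ → Set
Literal n = Fin n × Bool

Clause : ℕ → Set
Clause n = List (Literal n)

CNF : ℕ → Set
CNF n = List (Clause n)

Width≤ : ∀ {n} → ℕ → CNF n → Set
Width≤ {n} k = All (λ (cl : Clause n) → length cl ≤ k)

Satisfiable : ∀ {n} → CNF n → Set
Satisfiable {n} φ =
  ∃ λ (α : Fin n → Bool) → All (Any (λ (i , b) → α i ≡ b)) φ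

encodeLiteral : ∀ {n} → Literal n → ℕ
encodeLiteral (i , b) = 2 * toℕ i + (if b then 1 else 0)

encodeCNF : ∀ {n} → CNF n → List ℕ
encodeCNF {n} φ =
  n ∷ length φ ∷ concatMap (λ cl → length cl ∷ map encodeLiteral cl) φ

-- c decides k-SAT in time 2 ^ ((1 - ε) n) · poly(length of the input).
-- The polynomial factor cannot be dropped: clauses may be repeated, so
-- the input length is not bounded in terms of n and k.
DecidesSAT : ℕ → ℚ → Cmd → Set
DecidesSAT k ε c =
  ∃₂ λ K d → ∀ n (φ : CNF n) → Width≤ k φ →
  ∃₂ λ σ t → Run c (start (encodeCNF φ)) σ t
           × (reg σ 0 ≡ 1 ⇔ Satisfiable φ)
           × t ≤ K * length (encodeCNF φ) ^ d · 2 ^ n ^[1- ε ]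

SETH : Set
SETH = ∀ ε → 0ℚ ℚ.< ε → ∃[ k ] ¬ (∃[ c ] DecidesSAT k ε c)

------------------------------------------------------------------------
-- Graphs

-- Finite simple undirected graphs; every edge is listed once, with its
-- smaller endpoint first.
record Graph (n : ℕ) : Set where
  field
    size     : ℕ
    ends     : Fin size → Fin n × Fin n
    ordered  : ∀ e → proj₁ (ends e) Fin.< proj₂ (ends e)
    distinct : Injective _≡_ _≡_ ends

  source target : Fin size → Fin n
  source e = proj₁ (ends e)
  target e = proj₂ (ends e)

  Joins : Fin size → Fin n → Fin n → Set
  Joins e u v = ends e ≡ (u , v) ⊎ ends e ≡ (v , u)

  Incident : Fin n → Fin size → Set
  Incident v e = v ≡ source e ⊎ v ≡ target e

  data Walk : Fin n → Fin n → Set where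
    here : ∀ {u} → Walk u u
    step : ∀ {u v w} e → Joins e u v → Walk v w → Walk u w

  Weighting : Set
  Weighting = Vector ℕ size

  walkLength : ∀ {u v} → Weighting → Walk u v → ℕ
  walkLength ω here         = 0
  walkLength ω (step e _ p) = ω e + walkLength ω p

  Connected : Set
  Connected = ∀ u v → Walk u v

  IsDistance : Weighting → Fin n → Fin n → ℕ → Set
  IsDistance ω u v d = (∃[ p ] walkLength {u} {v} ω p ≡ d)
                     × (∀ (p : Walk u v) → d ≤ walkLength ω p)

  IsDiameter : Weighting → ℕ → Set
  IsDiameter ω D = (∃₂ λ u v → IsDistance ω u v D)
                 × (∀ u v d → IsDistance ω u v d → d ≤ D)

------------------------------------------------------------------------
-- Planarity: the graph has a drawing without crossings.
--
-- Edges are drawn as polygonal paths with rational vertices.  A path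
-- may touch itself; this is harmless, because it contains a simple path
-- between its two ends.

Point : Set
Point = ℚ × ℚ

OnSegment : Point → Point → Point → Set
OnSegment (a₁ , a₂) (b₁ , b₂) (p₁ , p₂) =
  ∃[ t ] 0ℚ ℚ.≤ t × t ℚ.≤ 1ℚ
       × p₁ ≡ (1ℚ ℚ.- t) ℚ.* a₁ ℚ.+ t ℚ.* b₁
       × p₂ ≡ (1ℚ ℚ.- t) ℚ.* a₂ ℚ.+ t ℚ.* b₂

OnPath : List Point → Point → Set
OnPath (a ∷ b ∷ ps) p = OnSegment a b p ⊎ OnPath (b ∷ ps) p
OnPath _            p = ⊥

record PlaneDrawing {n} (G : Graph n) : Set where
  open Graph G
  field
    position  : Fin n → Point
    bends     : Fin size → List Point

  path : Fin size → List Point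
  path e = position (source e) ∷ bends e ++ position (target e) ∷ []

  field
    position-injective : Injective _≡_ _≡_ position
    avoids-vertices    : ∀ e v → OnPath (path e) (position v) → Incident v e
    no-crossing        : ∀ e f p → e ≢ f → OnPath (path e) p → OnPath (path f) p →
                         ∃[ v ] p ≡ position v × Incident v e × Incident v f

Planar : ∀ {n} → Graph n → Set
Planar G = PlaneDrawing G

------------------------------------------------------------------------
-- Maintaining the diameter under weight changes

data Setting : Set where
  fullyDynamic decreasing increasing : Setting

Permits : Setting → (old new : ℕ) → Set
Permits fullyDynamic old new = ⊤
Permits decreasing   old new = new < old
Permits increasing   old new = old < new

record DynamicAlgorithm : Set where
  field
    preprocess : Cmd
    update     : Cmd

module _ {n} (G : Graph n) where
  open Graph G

  Change : Set
  Change = Fin size × ℕ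

  apply : Weighting → Change → Weighting
  apply ω (e , x) = updateAt ω e (const x)

  -- W bounds all weights.
  data Legal (s : Setting) (W : ℕ) : Weighting → List Change → Set where
    []  : ∀ {ω} → Legal s W ω []
    _∷_ : ∀ {ω e x cs} → Permits s (ω e) x × x ≤ W →
          Legal s W (apply ω (e , x)) cs → Legal s W ω ((e , x) ∷ cs)

  encodeGraph : Weighting → List ℕ
  encodeGraph ω =
    n ∷ size ∷
    concatMap (λ e → toℕ (source e) ∷ toℕ (target e) ∷ ω e ∷ []) (allFin size)

  -- A change is announced to the algorithm in registers 1 and 2; all
  -- other registers and the memory persist between updates.
  announce : Change → State → State
  announce (e , x) ⟪ ρ , μ ⟫ = ⟪ (ρ [ 1 ↦ toℕ e ]) [ 2 ↦ x ] , μ ⟫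

  -- Serves A σ ω cs T: from state σ and weights ω, the algorithm
  -- processes the changes cs one at a time with total cost T, and after
  -- each of them register 0 holds the current diameter.
  data Serves (A : DynamicAlgorithm) :
              State → Weighting → List Change → ℕ → Set where
    []  : ∀ {σ ω} → Serves A σ ω [] 0
    _∷_ : ∀ {σ σ′ ω c cs t T} →
          Run (DynamicAlgorithm.update A) (announce c σ) σ′ t
          × IsDiameter (apply ω c) (reg σ′ 0) →
          Serves A σ′ (apply ω c) cs T →
          Serves A σ ω (c ∷ cs) (t + T)

-- A maintains the diameter of planar graphs with n vertices and weights
-- at most n ^ C, with polynomial preprocessing and amortized time
-- O(n ^ (1 - ε)) per change.  Only connected graphs need to be handled,
-- so that all distances are finite.
MaintainsDiameter : Setting → ℕ → ℚ → DynamicAlgorithm → Set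
MaintainsDiameter s C ε A =
  ∃₂ λ K d → ∀ n .{{_ : NonZero n}} (G : Graph n) →
  Planar G → Graph.Connected G →
  (ω : Graph.Weighting G) → (∀ e → ω e ≤ n ^ C) →
  ∃₂ λ σ t → Run (DynamicAlgorithm.preprocess A) (start (encodeGraph G ω)) σ t
           × t ≤ K * n ^ d
           × Graph.IsDiameter G ω (reg σ 0)
           × (∀ cs → Legal G s (n ^ C) ω cs →
              ∃[ T ] Serves G A σ ω cs T
                   × T ≤ K * length cs · n ^[1- ε ])

{-# OPTIONS --safe #-}

-- Split the n variables of a CNF formula with l clauses into a small left
-- part, with N assignments, and a right part, with P.  Every left assignment
-- k owns two rows of a planar grid, at the same distance from the middle;
-- column c < l + 2 belongs to a clause, up to two dummy columns.  The lengths
-- of the rows grow towards the middle exactly as fast as the vertical distance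
-- shrinks, so all walks from the left end of a row of k to the right end of its
-- other row have nearly the same length, whichever column they use for crossing
-- the middle.  In the lower row the length of the piece up to column c is
-- increased by 1 if k satisfies the clause c, and the middle edge of column c
-- is longer by 1 if the given right assignment satisfies c.  Hence the two ends
-- are as far apart as possible exactly if every clause is satisfied, and the
-- diameter tells whether some k completes the right assignment.
--
-- The grid is preprocessed once, and each of the P right assignments needs only
-- l + 2 weight changes, always starting from the state after preprocessing.
-- As nothing accumulates, these changes can be increases or decreases.  The
-- state is recovered at no cost: the simulated algorithm writes to fresh cells
-- in every epoch and falls back on the cells of the preprocessing.  With
-- N = 2 ^ (n / D) for a large constant D the preprocessing is cheap, and
-- P · N ^ (1 - ε) · poly is 2 ^ ((1 - ε / D) n) · poly.

module Submission where

open import Defs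
open import Data.Bool.Base using (Bool; true; false; if_then_else_)
open import Data.Empty using (⊥)
open import Data.Fin.Base as Fin using (Fin; toℕ; fromℕ<; inject₁; combine; remQuot; splitAt; _↑ˡ_; _↑ʳ_)
open import Data.Fin using (#_)
import Data.Fin.Properties as Fin
open import Data.Integer.Base as ℤ using (ℤ)
import Data.Integer.Properties as ℤ
open import Data.List.Base as List using (List; []; _∷_; _++_; length; map; concatMap; allFin; drop)
open import Data.List.Properties using (length-map; length-++; ++-assoc; ++-identityʳ; map-tabulate; map-cong)
open import Data.List.Relation.Unary.All as All using (All; []; _∷_)
open import Data.List.Relation.Unary.Any as Any using (Any; here; there)
open import Data.Nat.Base
import Data.Nat.Coprimality as Coprime
open import Data.Nat.DivMod using (m/n≤m; m≡m%n+[m/n]*n; m%n<n; m/n*n≤m; m*n/n≡m; /-monoˡ-≤; m<n⇒m/n≡0; +-distrib-/-∣ʳ)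
open import Data.Nat.Divisibility using (divides)
open import Data.Nat.Logarithm using (⌊log₂_⌋; ⌊log₂⌋-mono-≤; ⌊log₂⌊n/2⌋⌋≡⌊log₂n⌋∸1; ⌊log₂[2*b]⌋≡1+⌊log₂b⌋; ⌊log₂[2^n]⌋≡n)
open import Data.Nat.Properties
open import Data.Nat.Tactic.RingSolver using (solve-∀)
open import Data.Product.Base using (_×_; _,_; proj₁; proj₂; ∃; ∃-syntax; ∃₂; uncurry)
open import Data.Rational.Base as ℚ using (ℚ; 0ℚ; 1ℚ; mkℚ)
import Data.Rational.Properties as ℚ
open import Data.Rational.Solver using (module +-*-Solver)
open import Data.Sum.Base as Sum using (_⊎_; inj₁; inj₂; [_,_])
open import Data.Unit.Base using (⊤; tt)
open import Data.Vec.Functional.Properties using (updateAt-updates; updateAt-minimal)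
open import Function.Base using (_∘_)
open import Function.Bundles using (_⇔_; mk⇔; Equivalence)
open import Function.Definitions using (Injective)
open import Relation.Binary.Definitions using (tri<; tri≈; tri>)
open import Relation.Binary.PropositionalEquality hiding ([_])
open import Relation.Nullary using (¬_; does; yes; no; contradiction)
open import Relation.Nullary.Decidable using (dec-true; dec-false)

-- Bit lengths

-- The hypothesis bounds every legal sequence of changes that begins at the preprocessed state, and
-- in the monotone settings no change can be taken back; so every right assignment has to begin at
-- that state. Copying it for each of them could take as long as the preprocessing, about N ^ d, far
-- beyond the budget of a query; hence the epochs.
--
-- One row further out on both sides means two more vertical edges of length 2 m, while each of the
-- m edges of a row loses 4: the balance is 2 · 2 m = 4 · m. The step 4 also outweighs the
-- perturbations by 1. The dummy columns 0 and m have row values 0 and 1 and middle values 1 and 0.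
-- Their sums are 1, so they are no shortcuts; their row values are the same for all k; and the last
-- one keeps the opposite pair of row ends close.
--
-- The number n of variables is a single entry of the encoding, so it is not bounded by the input
-- length. Powers of n cannot go into the polynomial factor that a SAT algorithm is allowed; they
-- are paid from the exponential saving, which is why this is first shown to be 2 ^ (2 n).

≤-by : ∀ {a b x y} → x ≤ y → ∀ s → b + x ≡ a + y + s → a ≤ b
≤-by {a} {b} {x} {y} x≤y s eq = +-cancelʳ-≤ x a b (begin
  a + x      ≤⟨ +-monoʳ-≤ a x≤y ⟩
  a + y      ≤⟨ m≤m+n (a + y) s ⟩
  a + y + s  ≡⟨ eq ⟨
  b + x      ∎)
  where open ≤-Reasoning

-- Together with `≤-by` this turns nonlinear inequalities into identities for the ring solver: the
-- slack s is written out, and the hypotheses used are added up into one inequality.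
≤-from : ∀ {a b} s → b ≡ a + s → a ≤ b
≤-from {a} s refl = m≤m+n a s

update-same : ∀ f a x → (f [ a ↦ x ]) a ≡ x
update-same f a x rewrite dec-true (a ≟ a) refl = refl

update-other : ∀ f {a b} x → b ≢ a → (f [ a ↦ x ]) b ≡ f b
update-other f {a} {b} x b≢a rewrite dec-false (b ≟ a) b≢a = refl

bits-mono : ∀ {x y} → x ≤ y → bits x ≤ bits y
bits-mono = s≤s ∘ ⌊log₂⌋-mono-≤

1≤bits : ∀ x → 1 ≤ bits x
1≤bits x = s≤s z≤n

bits-double : ∀ x → bits (2 * x) ≤ suc (bits x)
bits-double zero    = s≤s z≤n
bits-double (suc x) = s≤s (≤-reflexive (⌊log₂[2*b]⌋≡1+⌊log₂b⌋ (suc x)))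

2≤⇒1≤log₂ : ∀ {x} → 2 ≤ x → 1 ≤ ⌊log₂ x ⌋
2≤⇒1≤log₂ = ⌊log₂⌋-mono-≤

⌊n/2⌋<⇒<2* : ∀ x y → ⌊ x /2⌋ < y → x < 2 * y
⌊n/2⌋<⇒<2* x y lt = ≤-trans (s≤s (x≤ x)) (subst (_≤ 2 * y) (*-suc 2 ⌊ x /2⌋) (*-monoʳ-≤ 2 lt))
  where
  x≤ : ∀ x → x ≤ suc (2 * ⌊ x /2⌋)
  x≤ zero          = z≤n
  x≤ (suc zero)    = s≤s z≤n
  x≤ (suc (suc x)) = s≤s (≤-trans (s≤s (x≤ x)) (≤-reflexive (sym (*-suc 2 ⌊ x /2⌋))))

log₂<⇒<2^ : ∀ s x → ⌊log₂ x ⌋ < s → x < 2 ^ s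
log₂<⇒<2^ (suc s) zero _ = m^n>0 2 (suc s)
log₂<⇒<2^ (suc s) (suc zero) _ = *-mono-≤ {2} {2} ≤-refl (m^n>0 2 s)
log₂<⇒<2^ (suc s) x@(suc (suc x′)) (s≤s lt) = ⌊n/2⌋<⇒<2* x (2 ^ s) (log₂<⇒<2^ s ⌊ x /2⌋ (begin-strict
  ⌊log₂ ⌊ x /2⌋ ⌋  ≡⟨ ⌊log₂⌊n/2⌋⌋≡⌊log₂n⌋∸1 x ⟩
  ⌊log₂ x ⌋ ∸ 1    <⟨ ∸-monoʳ-< {⌊log₂ x ⌋} {1} {0} (s≤s z≤n) (2≤⇒1≤log₂ {x} (s≤s (s≤s z≤n))) ⟩
  ⌊log₂ x ⌋        ≤⟨ lt ⟩
  s                ∎))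
  where open ≤-Reasoning

<2^bits : ∀ x → x < 2 ^ bits x
<2^bits x = log₂<⇒<2^ (bits x) x ≤-refl

bits-2^ : ∀ s → bits (2 ^ s) ≡ suc s
bits-2^ s = cong suc (⌊log₂[2^n]⌋≡n s)

⌊n/2⌋< : ∀ x y → x < 2 * y → ⌊ x /2⌋ < y
⌊n/2⌋< x y lt = *-cancelˡ-< 2 ⌊ x /2⌋ y (≤-<-trans (2⌊n/2⌋≤ x) lt)
  where
  2⌊n/2⌋≤ : ∀ x → 2 * ⌊ x /2⌋ ≤ x
  2⌊n/2⌋≤ zero          = z≤n
  2⌊n/2⌋≤ (suc zero)    = z≤n
  2⌊n/2⌋≤ (suc (suc x)) = ≤-trans (≤-reflexive (*-suc 2 ⌊ x /2⌋)) (s≤s (s≤s (2⌊n/2⌋≤ x)))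

<2^⇒log₂< : ∀ s x → x < 2 ^ suc s → ⌊log₂ x ⌋ < suc s
<2^⇒log₂< zero zero lt = s≤s z≤n
<2^⇒log₂< zero (suc zero) lt = s≤s z≤n
<2^⇒log₂< zero (suc (suc x)) (s≤s (s≤s ()))
<2^⇒log₂< (suc s) x lt = s≤s (m∸1≤ (subst (_< suc s) (⌊log₂⌊n/2⌋⌋≡⌊log₂n⌋∸1 x)
    (<2^⇒log₂< s ⌊ x /2⌋ (⌊n/2⌋< x (2 ^ suc s) lt))))
  where
  m∸1≤ : ∀ {m n} → m ∸ 1 < n → m ≤ n
  m∸1≤ {zero}  _ = z≤n
  m∸1≤ {suc m} p = p

<2^⇒bits≤ : ∀ {s} x → 1 ≤ s → x < 2 ^ s → bits x ≤ s
<2^⇒bits≤ {suc s} x _ = <2^⇒log₂< s x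

bits-+ : ∀ x y → bits (x + y) ≤ bits x + bits y
bits-+ x y with ≤-total x y
... | inj₁ x≤y = ≤-trans (bits-mono (+-mono-≤ x≤y (≤-reflexive (sym (+-identityʳ y))))) (≤-trans (bits-double y) (+-monoˡ-≤ (bits y) (1≤bits x)))
... | inj₂ y≤x = ≤-trans (bits-mono (+-mono-≤ (≤-refl {x}) (≤-trans y≤x (≤-reflexive (sym (+-identityʳ x)))))) (≤-trans (bits-double x) (≤-trans (≤-reflexive (+-comm 1 (bits x))) (+-monoʳ-≤ (bits x) (1≤bits y))))

bits-* : ∀ x y → bits (x * y) ≤ bits x + bits y
bits-* x y = <2^⇒bits≤ (x * y) (m≤n⇒m≤n+o (bits y) (1≤bits x))
  (subst (x * y <_) (sym (^-distribˡ-+-* 2 (bits x) (bits y))) (*-mono-< (<2^bits x) (<2^bits y)))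

-- The bound is also the cost that the machine charges for the operation, which is why `width` and
-- `effort` can both be additive.
bits-op : ∀ o x y → bits (⟦ o ⟧ x y) ≤ bits x + bits y
bits-op plus  x y       = bits-+ x y
bits-op monus x y       = m≤n⇒m≤n+o (bits y) (bits-mono (m∸n≤m x y))
bits-op times x y       = bits-* x y
bits-op quot  x zero    = m≤n⇒m≤n+o 1 (1≤bits x)
bits-op quot  x (suc y) = m≤n⇒m≤n+o (bits (suc y)) (bits-mono (m/n≤m x (suc y)))

-- Expressions and their compilation

Env : ℕ → Set
Env zero    = ⊤
Env (suc k) = ℕ × Env k

get : ∀ {k} → Fin k → Env k → ℕ
get Fin.zero    o = proj₁ o
get (Fin.suc i) o = get i (proj₂ o)

-- Projections instead of a match on `o` let `put` at a literal index reduce for every environment,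
-- so the states of concrete programs agree by `refl`.
put : ∀ {k} → Fin k → ℕ → Env k → Env k
put Fin.zero    x o = x , proj₂ o
put (Fin.suc i) x o = proj₁ o , put i x (proj₂ o)

get-put-same : ∀ {k} (i : Fin k) x o → get i (put i x o) ≡ x
get-put-same Fin.zero    x o = refl
get-put-same (Fin.suc i) x o = get-put-same i x (proj₂ o)

get-put-other : ∀ {k} (i j : Fin k) x o → j ≢ i → get j (put i x o) ≡ get j o
get-put-other Fin.zero    Fin.zero    x o j≢i = contradiction refl j≢i
get-put-other Fin.zero    (Fin.suc j) x o j≢i = refl
get-put-other (Fin.suc i) Fin.zero    x o j≢i = refl
get-put-other (Fin.suc i) (Fin.suc j) x o j≢i = get-put-other i j x (proj₂ o) (j≢i ∘ cong Fin.suc)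

zeros : ∀ k → Env k
zeros zero    = tt
zeros (suc k) = 0 , zeros k

get-zeros : ∀ {k} (i : Fin k) → get i (zeros k) ≡ 0
get-zeros Fin.zero    = refl
get-zeros (Fin.suc i) = get-zeros i

infixl 7 _⊕_ _⊖_
infixl 8 _⊗_ _⊘_
infix  6 _≐_ _⇐_

data Exp (k : ℕ) : Set where
  var   : Fin k → Exp k
  lit   : ℕ → Exp k
  _‹_›_ : Exp k → Op → Exp k → Exp k
  mem[_]   : Exp k → Exp k

pattern _⊕_ e f = e ‹ plus › f
pattern _⊖_ e f = e ‹ monus › f
pattern _⊗_ e f = e ‹ times › f
pattern _⊘_ e f = e ‹ quot › f

Memory : Set
Memory = ℕ → ℕ

eval : ∀ {k} → Exp k → Env k → Memory → ℕ
eval (var i)       o μ = get i o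
eval (lit x)       o μ = x
eval (e ‹ ⊙ › f)  o μ = ⟦ ⊙ ⟧ (eval e o μ) (eval f o μ)
eval mem[ e ]         o μ = μ (eval e o μ)

-- Registers below k hold the variables, k + j is the j-th temporary.
compile : ∀ {k} → ℕ → Exp k → Cmd
compile {k} j (var i)      = ((k + suc j) ≔ 0) ⨾ ((k + j) ≔ toℕ i ⟨ plus ⟩ (k + suc j))
compile {k} j (lit x)      = (k + j) ≔ x
compile {k} j (e ‹ ⊙ › f) = compile j e ⨾ compile (suc j) f ⨾ ((k + j) ≔ (k + j) ⟨ ⊙ ⟩ (k + suc j))
compile {k} j mem[ e ]        = compile j e ⨾ load (k + j) (k + j)

-- The machine has no move instruction; copying is adding a register that holds 0.
_≐_ : ∀ {k} → Fin k → Exp k → Cmd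
_≐_ {k} i e = compile 0 e ⨾ ((k + 1) ≔ 0) ⨾ (toℕ i ≔ (k + 0) ⟨ plus ⟩ (k + 1))

_⇐_ : ∀ {k} → Exp k → Exp k → Cmd
_⇐_ {k} e f = compile 0 e ⨾ compile 1 f ⨾ store (k + 0) (k + 1)

branch : ∀ {k} → Exp k → Cmd → Cmd → Cmd
branch {k} e c d = compile 0 e ⨾ (ifnz (k + 0) then c else d)

while : ∀ {k} → Exp k → Cmd → Cmd
while {k} e c = compile 0 e ⨾ (whilenz (k + 0) loop (c ⨾ compile 0 e))

for : ∀ {k} → Fin k → Cmd → Cmd
for i c = while (var i) (c ⨾ i ≐ var i ⊖ lit 1)

-- Bounds, in units of S, for the bit length of the value of an expression
-- all of whose leaves have at most S bits, and for the cost of computing it.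
width : ∀ {k} → Exp k → ℕ
width (var i)      = 1
width (lit x)      = bits x
width (e ‹ ⊙ › f) = width e + width f
width mem[ e ]        = 1

effort : ∀ {k} → Exp k → ℕ
effort (var i)      = 3
effort (lit x)      = bits x
effort (e ‹ ⊙ › f) = effort e + effort f + (width e + width f)
effort mem[ e ]        = effort e + (width e + 1)

-- The length of a value is controlled by the leaves of the expression, except for cells read from
-- memory. Their lengths have nothing to do with the variables and become separate hypotheses.
Loads : ∀ {k} → ℕ → Exp k → Env k → Memory → Set
Loads S (var i)      o μ = ⊤
Loads S (lit x)      o μ = ⊤
Loads S (e ‹ ⊙ › f) o μ = Loads S e o μ × Loads S f o μ
Loads S mem[ e ]        o μ = Loads S e o μ × bits (μ (eval e o μ)) ≤ S

Small : ∀ {k} → ℕ → Env k → Set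
Small S o = ∀ i → bits (get i o) ≤ S

eval-bits : ∀ {k} S → 1 ≤ S → (e : Exp k) → ∀ {o μ} → Small S o → Loads S e o μ →
            bits (eval e o μ) ≤ width e * S
eval-bits S 1≤S (var i) sm ld = ≤-trans (sm i) (≤-reflexive (sym (*-identityˡ S)))
eval-bits S 1≤S (lit x) sm ld = m≤m*n (bits x) S {{>-nonZero 1≤S}}
eval-bits S 1≤S (e ‹ ⊙ › f) {o} {μ} sm (le , lf) = begin
  bits (⟦ ⊙ ⟧ (eval e o μ) (eval f o μ))  ≤⟨ bits-op ⊙ (eval e o μ) (eval f o μ) ⟩
  bits (eval e o μ) + bits (eval f o μ)    ≤⟨ +-mono-≤ (eval-bits S 1≤S e sm le) (eval-bits S 1≤S f sm lf) ⟩
  width e * S + width f * S                ≡⟨ *-distribʳ-+ S (width e) (width f) ⟨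
  (width e + width f) * S                  ∎
  where open ≤-Reasoning
eval-bits S 1≤S mem[ e ] sm (le , b) = ≤-trans b (≤-reflexive (sym (*-identityˡ S)))

record Computes {k} (S : ℕ) (j : ℕ) (e : Exp k) (o : Env k) (ρ : ℕ → ℕ) (μ : Memory) : Set where
  constructor computes
  field
    final  : ℕ → ℕ
    time   : ℕ
    run    : Run (compile j e) ⟪ ρ , μ ⟫ ⟪ final , μ ⟫ time
    result : final (k + j) ≡ eval e o μ
    frame  : ∀ r → r < k + j → final r ≡ ρ r
    cost   : time ≤ effort e * S

-- The second operand is compiled for the next temporary, so `frame` protects the first operand as
-- well as the variables.
compute : ∀ {k} S → 1 ≤ S → ∀ j (e : Exp k) {o ρ μ} → (∀ i → ρ (toℕ i) ≡ get i o) → Small S o →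
          Loads S e o μ → Computes S j e o ρ μ
compute {k} S 1≤S j (var i) {o} {ρ} {μ} vs sm ld = record
  { final  = ρ₁ [ k + j ↦ ρ₁ (toℕ i) + ρ₁ (k + suc j) ]
  ; time   = bits 0 + (bits (ρ₁ (toℕ i)) + bits (ρ₁ (k + suc j)))
  ; run    = seq set op
  ; result = trans (update-same ρ₁ (k + j) _) (trans (cong₂ _+_ ρ₁i (update-same ρ (k + suc j) 0)) (trans (+-identityʳ _) (vs i)))
  ; frame  = λ r r< → trans (update-other ρ₁ _ (<⇒≢ r<)) (update-other ρ 0 (<⇒≢ (<-trans r< (+-monoʳ-< k ≤-refl))))
  ; cost   = begin
      1 + (bits (ρ₁ (toℕ i)) + bits (ρ₁ (k + suc j)))
        ≡⟨ cong₂ (λ x y → 1 + (bits x + bits y)) (trans ρ₁i (vs i)) (update-same ρ (k + suc j) 0) ⟩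
      1 + (bits (get i o) + 1)
        ≤⟨ +-mono-≤ 1≤S (+-mono-≤ (sm i) 1≤S) ⟩
      S + (S + S)
        ≡⟨ eq S ⟩
      3 * S ∎
  }
  where
  open ≤-Reasoning
  ρ₁ : ℕ → ℕ
  ρ₁ = ρ [ k + suc j ↦ 0 ]
  ρ₁i : ρ₁ (toℕ i) ≡ ρ (toℕ i)
  ρ₁i = update-other ρ 0 (<⇒≢ (<-≤-trans (Fin.toℕ<n i) (m≤m+n k (suc j))))
  eq : ∀ s → s + (s + s) ≡ 3 * s
  eq = solve-∀
compute {k} S 1≤S j (lit x) {o} {ρ} {μ} vs sm ld = record
  { final  = ρ [ k + j ↦ x ]
  ; time   = bits x
  ; run    = set
  ; result = update-same ρ (k + j) x
  ; frame  = λ r r< → update-other ρ x (<⇒≢ r<)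
  ; cost   = m≤m*n (bits x) S {{>-nonZero 1≤S}}
  }
compute {k} S 1≤S j (e ‹ ⊙ › f) {o} {ρ} {μ} vs sm (le , lf) = record
  { final  = F.final [ k + j ↦ ⟦ ⊙ ⟧ (F.final (k + j)) (F.final (k + suc j)) ]
  ; time   = E.time + (F.time + (bits (F.final (k + j)) + bits (F.final (k + suc j))))
  ; run    = seq E.run (seq F.run Run.op)
  ; result = trans (update-same F.final (k + j) _) (cong₂ ⟦ ⊙ ⟧ left F.result)
  ; frame  = λ r r< → trans (update-other F.final _ (<⇒≢ r<)) (trans (F.frame r (<-trans r< j<sj)) (E.frame r r<))
  ; cost   = begin
      E.time + (F.time + (bits (F.final (k + j)) + bits (F.final (k + suc j))))
        ≡⟨ cong₂ (λ x y → E.time + (F.time + (bits x + bits y))) left F.result ⟩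
      E.time + (F.time + (bits (eval e o μ) + bits (eval f o μ)))
        ≤⟨ +-mono-≤ E.cost (+-mono-≤ F.cost (+-mono-≤ (eval-bits S 1≤S e sm le) (eval-bits S 1≤S f sm lf))) ⟩
      effort e * S + (effort f * S + (width e * S + width f * S))
        ≡⟨ eq (effort e) (effort f) (width e) (width f) S ⟩
      (effort e + effort f + (width e + width f)) * S ∎
  }
  where
  open ≤-Reasoning
  j<sj : k + j < k + suc j
  j<sj = +-monoʳ-< k ≤-refl
  module E = Computes (compute S 1≤S j e {ρ = ρ} vs sm le)
  vs′ : ∀ i → E.final (toℕ i) ≡ get i o
  vs′ i = trans (E.frame (toℕ i) (<-≤-trans (Fin.toℕ<n i) (m≤m+n k j))) (vs i)
  module F = Computes (compute S 1≤S (suc j) f {ρ = E.final} vs′ sm lf)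
  left : F.final (k + j) ≡ eval e o μ
  left = trans (F.frame (k + j) j<sj) E.result
  eq : ∀ a b c d s → a * s + (b * s + (c * s + d * s)) ≡ (a + b + (c + d)) * s
  eq = solve-∀
compute {k} S 1≤S j mem[ e ] {o} {ρ} {μ} vs sm (le , b) = record
  { final  = E.final [ k + j ↦ μ (E.final (k + j)) ]
  ; time   = E.time + (bits (E.final (k + j)) + bits (μ (E.final (k + j))))
  ; run    = seq E.run load
  ; result = trans (update-same E.final (k + j) _) (cong μ E.result)
  ; frame  = λ r r< → trans (update-other E.final _ (<⇒≢ r<)) (E.frame r r<)
  ; cost   = begin
      E.time + (bits (E.final (k + j)) + bits (μ (E.final (k + j))))
        ≡⟨ cong (λ x → E.time + (bits x + bits (μ x))) E.result ⟩
      E.time + (bits (eval e o μ) + bits (μ (eval e o μ)))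
        ≤⟨ +-mono-≤ E.cost (+-mono-≤ (eval-bits S 1≤S e sm le) b) ⟩
      effort e * S + (width e * S + S)
        ≡⟨ eq (effort e) (width e) S ⟩
      (effort e + (width e + 1)) * S ∎
  }
  where
  open ≤-Reasoning
  module E = Computes (compute S 1≤S j e {ρ = ρ} vs sm le)
  eq : ∀ a b s → a * s + (b * s + s) ≡ (a + (b + 1)) * s
  eq = solve-∀

-- Cost-aware execution of programs

Conf : ℕ → Set
Conf k = Env k × Memory

-- Only the variables have to be short. The memory also stores numbers of the simulated algorithm,
-- which may have more than S bits.
record Represents {k} (S : ℕ) (s : Conf k) (σ : State) : Set where
  constructor represents
  field
    variables : ∀ i → reg σ (toℕ i) ≡ get i (proj₁ s)
    small     : Small S (proj₁ s)
    memory    : mem σ ≡ proj₂ s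

-- The cost is counted in units of S, which bounds the bit lengths of all variables.
record Exec {k} (S : ℕ) (c : Cmd) (s s′ : Conf k) (B : ℕ) : Set where
  field
    execute : ∀ σ → Represents S s σ → ∃₂ λ σ′ t → Run c σ σ′ t × Represents S s′ σ′ × t ≤ B * S

open Exec public

exec-mono : ∀ {k S c} {s s′ : Conf k} {B B′} → B ≤ B′ → Exec S c s s′ B → Exec S c s s′ B′
execute (exec-mono {S = S} B≤ E) σ R = let σ′ , t , run , R′ , t≤ = execute E σ R in
  σ′ , t , run , R′ , ≤-trans t≤ (*-monoˡ-≤ S B≤)

exec-seq : ∀ {k S c d} {s s′ s″ : Conf k} {B B′} →
           Exec S c s s′ B → Exec S d s′ s″ B′ → Exec S (c ⨾ d) s s″ (B + B′)
execute (exec-seq {S = S} {B = B} {B′} E F) σ R =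
  let σ₁ , t₁ , run₁ , R₁ , t₁≤ = execute E σ R
      σ₂ , t₂ , run₂ , R₂ , t₂≤ = execute F σ₁ R₁
  in σ₂ , t₁ + t₂ , seq run₁ run₂ , R₂ ,
     ≤-trans (+-mono-≤ t₁≤ t₂≤) (≤-reflexive (sym (*-distribʳ-+ S B B′)))

module Rules {k : ℕ} (S : ℕ) (1≤S : 1 ≤ S) where

  k≢toℕ : ∀ (i : Fin k) j → toℕ i ≢ k + j
  k≢toℕ i j = <⇒≢ (<-≤-trans (Fin.toℕ<n i) (m≤m+n k j))

  small-scale : ∀ m → 1 ≤ m → ∀ {o : Env k} → Small S o → Small (m * S) o
  small-scale m 1≤m sm i = ≤-trans (sm i) (m≤n*m S m {{>-nonZero 1≤m}})

  1≤m*S : ∀ {m} → 1 ≤ m → 1 ≤ m * S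
  1≤m*S 1≤m = *-mono-≤ 1≤m 1≤S

  exec-skip : ∀ {s : Conf k} → Exec S skip s s 1
  execute exec-skip σ R = σ , 1 , skip , R , ≤-trans 1≤S (≤-reflexive (sym (*-identityˡ S)))

  -- The bound on the new value may use `Small S o`: decrements, halvings and copies inherit it from
  -- the old variable.
  exec-assign : ∀ (i : Fin k) e {o μ} → Loads S e o μ → (Small S o → bits (eval e o μ) ≤ S) →
                Exec S (i ≐ e) (o , μ) (put i (eval e o μ) o , μ) (effort e + 3)
  execute (exec-assign i e {o} {μ} ld val) ⟪ ρ , .μ ⟫ (represents vs sm refl) =
    ⟪ ρ₂ , μ ⟫ , C.time + (bits 0 + (bits (ρ₁ (k + 0)) + bits (ρ₁ (k + 1)))) ,
    seq C.run (seq Run.set Run.op) ,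
    represents vars small refl ,
    (begin
      C.time + (1 + (bits (ρ₁ (k + 0)) + bits (ρ₁ (k + 1))))
        ≡⟨ cong₂ (λ x y → C.time + (1 + (bits x + bits y))) ρ₁0 (update-same C.final (k + 1) 0) ⟩
      C.time + (1 + (bits (eval e o μ) + 1))
        ≤⟨ +-mono-≤ C.cost (+-mono-≤ 1≤S (+-mono-≤ (val sm) 1≤S)) ⟩
      effort e * S + (S + (S + S))
        ≡⟨ eq (effort e) S ⟩
      (effort e + 3) * S ∎)
    where
    open ≤-Reasoning
    module C = Computes (compute S 1≤S 0 e {ρ = ρ} vs sm ld)
    ρ₁ ρ₂ : ℕ → ℕ
    ρ₁ = C.final [ k + 1 ↦ 0 ]
    ρ₂ = ρ₁ [ toℕ i ↦ ρ₁ (k + 0) + ρ₁ (k + 1) ]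
    ρ₁0 : ρ₁ (k + 0) ≡ eval e o μ
    ρ₁0 = trans (update-other C.final 0 (<⇒≢ (+-monoʳ-< k (s≤s z≤n)))) C.result
    new : ρ₁ (k + 0) + ρ₁ (k + 1) ≡ eval e o μ
    new = trans (cong₂ _+_ ρ₁0 (update-same C.final (k + 1) 0)) (+-identityʳ _)
    vars : ∀ j → ρ₂ (toℕ j) ≡ get j (put i (eval e o μ) o)
    vars j with j Fin.≟ i
    ... | yes refl = trans (update-same ρ₁ (toℕ i) _) (trans new (sym (get-put-same i _ o)))
    ... | no j≢i = begin-equality
      ρ₂ (toℕ j)                    ≡⟨ update-other ρ₁ _ (j≢i ∘ Fin.toℕ-injective) ⟩
      ρ₁ (toℕ j)                    ≡⟨ update-other C.final 0 (k≢toℕ j 1) ⟩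
      C.final (toℕ j)               ≡⟨ C.frame (toℕ j) (<-≤-trans (Fin.toℕ<n j) (m≤m+n k 0)) ⟩
      ρ (toℕ j)                     ≡⟨ vs j ⟩
      get j o                       ≡⟨ get-put-other i j _ o j≢i ⟨
      get j (put i (eval e o μ) o)  ∎
    small : Small S (put i (eval e o μ) o)
    small j with j Fin.≟ i
    ... | yes refl = subst (λ x → bits x ≤ S) (sym (get-put-same i _ o)) (val sm)
    ... | no j≢i   = subst (λ x → bits x ≤ S) (sym (get-put-other i j _ o j≢i)) (sm j)
    eq : ∀ a s → a * s + (s + (s + s)) ≡ (a + 3) * s
    eq = solve-∀

  -- The factor m admits stored values and addresses of up to a multiple of m · S bits, at m times
  -- the cost. Assignments need no such factor, since variables stay below S.
  exec-store : ∀ m → 1 ≤ m → ∀ e f {o μ} → Loads (m * S) e o μ → Loads (m * S) f o μ →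
               Exec {k} S (e ⇐ f) (o , μ) (o , μ [ eval e o μ ↦ eval f o μ ])
                    ((effort e + effort f + (width e + width f)) * m)
  execute (exec-store m 1≤m e f {o} {μ} le lf) ⟪ ρ , .μ ⟫ (represents vs sm refl) =
    ⟪ F.final , μ [ F.final (k + 0) ↦ F.final (k + 1) ] ⟫ ,
    E.time + (F.time + (bits (F.final (k + 0)) + bits (F.final (k + 1)))) ,
    seq E.run (seq F.run Run.store) ,
    represents (λ i → trans (F.frame (toℕ i) (<-≤-trans (Fin.toℕ<n i) (m≤m+n k 1))) (vs′ i)) sm
      (cong₂ (λ x y → μ [ x ↦ y ]) left F.result) ,
    (begin
      E.time + (F.time + (bits (F.final (k + 0)) + bits (F.final (k + 1))))
        ≡⟨ cong₂ (λ x y → E.time + (F.time + (bits x + bits y))) left F.result ⟩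
      E.time + (F.time + (bits (eval e o μ) + bits (eval f o μ)))
        ≤⟨ +-mono-≤ E.cost (+-mono-≤ F.cost (+-mono-≤ (eval-bits (m * S) 1≤ e sm′ le) (eval-bits (m * S) 1≤ f sm′ lf))) ⟩
      effort e * (m * S) + (effort f * (m * S) + (width e * (m * S) + width f * (m * S)))
        ≡⟨ eq (effort e) (effort f) (width e) (width f) m S ⟩
      ((effort e + effort f + (width e + width f)) * m) * S ∎)
    where
    open ≤-Reasoning
    1≤ : 1 ≤ m * S
    1≤ = 1≤m*S 1≤m
    sm′ : Small (m * S) o
    sm′ = small-scale m 1≤m {o} sm
    module E = Computes (compute (m * S) 1≤ 0 e {ρ = ρ} vs sm′ le)
    vs′ : ∀ i → E.final (toℕ i) ≡ get i o
    vs′ i = trans (E.frame (toℕ i) (<-≤-trans (Fin.toℕ<n i) (m≤m+n k 0))) (vs i)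
    module F = Computes (compute (m * S) 1≤ 1 f {ρ = E.final} vs′ sm′ lf)
    left : F.final (k + 0) ≡ eval e o μ
    left = trans (F.frame (k + 0) (+-monoʳ-< k (s≤s z≤n))) E.result
    eq : ∀ a b c d m s → a * (m * s) + (b * (m * s) + (c * (m * s) + d * (m * s))) ≡ (a + b + (c + d)) * m * s
    eq = solve-∀

  record Tests (m : ℕ) (e : Exp k) (o : Env k) (μ : Memory) (σ : State) : Set where
    constructor tests
    field
      state   : State
      time    : ℕ
      run     : Run (compile 0 e) σ state time
      result  : reg state (k + 0) ≡ eval e o μ
      still   : Represents S (o , μ) state
      cost    : time ≤ effort e * m * S
      outcome : bits (reg state (k + 0)) ≤ width e * m * S

  test : ∀ m → 1 ≤ m → ∀ e {o μ} → Loads (m * S) e o μ → ∀ σ → Represents S (o , μ) σ → Tests m e o μ σ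
  test m 1≤m e {o} {μ} ld ⟪ ρ , .μ ⟫ (represents vs sm refl) = record
    { state   = ⟪ C.final , μ ⟫
    ; time    = C.time
    ; run     = C.run
    ; result  = C.result
    ; still   = represents (λ i → trans (C.frame (toℕ i) (<-≤-trans (Fin.toℕ<n i) (m≤m+n k 0))) (vs i)) sm refl
    ; cost    = ≤-trans C.cost (≤-reflexive (sym (*-assoc (effort e) m S)))
    ; outcome = ≤-trans (≤-reflexive (cong bits C.result)) (≤-trans (eval-bits (m * S) (1≤m*S 1≤m) e sm′ ld) (≤-reflexive (sym (*-assoc (width e) m S))))
    }
    where
    sm′ : Small (m * S) o
    sm′ = small-scale m 1≤m {o} sm
    module C = Computes (compute (m * S) (1≤m*S 1≤m) 0 e {ρ = ρ} vs sm′ ld)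

  regroup : ∀ a b c m s → a * m * s + (b * m * s + c * s) ≡ ((a + b) * m + c) * s
  regroup = solve-∀

  exec-branch-nz : ∀ m → 1 ≤ m → ∀ e {c d o μ s′ B} → Loads (m * S) e o μ → eval e o μ ≢ 0 →
                   Exec S c (o , μ) s′ B → Exec S (branch e c d) (o , μ) s′ ((effort e + width e) * m + B)
  execute (exec-branch-nz m 1≤m e {B = B} ld nz E) σ R =
    let σ′ , t , run , R′ , t≤ = execute E T.state T.still in
    σ′ , _ , seq T.run (if-nz (nz ∘ trans (sym T.result)) run) , R′ ,
    ≤-trans (+-mono-≤ T.cost (+-mono-≤ T.outcome t≤)) (≤-reflexive (regroup (effort e) (width e) B m S))
    where module T = Tests (test m 1≤m e ld σ R)

  exec-branch-z : ∀ m → 1 ≤ m → ∀ e {c d o μ s′ B} → Loads (m * S) e o μ → eval e o μ ≡ 0 →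
                  Exec S d (o , μ) s′ B → Exec S (branch e c d) (o , μ) s′ ((effort e + width e) * m + B)
  execute (exec-branch-z m 1≤m e {B = B} ld z E) σ R =
    let σ′ , t , run , R′ , t≤ = execute E T.state T.still in
    σ′ , _ , seq T.run (if-z (trans T.result z) run) , R′ ,
    ≤-trans (+-mono-≤ T.cost (+-mono-≤ T.outcome t≤)) (≤-reflexive (regroup (effort e) (width e) B m S))
    where module T = Tests (test m 1≤m e ld σ R)

  exec-while-z : ∀ m → 1 ≤ m → ∀ e {c o μ} → Loads (m * S) e o μ → eval e o μ ≡ 0 →
                 Exec S (while e c) (o , μ) (o , μ) ((effort e + width e) * m)
  execute (exec-while-z m 1≤m e ld z) σ R =
    T.state , _ , seq T.run (while-z (trans T.result z)) , T.still ,
    ≤-trans (+-mono-≤ T.cost T.outcome) (≤-reflexive (eq (effort e) (width e) m S))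
    where
    module T = Tests (test m 1≤m e ld σ R)
    eq : ∀ a b m s → a * m * s + b * m * s ≡ (a + b) * m * s
    eq = solve-∀

  exec-while-nz : ∀ m → 1 ≤ m → ∀ e {c o μ s′ s″ B B′} → Loads (m * S) e o μ → eval e o μ ≢ 0 →
                  Exec S c (o , μ) s′ B → Exec S (while e c) s′ s″ B′ →
                  Exec S (while e c) (o , μ) s″ ((effort e + width e) * m + (B + B′))
  execute (exec-while-nz m 1≤m e {c} {B = B} {B′} ld nz E W) σ R = result
    where
    module T = Tests (test m 1≤m e ld σ R)
    eq : ∀ a b B B′ m s → a * m * s + (b * m * s + (B * s + B′ * s)) ≡ ((a + b) * m + (B + B′)) * s
    eq = solve-∀
    again : ∀ a b c d e → a + (b + (c + d) + e) ≡ a + (b + (c + (d + e)))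
    again = solve-∀
    result : ∃₂ λ σ′ t → Run (while e c) σ σ′ t × Represents S _ σ′ × t ≤ ((effort e + width e) * m + (B + B′)) * S
    result with execute E T.state T.still
    ... | σ₁ , t₁ , run₁ , R₁ , t₁≤ with execute W σ₁ R₁
    -- The run of the remaining loop starts with its own test. Splitting it off supplies the test
    -- that closes the current body; only the times have to be regrouped.
    ... | σ₂ , _ , seq {σ′ = σ₃} {t = u} {t′ = u′} test′ loop′ , R₂ , t₂≤ =
      σ₂ , _ , seq T.run (while-nz (nz ∘ trans (sym T.result)) (seq run₁ test′) loop′) , R₂ ,
      ≤-trans (≤-reflexive (again T.time (bits (reg T.state (k + 0))) t₁ u u′))
        (≤-trans (+-mono-≤ T.cost (+-mono-≤ T.outcome (+-mono-≤ t₁≤ t₂≤)))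
                 (≤-reflexive (eq (effort e) (width e) B B′ m S)))

  exec-for-zero : ∀ (i : Fin k) {c o μ} → get i o ≡ 0 → Exec S (for i c) (o , μ) (o , μ) 4
  exec-for-zero i z = exec-while-z 1 ≤-refl (var i) tt z

  exec-for-suc : ∀ (i : Fin k) {c o μ o′ μ′ s″ B B′} → get i o ≢ 0 →
                 Exec S c (o , μ) (o′ , μ′) B → Exec S (for i c) (put i (get i o′ ∸ 1) o′ , μ′) s″ B′ →
                 Exec S (for i c) (o , μ) s″ (B + 13 + B′)
  exec-for-suc i {o′ = o′} {B = B} {B′} nz E F =
    exec-mono (≤-reflexive (eq B B′))
      (exec-while-nz 1 ≤-refl (var i) tt nz
        (exec-seq E (exec-assign i (var i ⊖ lit 1) (tt , tt)
          (λ sm → ≤-trans (bits-mono (m∸n≤m (get i o′) 1)) (sm i))))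
        F)
    where
    eq : ∀ B B′ → 4 + (B + 9 + B′) ≡ B + 13 + B′
    eq = solve-∀

-- Simulation with epochs

*2-injective : ∀ {x y} → x * 2 ≡ y * 2 → x ≡ y
*2-injective {x} {y} = *-cancelʳ-≡ x y 2

*2≢*2+1 : ∀ x y → x * 2 ≢ y * 2 + 1
*2≢*2+1 zero    y       p rewrite +-comm (y * 2) 1 with () ← p
*2≢*2+1 (suc x) zero    ()
*2≢*2+1 (suc x) (suc y) p = *2≢*2+1 x y (suc-injective (suc-injective p))

-- The number E of epochs is known in advance, the extent of the simulated memory is not; so the
-- epoch is the fast coordinate.
address : ℕ → ℕ → ℕ → ℕ → ℕ
address b E e i = i * E + b + e

address-< : ∀ b {E e e′ i i′} → e < E → i < i′ → address b E e i < address b E e′ i′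
address-< b {E} {e} {e′} {i} {i′} e<E i<i′ = begin-strict
  i * E + b + e    <⟨ +-monoʳ-< (i * E + b) e<E ⟩
  i * E + b + E    ≡⟨ eq (i * E) b E ⟩
  suc i * E + b    ≤⟨ +-monoˡ-≤ b (*-monoˡ-≤ E i<i′) ⟩
  i′ * E + b       ≤⟨ m≤m+n _ e′ ⟩
  i′ * E + b + e′  ∎
  where
  open ≤-Reasoning
  eq : ∀ x b E → x + b + E ≡ E + x + b
  eq = solve-∀

address-injective : ∀ b {E e e′} i i′ → e < E → e′ < E → address b E e i ≡ address b E e′ i′ → i ≡ i′ × e ≡ e′
address-injective b {E} {e} {e′} i i′ e<E e′<E p with <-cmp i i′
... | tri< lt _ _ = contradiction p (<⇒≢ (address-< b e<E lt))
... | tri> _ _ gt = contradiction (sym p) (<⇒≢ (address-< b e′<E gt))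
... | tri≈ _ refl _ = refl , +-cancelˡ-≡ (i * E + b) e e′ p

-- A cell holds the successor of its value.  A cell not yet written in the
-- current epoch holds 0, and then the value of epoch 0 is the valid one.
decode : ℕ → ℕ → ℕ → Memory → ℕ → ℕ
decode b E e μ i = μ (i * E + b + e * (1 ∸ (1 ∸ μ (address b E e i)))) ∸ 1

decode-written : ∀ b E e μ i {x} → μ (address b E e i) ≡ suc x → decode b E e μ i ≡ x
decode-written b E e μ i {x} p = begin
  μ (i * E + b + e * (1 ∸ (1 ∸ μ (address b E e i)))) ∸ 1  ≡⟨ cong (λ y → μ (i * E + b + e * (1 ∸ (1 ∸ y))) ∸ 1) p ⟩
  μ (i * E + b + e * (1 ∸ (0 ∸ x))) ∸ 1                     ≡⟨ cong (λ y → μ (i * E + b + e * (1 ∸ y)) ∸ 1) (0∸n≡0 x) ⟩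
  μ (i * E + b + e * 1) ∸ 1                                 ≡⟨ cong (λ y → μ (i * E + b + y) ∸ 1) (*-identityʳ e) ⟩
  μ (address b E e i) ∸ 1                                   ≡⟨ cong (_∸ 1) p ⟩
  x                                                         ∎
  where open ≡-Reasoning

decode-fresh : ∀ b E e μ i → μ (address b E e i) ≡ 0 → decode b E e μ i ≡ μ (i * E + b) ∸ 1
decode-fresh b E e μ i p = begin
  μ (i * E + b + e * (1 ∸ (1 ∸ μ (address b E e i)))) ∸ 1  ≡⟨ cong (λ y → μ (i * E + b + e * (1 ∸ (1 ∸ y))) ∸ 1) p ⟩
  μ (i * E + b + e * 0) ∸ 1                                 ≡⟨ cong (λ y → μ (i * E + b + y) ∸ 1) (*-zeroʳ e) ⟩
  μ (i * E + b + 0) ∸ 1                                     ≡⟨ cong (λ y → μ y ∸ 1) (+-identityʳ (i * E + b)) ⟩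
  μ (i * E + b) ∸ 1                                         ∎
  where open ≡-Reasoning

decode-update : ∀ b E e μ i x → decode b E e (μ [ address b E e i ↦ suc x ]) i ≡ x
decode-update b E e μ i x = decode-written b E e (μ [ address b E e i ↦ suc x ]) i (update-same μ (address b E e i) (suc x))

-- Decoding j reads the flag and the selected cell. Both belong to j and to an epoch at most e,
-- hence differ from the written address.
decode-update-other : ∀ b E e μ {i j} x → e < E → j ≢ i →
                      decode b E e (μ [ address b E e i ↦ suc x ]) j ≡ decode b E e μ j
decode-update-other b E e μ {i} {j} x e<E j≢i =
  trans (cong (λ y → μ′ (j * E + b + e * (1 ∸ (1 ∸ y))) ∸ 1) (elsewhere e ≤-refl))
        (cong (_∸ 1) (elsewhere (e * (1 ∸ (1 ∸ μ (address b E e j)))) (flag≤ (μ (address b E e j)))))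
  where
  μ′ : Memory
  μ′ = μ [ address b E e i ↦ suc x ]
  elsewhere : ∀ e′ → e′ ≤ e → μ′ (address b E e′ j) ≡ μ (address b E e′ j)
  elsewhere e′ e′≤e = update-other μ (suc x) λ p → j≢i (proj₁ (address-injective b j i (≤-<-trans e′≤e e<E) e<E p))
  flag≤ : ∀ y → e * (1 ∸ (1 ∸ y)) ≤ e
  flag≤ y = ≤-trans (*-monoʳ-≤ e (m∸n≤m 1 (1 ∸ y))) (≤-reflexive (*-identityʳ e))

bits-pred : ∀ y → bits y ≤ bits (y ∸ 1) + 1
bits-pred zero    = s≤s z≤n
bits-pred (suc y) = ≤-trans (≤-reflexive (cong bits (+-comm 1 y))) (bits-+ y 1)

module Virtual {k : ℕ} (base span epoch : Fin k) where

  cell : Exp k → Exp k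
  cell x = x ⊗ var span ⊕ var base ⊕ var epoch

  -- The double truncated difference is 1 for a written cell and 0 otherwise. Multiplied by the
  -- epoch it selects the address without a branch, so that a fetch can be part of an expression.
  fetch : Exp k → Exp k
  fetch x = mem[ x ⊗ var span ⊕ var base ⊕ var epoch ⊗ (lit 1 ⊖ (lit 1 ⊖ mem[ cell x ])) ] ⊖ lit 1

  save : Exp k → Exp k → Cmd
  save x y = cell x ⇐ y ⊕ lit 1

  -- Registers and memory of the simulated machine share one virtual memory, at even and odd
  -- indices.
  register address′ : Exp k → Exp k
  register x = x ⊗ lit 2
  address′ x = x ⊗ lit 2 ⊕ lit 1

  virtual : Cmd → Cmd
  virtual skip                 = skip
  virtual (r ≔ x)              = save (lit (r * 2)) (lit x)
  virtual (r ≔ s ⟨ o ⟩ s′)     = save (lit (r * 2)) (fetch (lit (s * 2)) ‹ o › fetch (lit (s′ * 2)))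
  virtual (load r a)           = save (lit (r * 2)) (fetch (address′ (fetch (lit (a * 2)))))
  virtual (store a r)          = save (address′ (fetch (lit (a * 2)))) (fetch (lit (r * 2)))
  virtual (c ⨾ d)              = virtual c ⨾ virtual d
  virtual (ifnz r then c else d) = branch (fetch (lit (r * 2))) (virtual c) (virtual d)
  virtual (whilenz r loop c)   = while (fetch (lit (r * 2))) (virtual c)

  saveEffort : Exp k → Exp k → ℕ
  saveEffort x y = (effort (cell x) + effort (y ⊕ lit 1) + (width (cell x) + width (y ⊕ lit 1))) * 2

  testEffort : Exp k → ℕ
  testEffort x = (effort (fetch x) + width (fetch x)) * 2

  overhead : Cmd → ℕ
  overhead skip                 = 1
  overhead (r ≔ x)              = saveEffort (lit (r * 2)) (lit x)
  overhead (r ≔ s ⟨ o ⟩ s′)     = saveEffort (lit (r * 2)) (fetch (lit (s * 2)) ‹ o › fetch (lit (s′ * 2)))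
  overhead (load r a)           = saveEffort (lit (r * 2)) (fetch (address′ (fetch (lit (a * 2)))))
  overhead (store a r)          = saveEffort (address′ (fetch (lit (a * 2)))) (fetch (lit (r * 2)))
  overhead (c ⨾ d)              = overhead c + overhead d
  overhead (ifnz r then c else d) = testEffort (lit (r * 2)) + overhead c + overhead d
  overhead (whilenz r loop c)   = testEffort (lit (r * 2)) + overhead c

  value : Env k → Memory → ℕ → ℕ
  value o μ = decode (get base o) (get span o) (get epoch o) μ

  place : Env k → ℕ → ℕ
  place o = address (get base o) (get span o) (get epoch o)

  record Simulates (o : Env k) (μ : Memory) (τ : State) : Set where
    constructor simulates
    field
      registers : ∀ r → value o μ (r * 2) ≡ reg τ r
      cells     : ∀ a → value o μ (a * 2 + 1) ≡ mem τ a

  -- This makes the return to epoch 0 free: a run in another epoch cannot alter its cells, nor the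
  -- input below the base.
  Untouched : Env k → Memory → Memory → Set
  Untouched o μ μ′ = ∀ x → (∀ i → x ≢ place o i) → μ′ x ≡ μ x

  -- A fetch loads twice. The flag cell is 0 or the successor of the value, and the selected cell
  -- holds a number whose predecessor is the value; the one extra bit covers the successor.
  fetch-loads : ∀ S x o μ → Loads S x o μ → bits (value o μ (eval x o μ)) + 1 ≤ S → Loads S (fetch x) o μ
  fetch-loads S x o μ ld le =
    ((((ld , tt) , tt) , tt , tt , tt , (((ld , tt) , tt) , tt) , first) , ≤-trans (bits-pred (μ (get′ x))) le) , tt
    where
    i = eval x o μ
    get′ : Exp k → ℕ
    get′ x = eval (x ⊗ var span ⊕ var base ⊕ var epoch ⊗ (lit 1 ⊖ (lit 1 ⊖ mem[ cell x ]))) o μ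
    first : bits (μ (place o i)) ≤ S
    first = nonzero (μ (place o i)) refl
      where
      nonzero : ∀ y → μ (place o i) ≡ y → bits y ≤ S
      nonzero zero    p = ≤-trans (m≤n+m 1 (bits (value o μ i))) le
      nonzero (suc y) p = ≤-trans (bits-pred (suc y)) (subst (λ z → bits z + 1 ≤ S) (decode-written (get base o) (get span o) (get epoch o) μ i p) le)

  module _ (S : ℕ) (1≤S : 1 ≤ S) where
    open Rules {k} S 1≤S

    save-correct : ∀ m → 1 ≤ m → ∀ x y {o μ} → Loads (m * S) x o μ → Loads (m * S) y o μ →
                   Exec S (save x y) (o , μ) (o , μ [ place o (eval x o μ) ↦ suc (eval y o μ) ])
                        ((effort (cell x) + effort (y ⊕ lit 1) + (width (cell x) + width (y ⊕ lit 1))) * m)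
    save-correct m 1≤m x y {o} {μ} lx ly =
      subst (λ z → Exec S (save x y) (o , μ) (o , μ [ place o (eval x o μ) ↦ z ])
                     ((effort (cell x) + effort (y ⊕ lit 1) + (width (cell x) + width (y ⊕ lit 1))) * m)) (+-comm (eval y o μ) 1)
        (exec-store m 1≤m (cell x) (y ⊕ lit 1) {o} {μ} (((lx , tt) , tt) , tt) (ly , tt))

    save-untouched : ∀ o μ i x → Untouched o μ (μ [ place o i ↦ suc x ])
    save-untouched o μ i x y y≢ = update-other μ (suc x) (y≢ i)

    private
      -- A simulated instruction of cost t handles only numbers of at most t bits. The scale 2 t
      -- leaves room for the successor.
      fetch-ok : ∀ x o μ t v → 1 ≤ t → value o μ (eval x o μ) ≡ v → bits v ≤ t →
                 Loads (2 * t * S) x o μ → Loads (2 * t * S) (fetch x) o μ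
      fetch-ok x o μ t v 1≤t refl v≤ ld = fetch-loads (2 * t * S) x o μ ld (begin
        bits v + 1  ≤⟨ +-mono-≤ v≤ 1≤t ⟩
        t + t       ≡⟨ cong (t +_) (+-identityʳ t) ⟨
        2 * t       ≤⟨ m≤m*n (2 * t) S {{>-nonZero 1≤S}} ⟩
        2 * t * S   ∎)
        where open ≤-Reasoning

      1≤2* : ∀ {t} → 1 ≤ t → 1 ≤ 2 * t
      1≤2* {t} 1≤t = ≤-trans 1≤t (m≤m+n t _)

      save-at : ∀ x y {o μ i v t} → 1 ≤ t → eval x o μ ≡ i → eval y o μ ≡ v →
                Loads (2 * t * S) x o μ → Loads (2 * t * S) y o μ →
                Exec S (save x y) (o , μ) (o , μ [ place o i ↦ suc v ]) (saveEffort x y * t)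
      save-at x y {t = t} 1≤t refl refl lx ly =
        exec-mono (≤-reflexive (eq (effort (cell x) + effort (y ⊕ lit 1) + (width (cell x) + width (y ⊕ lit 1))) t))
          (save-correct (2 * t) (1≤2* 1≤t) x y lx ly)
        where
        eq : ∀ a t → a * (2 * t) ≡ a * 2 * t
        eq = solve-∀

    module _ {o : Env k} (e<E : get epoch o < get span o) where

      simulates-register : ∀ {μ ρ ν} r x → Simulates o μ ⟪ ρ , ν ⟫ →
                           Simulates o (μ [ place o (r * 2) ↦ suc x ]) ⟪ ρ [ r ↦ x ] , ν ⟫
      simulates-register {μ} {ρ} {ν} r x (simulates rs cs) = simulates rs′ λ a →
          trans (decode-update-other _ _ _ μ x e<E (*2≢*2+1 r a ∘ sym)) (cs a)
        where
        rs′ : ∀ r′ → value o (μ [ place o (r * 2) ↦ suc x ]) (r′ * 2) ≡ (ρ [ r ↦ x ]) r′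
        rs′ r′ with r′ ≟ r
        ... | yes refl = trans (decode-update _ _ _ μ (r * 2) x) (sym (update-same ρ r x))
        ... | no r′≢r  = trans (decode-update-other _ _ _ μ x e<E (r′≢r ∘ *2-injective)) (trans (rs r′) (sym (update-other ρ x r′≢r)))

      simulates-cell : ∀ {μ ρ ν} a x → Simulates o μ ⟪ ρ , ν ⟫ →
                       Simulates o (μ [ place o (a * 2 + 1) ↦ suc x ]) ⟪ ρ , ν [ a ↦ x ] ⟫
      simulates-cell {μ} {ρ} {ν} a x (simulates rs cs) = simulates
          (λ r → trans (decode-update-other _ _ _ μ x e<E (*2≢*2+1 r a)) (rs r)) cs′
        where
        cs′ : ∀ a′ → value o (μ [ place o (a * 2 + 1) ↦ suc x ]) (a′ * 2 + 1) ≡ (ν [ a ↦ x ]) a′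
        cs′ a′ with a′ ≟ a
        ... | yes refl = trans (decode-update _ _ _ μ (a * 2 + 1) x) (sym (update-same ν a x))
        ... | no a′≢a  = trans (decode-update-other _ _ _ μ x e<E (a′≢a ∘ *2-injective ∘ +-cancelʳ-≡ 1 _ _)) (trans (cs a′) (sym (update-other ν x a′≢a)))

      untouched-trans : ∀ {μ μ′ μ″} → Untouched o μ μ′ → Untouched o μ′ μ″ → Untouched o μ μ″
      untouched-trans u u′ x x≢ = trans (u′ x x≢) (u x x≢)

      Simulation : Cmd → Memory → State → ℕ → Set
      Simulation c μ τ B = ∃ λ μ′ → Exec S c (o , μ) (o , μ′) B × Simulates o μ′ τ × Untouched o μ μ′

      -- Induction on the run. The cost of a simulated instruction already counts the lengths of its
      -- numbers, so `overhead` is a constant of the program, and the unit S accounts for base, span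
      -- and epoch in the addresses.
      simulate : ∀ {c τ τ′ t} → Run c τ τ′ t → ∀ {μ} → Simulates o μ τ → Simulation (virtual c) μ τ′ (overhead c * t)
      simulate skip {μ} sim = μ , exec-skip , sim , λ x x≢ → refl
      simulate (set {r} {x}) {μ} sim = _ ,
        save-at (lit (r * 2)) (lit x) {o} {μ} (1≤bits x) refl refl tt tt ,
        simulates-register r x sim ,
        save-untouched o μ (r * 2) x
      simulate (op {r} {s} {⊙} {s′} {ρ} {ν}) {μ} sim@(simulates rs cs) = _ ,
        save-at (lit (r * 2)) (fetch (lit (s * 2)) ‹ ⊙ › fetch (lit (s′ * 2))) {o} {μ} 1≤t refl (cong₂ ⟦ ⊙ ⟧ (rs s) (rs s′)) tt
          ( fetch-ok (lit (s * 2)) o μ t (ρ s) 1≤t (rs s) (m≤m+n (bits (ρ s)) (bits (ρ s′))) tt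
          , fetch-ok (lit (s′ * 2)) o μ t (ρ s′) 1≤t (rs s′) (m≤n+m (bits (ρ s′)) (bits (ρ s))) tt) ,
        simulates-register r _ sim ,
        save-untouched o μ (r * 2) _
        where
        t = bits (ρ s) + bits (ρ s′)
        1≤t : 1 ≤ t
        1≤t = m≤n⇒m≤n+o _ (1≤bits (ρ s))
      simulate (load {r} {a} {ρ} {ν}) {μ} sim@(simulates rs cs) = _ ,
        save-at (lit (r * 2)) (fetch (address′ (fetch (lit (a * 2))))) {o} {μ} 1≤t refl inner tt
          (fetch-ok (address′ (fetch (lit (a * 2)))) o μ t (ν (ρ a)) 1≤t inner (m≤n+m (bits (ν (ρ a))) (bits (ρ a)))
            ((fetch-ok (lit (a * 2)) o μ t (ρ a) 1≤t (rs a) (m≤m+n (bits (ρ a)) (bits (ν (ρ a)))) tt , tt) , tt)) ,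
        simulates-register r _ sim ,
        save-untouched o μ (r * 2) _
        where
        t = bits (ρ a) + bits (ν (ρ a))
        1≤t : 1 ≤ t
        1≤t = m≤n⇒m≤n+o _ (1≤bits (ρ a))
        inner : value o μ (value o μ (a * 2) * 2 + 1) ≡ ν (ρ a)
        inner = trans (cong (λ x → value o μ (x * 2 + 1)) (rs a)) (cs (ρ a))
      simulate (store {a} {r} {ρ} {ν}) {μ} sim@(simulates rs cs) = _ ,
        save-at (address′ (fetch (lit (a * 2)))) (fetch (lit (r * 2))) {o} {μ} 1≤t (cong (λ x → x * 2 + 1) (rs a)) (rs r)
          ((fetch-ok (lit (a * 2)) o μ t (ρ a) 1≤t (rs a) (m≤m+n (bits (ρ a)) (bits (ρ r))) tt , tt) , tt)
          (fetch-ok (lit (r * 2)) o μ t (ρ r) 1≤t (rs r) (m≤n+m (bits (ρ r)) (bits (ρ a))) tt) ,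
        simulates-cell (ρ a) (ρ r) sim ,
        save-untouched o μ (ρ a * 2 + 1) _
        where
        t = bits (ρ a) + bits (ρ r)
        1≤t : 1 ≤ t
        1≤t = m≤n⇒m≤n+o _ (1≤bits (ρ a))
      simulate (seq {c} {d} {t = t} {t′} run run′) sim
        with μ₁ , E , sim₁ , u₁ ← simulate run sim
        with μ₂ , F , sim₂ , u₂ ← simulate run′ sim₁ =
          μ₂ , exec-mono (≤-from (overhead c * t′ + overhead d * t) (eq (overhead c) (overhead d) t t′)) (exec-seq E F) ,
          sim₂ , untouched-trans u₁ u₂
        where
        eq : ∀ a b t t′ → (a + b) * (t + t′) ≡ a * t + b * t′ + (a * t′ + b * t)
        eq = solve-∀
      simulate (if-nz {r} {c} {d} {σ} {t = t} nz run) {μ} sim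
        with μ₁ , E , sim₁ , u₁ ← simulate run sim =
          μ₁ , exec-mono (≤-from ((testEffort (lit (r * 2)) + overhead d) * t + (overhead c + overhead d) * b) (eq (effort f + width f) (overhead c) (overhead d) b t))
                 (exec-branch-nz (2 * b) (1≤2* (1≤bits (reg σ r))) f
                   (fetch-ok (lit (r * 2)) o μ b (reg σ r) (1≤bits (reg σ r)) (Simulates.registers sim r) ≤-refl tt)
                   (nz ∘ trans (sym (Simulates.registers sim r))) E) ,
          sim₁ , u₁
        where
        b = bits (reg σ r)
        f = fetch (lit (r * 2))
        eq : ∀ x c d b t → (x * 2 + c + d) * (b + t) ≡ x * (2 * b) + c * t + ((x * 2 + d) * t + (c + d) * b)
        eq = solve-∀
      simulate (if-z {r} {c} {d} {σ} {t = t} z run) {μ} sim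
        with μ₁ , E , sim₁ , u₁ ← simulate run sim =
          μ₁ , exec-mono (≤-from ((testEffort (lit (r * 2)) + overhead c) * t + (overhead c + overhead d) * b) (eq (effort f + width f) (overhead c) (overhead d) b t))
                 (exec-branch-z (2 * b) (1≤2* (1≤bits (reg σ r))) f
                   (fetch-ok (lit (r * 2)) o μ b (reg σ r) (1≤bits (reg σ r)) (Simulates.registers sim r) ≤-refl tt)
                   (trans (Simulates.registers sim r) z) E) ,
          sim₁ , u₁
        where
        b = bits (reg σ r)
        f = fetch (lit (r * 2))
        eq : ∀ x c d b t → (x * 2 + c + d) * (b + t) ≡ x * (2 * b) + d * t + ((x * 2 + c) * t + (c + d) * b)
        eq = solve-∀
      simulate (while-nz {r} {c} {σ} {t = t} {t′} nz run run′) {μ} sim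
        with μ₁ , E , sim₁ , u₁ ← simulate run sim
        with μ₂ , F , sim₂ , u₂ ← simulate run′ sim₁ =
          μ₂ , exec-mono (≤-from (testEffort (lit (r * 2)) * t + overhead c * b) (eq (effort f + width f) (overhead c) b t t′))
                 (exec-while-nz (2 * b) (1≤2* (1≤bits (reg σ r))) f
                   (fetch-ok (lit (r * 2)) o μ b (reg σ r) (1≤bits (reg σ r)) (Simulates.registers sim r) ≤-refl tt)
                   (nz ∘ trans (sym (Simulates.registers sim r))) E F) ,
          sim₂ , untouched-trans u₁ u₂
        where
        b = bits (reg σ r)
        f = fetch (lit (r * 2))
        eq : ∀ x c b t t′ → (x * 2 + c) * (b + t + t′) ≡ x * (2 * b) + (c * t + (x * 2 + c) * t′) + (x * 2 * t + c * b)
        eq = solve-∀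
      simulate (while-z {r} {c} {σ} z) {μ} sim =
        μ , exec-mono (≤-from (overhead c * b) (eq (effort f + width f) (overhead c) b))
              (exec-while-z (2 * b) (1≤2* (1≤bits (reg σ r))) f
                (fetch-ok (lit (r * 2)) o μ b (reg σ r) (1≤bits (reg σ r)) (Simulates.registers sim r) ≤-refl tt)
                (trans (Simulates.registers sim r) z)) ,
        sim , λ x x≢ → refl
        where
        b = bits (reg σ r)
        f = fetch (lit (r * 2))
        eq : ∀ x c b → (x * 2 + c) * b ≡ x * (2 * b) + c * b
        eq = solve-∀

-- The grid and its drawing

-- Built with `mkℚ`, so that the numerator is visible without normalising a fraction; injectivity
-- and monotonicity then come from the integers.
ι : ℕ → ℚ
ι n = mkℚ (ℤ.+ n) 0 (Coprime.sym (Coprime.1-coprimeTo n))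

ι-injective : ∀ {m n} → ι m ≡ ι n → m ≡ n
ι-injective p = ℤ.+-injective (cong ℚ.numerator p)

ι-mono : ∀ {m n} → m ≤ n → ι m ℚ.≤ ι n
ι-mono m≤n = ℚ.*≤* (ℤ.*-monoʳ-≤-nonNeg (ℤ.+ 1) (ℤ.+≤+ m≤n))

ι-cancel : ∀ {m n} → ι m ℚ.≤ ι n → m ≤ n
ι-cancel {m} {n} (ℚ.*≤* p) = ℤ.drop‿+≤+ (subst₂ ℤ._≤_ (ℤ.*-identityʳ (ℤ.+ m)) (ℤ.*-identityʳ (ℤ.+ n)) p)

ι-suc : ∀ n → ι n ℚ.≤ ι (suc n)
ι-suc n = ι-mono (n≤1+n n)

module _ where
  open +-*-Solver

  convex-const : ∀ t a → (1ℚ ℚ.- t) ℚ.* a ℚ.+ t ℚ.* a ≡ a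
  convex-const = solve 2 (λ t a → (con 1ℚ :- t) :* a :+ t :* a := a) refl

convex-lower : ∀ {t a b} → 0ℚ ℚ.≤ t → a ℚ.≤ b → a ℚ.≤ (1ℚ ℚ.- t) ℚ.* a ℚ.+ t ℚ.* b
convex-lower {t} {a} {b} 0≤t a≤b = subst (ℚ._≤ (1ℚ ℚ.- t) ℚ.* a ℚ.+ t ℚ.* b) (convex-const t a)
  (ℚ.+-monoʳ-≤ ((1ℚ ℚ.- t) ℚ.* a) (ℚ.*-monoˡ-≤-nonNeg t {{ℚ.nonNegative 0≤t}} a≤b))

convex-upper : ∀ {t a b} → t ℚ.≤ 1ℚ → a ℚ.≤ b → (1ℚ ℚ.- t) ℚ.* a ℚ.+ t ℚ.* b ℚ.≤ b
convex-upper {t} {a} {b} t≤1 a≤b = subst ((1ℚ ℚ.- t) ℚ.* a ℚ.+ t ℚ.* b ℚ.≤_) (convex-const t b)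
  (ℚ.+-monoˡ-≤ (t ℚ.* b) (ℚ.*-monoˡ-≤-nonNeg (1ℚ ℚ.- t) {{ℚ.nonNegative (subst (ℚ._≤ 1ℚ ℚ.- t) (ℚ.+-inverseʳ t) (ℚ.+-monoˡ-≤ (ℚ.- t) t≤1))}} a≤b))

module Grid (h m : ℕ) where

  rows columns vertices size : ℕ
  rows     = suc h
  columns  = suc m
  vertices = rows * columns
  size     = h * columns + rows * m

  -- Vertical edges are numbered first, row by row, so a middle edge has the index columns · N′ + c,
  -- which the program can compute.
  vertical : Fin h → Fin columns → Fin size
  vertical y c = combine y c ↑ˡ (rows * m)

  horizontal : Fin rows → Fin m → Fin size
  horizontal y c = (h * columns) ↑ʳ combine y c

  data View : Fin size → Set where
    isVertical   : ∀ y c → View (vertical y c)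
    isHorizontal : ∀ y c → View (horizontal y c)

  view : ∀ e → View e
  view e with splitAt (h * columns) e in eq
  ... | inj₁ i = subst View
          (trans (cong (_↑ˡ (rows * m)) (Fin.combine-remQuot {h} columns i)) (Fin.splitAt⁻¹-↑ˡ eq))
          (isVertical (proj₁ (remQuot {h} columns i)) (proj₂ (remQuot {h} columns i)))
  ... | inj₂ i = subst View
          (trans (cong ((h * columns) ↑ʳ_) (Fin.combine-remQuot {rows} m i)) (Fin.splitAt⁻¹-↑ʳ eq))
          (isHorizontal (proj₁ (remQuot {rows} m i)) (proj₂ (remQuot {rows} m i)))

  verticalEnds : Fin h × Fin columns → Fin vertices × Fin vertices
  verticalEnds (y , c) = combine (inject₁ y) c , combine (Fin.suc y) c

  horizontalEnds : Fin rows × Fin m → Fin vertices × Fin vertices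
  horizontalEnds (y , c) = combine y (inject₁ c) , combine y (Fin.suc c)

  ends : Fin size → Fin vertices × Fin vertices
  ends e = [ verticalEnds ∘ remQuot {h} columns , horizontalEnds ∘ remQuot {rows} m ] (splitAt (h * columns) e)

  ends-vertical : ∀ y c → ends (vertical y c) ≡ verticalEnds (y , c)
  ends-vertical y c rewrite Fin.splitAt-↑ˡ (h * columns) (combine y c) (rows * m) =
    cong verticalEnds (Fin.remQuot-combine y c)

  ends-horizontal : ∀ y c → ends (horizontal y c) ≡ horizontalEnds (y , c)
  ends-horizontal y c rewrite Fin.splitAt-↑ʳ (h * columns) (rows * m) (combine y c) =
    cong horizontalEnds (Fin.remQuot-combine y c)

  ordered : ∀ e → proj₁ (ends e) Fin.< proj₂ (ends e)
  ordered e with view e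
  ... | isVertical y c rewrite ends-vertical y c =
    Fin.combine-monoˡ-< {i = inject₁ y} {Fin.suc y} c c (≤-reflexive (cong suc (Fin.toℕ-inject₁ y)))
  ... | isHorizontal y c rewrite ends-horizontal y c = begin-strict
    toℕ (combine y (inject₁ c))        ≡⟨ Fin.toℕ-combine y (inject₁ c) ⟩
    columns * toℕ y + toℕ (inject₁ c)  ≡⟨ cong ((columns * toℕ y) +_) (Fin.toℕ-inject₁ c) ⟩
    columns * toℕ y + toℕ c            <⟨ +-monoʳ-< (columns * toℕ y) ≤-refl ⟩
    columns * toℕ y + suc (toℕ c)      ≡⟨ Fin.toℕ-combine y (Fin.suc c) ⟨
    toℕ (combine y (Fin.suc c))        ∎
    where open ≤-Reasoning

  suc≢inject₁ : ∀ {n} {i : Fin n} → Fin.suc i ≢ inject₁ i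
  suc≢inject₁ {i = i} p = 1+n≢n (trans (cong toℕ p) (Fin.toℕ-inject₁ i))

  -- A horizontal edge stays in its row, a vertical one leaves it.
  crosswise : ∀ y c y′ c′ → verticalEnds (y , c) ≢ horizontalEnds (y′ , c′)
  crosswise y c y′ c′ p = suc≢inject₁ (trans
    (Fin.combine-injectiveˡ (Fin.suc y) c y′ (Fin.suc c′) (cong proj₂ p))
    (sym (Fin.combine-injectiveˡ (inject₁ y) c y′ (inject₁ c′) (cong proj₁ p))))

  distinct : Injective _≡_ _≡_ ends
  distinct {e} {f} p with view e | view f
  ... | isVertical y c   | isVertical y′ c′
    with q , refl ← Fin.combine-injective (inject₁ y) c (inject₁ y′) c′
           (cong proj₁ (trans (sym (ends-vertical y c)) (trans p (ends-vertical y′ c′))))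
    rewrite Fin.inject₁-injective q = refl
  ... | isHorizontal y c | isHorizontal y′ c′
    with refl , q ← Fin.combine-injective y (inject₁ c) y′ (inject₁ c′)
           (cong proj₁ (trans (sym (ends-horizontal y c)) (trans p (ends-horizontal y′ c′))))
    rewrite Fin.inject₁-injective q = refl
  ... | isVertical y c   | isHorizontal y′ c′ =
    contradiction (trans (sym (ends-vertical y c)) (trans p (ends-horizontal y′ c′))) (crosswise y c y′ c′)
  ... | isHorizontal y c | isVertical y′ c′ =
    contradiction (trans (sym (ends-vertical y′ c′)) (trans (sym p) (ends-horizontal y c))) (crosswise y′ c′ y c)

  grid : Graph vertices
  grid = record { size = size ; ends = ends ; ordered = ordered ; distinct = distinct }

  open Graph grid using (Incident; source; target)

  point : Fin rows × Fin columns → Point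
  point (y , c) = ι (toℕ c) , ι (toℕ y)

  position : Fin vertices → Point
  position v = point (remQuot {rows} columns v)

  position-combine : ∀ y c → position (combine y c) ≡ point (y , c)
  position-combine y c = cong point (Fin.remQuot-combine y c)

  position-injective : Injective _≡_ _≡_ position
  position-injective {u} {v} p = begin
    u                                                   ≡⟨ Fin.combine-remQuot {rows} columns u ⟨
    uncurry combine (remQuot {rows} columns u)  ≡⟨ cong₂ combine (Fin.toℕ-injective (ι-injective (cong proj₂ p))) (Fin.toℕ-injective (ι-injective (cong proj₁ p))) ⟩
    uncurry combine (remQuot {rows} columns v)  ≡⟨ Fin.combine-remQuot {rows} columns v ⟩
    v                                                   ∎
    where open ≡-Reasoning

  bends : Fin size → List Point
  bends e = []

  path : Fin size → List Point
  path e = position (source e) ∷ bends e ++ position (target e) ∷ []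

  OnVertical : Fin h → Fin columns → Point → Set
  OnVertical y c (p₁ , p₂) = p₁ ≡ ι (toℕ c) × ι (toℕ y) ℚ.≤ p₂ × p₂ ℚ.≤ ι (suc (toℕ y))

  OnHorizontal : Fin rows → Fin m → Point → Set
  OnHorizontal y c (p₁ , p₂) = p₂ ≡ ι (toℕ y) × ι (toℕ c) ℚ.≤ p₁ × p₁ ℚ.≤ ι (suc (toℕ c))

  on-vertical : ∀ y c {p} → OnPath (path (vertical y c)) p → OnVertical y c p
  on-vertical y c {p} (inj₁ on) = segment (subst₂ (λ a b → OnSegment a b p) left right on)
    where
    left : position (source (vertical y c)) ≡ (ι (toℕ c) , ι (toℕ y))
    left = trans (cong (position ∘ proj₁) (ends-vertical y c)) (trans (position-combine (inject₁ y) c) (cong (λ i → ι (toℕ c) , ι i) (Fin.toℕ-inject₁ y)))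
    right : position (target (vertical y c)) ≡ (ι (toℕ c) , ι (suc (toℕ y)))
    right = trans (cong (position ∘ proj₂) (ends-vertical y c)) (position-combine (Fin.suc y) c)
    segment : OnSegment (ι (toℕ c) , ι (toℕ y)) (ι (toℕ c) , ι (suc (toℕ y))) p → OnVertical y c p
    segment (t , 0≤t , t≤1 , refl , refl) =
      convex-const t (ι (toℕ c)) , convex-lower 0≤t (ι-suc (toℕ y)) , convex-upper t≤1 (ι-suc (toℕ y))

  on-horizontal : ∀ y c {p} → OnPath (path (horizontal y c)) p → OnHorizontal y c p
  on-horizontal y c {p} (inj₁ on) = segment (subst₂ (λ a b → OnSegment a b p) left right on)
    where
    left : position (source (horizontal y c)) ≡ (ι (toℕ c) , ι (toℕ y))
    left = trans (cong (position ∘ proj₁) (ends-horizontal y c)) (trans (position-combine y (inject₁ c)) (cong (λ i → ι i , ι (toℕ y)) (Fin.toℕ-inject₁ c)))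
    right : position (target (horizontal y c)) ≡ (ι (suc (toℕ c)) , ι (toℕ y))
    right = trans (cong (position ∘ proj₂) (ends-horizontal y c)) (position-combine y (Fin.suc c))
    segment : OnSegment (ι (toℕ c) , ι (toℕ y)) (ι (suc (toℕ c)) , ι (toℕ y)) p → OnHorizontal y c p
    segment (t , 0≤t , t≤1 , refl , refl) =
      convex-const t (ι (toℕ y)) , convex-lower 0≤t (ι-suc (toℕ c)) , convex-upper t≤1 (ι-suc (toℕ c))

  -- No row lies strictly between two consecutive ones, so a grid point on the segment is one of its
  -- ends.
  incident-vertical : ∀ y c y′ → toℕ y ≤ toℕ y′ → toℕ y′ ≤ suc (toℕ y) → Incident (combine y′ c) (vertical y c)
  incident-vertical y c y′ lo hi with m≤n⇒m<n∨m≡n lo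
  ... | inj₂ eq = inj₁ (trans (cong (λ i → combine i c) (Fin.toℕ-injective (trans (sym eq) (sym (Fin.toℕ-inject₁ y))))) (sym (cong proj₁ (ends-vertical y c))))
  ... | inj₁ lt = inj₂ (trans (cong (λ i → combine i c) (Fin.toℕ-injective (≤-antisym hi lt))) (sym (cong proj₂ (ends-vertical y c))))

  incident-horizontal : ∀ y c c′ → toℕ c ≤ toℕ c′ → toℕ c′ ≤ suc (toℕ c) → Incident (combine y c′) (horizontal y c)
  incident-horizontal y c c′ lo hi with m≤n⇒m<n∨m≡n lo
  ... | inj₂ eq = inj₁ (trans (cong (combine y) (Fin.toℕ-injective (trans (sym eq) (sym (Fin.toℕ-inject₁ c))))) (sym (cong proj₁ (ends-horizontal y c))))
  ... | inj₁ lt = inj₂ (trans (cong (combine y) (Fin.toℕ-injective (≤-antisym hi lt))) (sym (cong proj₂ (ends-horizontal y c))))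

  avoids-vertices : ∀ e v → OnPath (path e) (position v) → Incident v e
  avoids-vertices e v on with view e
  ... | isVertical y c
    with p , lo , hi ← on-vertical y c on =
    subst (λ u → Incident u (vertical y c))
      (trans (cong (combine (proj₁ (remQuot {rows} columns v))) (Fin.toℕ-injective (sym (ι-injective p)))) (Fin.combine-remQuot {rows} columns v))
      (incident-vertical y c (proj₁ (remQuot {rows} columns v)) (ι-cancel lo) (ι-cancel hi))
  ... | isHorizontal y c
    with p , lo , hi ← on-horizontal y c on =
    subst (λ u → Incident u (horizontal y c))
      (trans (cong (λ i → combine i (proj₂ (remQuot {rows} columns v))) (Fin.toℕ-injective (sym (ι-injective p)))) (Fin.combine-remQuot {rows} columns v))
      (incident-horizontal y c (proj₂ (remQuot {rows} columns v)) (ι-cancel lo) (ι-cancel hi))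

  Meet : Fin size → Fin size → Point → Set
  Meet e f p = ∃[ v ] p ≡ position v × Incident v e × Incident v f

  meet-sym : ∀ {e f p} → Meet e f p → Meet f e p
  meet-sym (v , p , i , j) = v , p , j , i

  meet : ∀ {e f p₁ p₂} y c → p₁ ≡ ι (toℕ c) → p₂ ≡ ι (toℕ y) → Incident (combine y c) e → Incident (combine y c) f → Meet e f (p₁ , p₂)
  meet y c p q i j = combine y c , trans (cong₂ _,_ p q) (sym (position-combine y c)) , i , j

  -- If y < y′, a common point has height at most y + 1 and at least y′, hence it is the shared end.
  stacked : ∀ y y′ c {p} → toℕ y < toℕ y′ → OnVertical y c p → OnVertical y′ c p → Meet (vertical y c) (vertical y′ c) p
  stacked y y′ c {p} y<y′ (p≡ , _ , hi) (_ , lo , _) =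
    meet (Fin.suc y) c p≡ (ℚ.≤-antisym hi (ℚ.≤-trans (ι-mono y<y′) lo))
      (incident-vertical y c (Fin.suc y) (n≤1+n (toℕ y)) ≤-refl)
      (incident-vertical y′ c (Fin.suc y) (ι-cancel (ℚ.≤-trans lo hi)) (≤-trans y<y′ (n≤1+n (toℕ y′))))

  adjoining : ∀ y c c′ {p} → toℕ c < toℕ c′ → OnHorizontal y c p → OnHorizontal y c′ p → Meet (horizontal y c) (horizontal y c′) p
  adjoining y c c′ {p} c<c′ (p≡ , _ , hi) (_ , lo , _) =
    meet y (Fin.suc c) (ℚ.≤-antisym hi (ℚ.≤-trans (ι-mono c<c′) lo)) p≡
      (incident-horizontal y c (Fin.suc c) (n≤1+n (toℕ c)) ≤-refl)
      (incident-horizontal y c′ (Fin.suc c) (ι-cancel (ℚ.≤-trans lo hi)) (≤-trans c<c′ (n≤1+n (toℕ c′))))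

  -- The vertical edge fixes an integral first coordinate of the common point and the horizontal
  -- edge an integral second one, so the point is a vertex.
  crossing : ∀ y c y′ c′ {p} → OnVertical y c p → OnHorizontal y′ c′ p → Meet (vertical y c) (horizontal y′ c′) p
  crossing y c y′ c′ (refl , lo , hi) (refl , lo′ , hi′) =
    meet y′ c refl refl (incident-vertical y c y′ (ι-cancel lo) (ι-cancel hi)) (incident-horizontal y′ c′ c (ι-cancel lo′) (ι-cancel hi′))

  no-crossing : ∀ e f p → e ≢ f → OnPath (path e) p → OnPath (path f) p → Meet e f p
  no-crossing e f p e≢f on on′ with view e | view f
  ... | isVertical y c   | isHorizontal y′ c′ = crossing y c y′ c′ (on-vertical y c on) (on-horizontal y′ c′ on′)
  ... | isHorizontal y c | isVertical y′ c′   = meet-sym (crossing y′ c′ y c (on-vertical y′ c′ on′) (on-horizontal y c on))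
  ... | isVertical y c   | isVertical y′ c′
    with on-vertical y c on | on-vertical y′ c′ on′
  ... | v@(p≡ , _) | v′@(p≡′ , _)
    with refl ← Fin.toℕ-injective {i = c} {c′} (ι-injective (trans (sym p≡) p≡′))
    with <-cmp (toℕ y) (toℕ y′)
  ... | tri< lt _ _ = stacked y y′ c lt v v′
  ... | tri> _ _ gt = meet-sym (stacked y′ y c gt v′ v)
  ... | tri≈ _ eq _ with refl ← Fin.toℕ-injective eq = contradiction refl e≢f
  no-crossing e f p e≢f on on′ | isHorizontal y c | isHorizontal y′ c′
    with on-horizontal y c on | on-horizontal y′ c′ on′
  ... | v@(p≡ , _) | v′@(p≡′ , _)
    with refl ← Fin.toℕ-injective {i = y} {y′} (ι-injective (trans (sym p≡) p≡′))
    with <-cmp (toℕ c) (toℕ c′)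
  ... | tri< lt _ _ = adjoining y c c′ lt v v′
  ... | tri> _ _ gt = meet-sym (adjoining y c′ c gt v′ v)
  ... | tri≈ _ eq _ with refl ← Fin.toℕ-injective eq = contradiction refl e≢f

  planar : Planar grid
  planar = record
    { position           = position
    ; bends              = bends
    ; position-injective = position-injective
    ; avoids-vertices    = avoids-vertices
    ; no-crossing        = no-crossing
    }

-- Distances in the weighted grid

-- This is ∣ a - b ∣ ≤ x, as two inequalities without subtraction.
Lipschitz : ℕ → ℕ → ℕ → Set
Lipschitz a b x = a ≤ b + x × b ≤ a + x

lipschitz-≡ : ∀ {a b x} → a + x ≡ b → Lipschitz a b x
lipschitz-≡ {a} {x = x} refl = ≤-trans (m≤m+n a x) (m≤m+n (a + x) x) , ≤-refl

lipschitz-sym : ∀ {a b x} → Lipschitz a b x → Lipschitz b a x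
lipschitz-sym (p , q) = q , p

lipschitz-∸ : ∀ t {a b x} → Lipschitz a b x → Lipschitz (t ∸ a) (t ∸ b) x
lipschitz-∸ t {a} {b} {x} (a≤ , b≤) = flip b≤ , flip a≤
  where
  flip : ∀ {a b} → a ≤ b + x → t ∸ b ≤ t ∸ a + x
  flip {a} {b} a≤ = m≤n+o⇒m∸n≤o t b (begin
    t                  ≤⟨ m≤n+m∸n t a ⟩
    a + (t ∸ a)        ≤⟨ +-monoˡ-≤ (t ∸ a) a≤ ⟩
    b + x + (t ∸ a)    ≡⟨ eq b x (t ∸ a) ⟩
    b + (t ∸ a + x)    ∎)
    where
    open ≤-Reasoning
    eq : ∀ b x d → b + x + d ≡ b + (d + x)
    eq = solve-∀

module Walks {n} (G : Graph n) (ω : Graph.Weighting G) where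
  open Graph G

  Short : Fin n → Fin n → ℕ → Set
  Short u v x = ∃ λ (p : Walk u v) → walkLength ω p ≤ x

  joins-sym : ∀ {e u v} → Joins e u v → Joins e v u
  joins-sym (inj₁ p) = inj₂ p
  joins-sym (inj₂ p) = inj₁ p

  append : ∀ {u v w} → Walk u v → Walk v w → Walk u w
  append here         q = q
  append (step e j p) q = step e j (append p q)

  append-length : ∀ {u v w} (p : Walk u v) (q : Walk v w) → walkLength ω (append p q) ≡ walkLength ω p + walkLength ω q
  append-length here         q = refl
  append-length (step e j p) q = trans (cong (ω e +_) (append-length p q)) (sym (+-assoc (ω e) (walkLength ω p) (walkLength ω q)))

  reverse : ∀ {u v} → Walk u v → Walk v u
  reverse here         = here
  reverse (step e j p) = append (reverse p) (step e (joins-sym j) here)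

  reverse-length : ∀ {u v} (p : Walk u v) → walkLength ω (reverse p) ≡ walkLength ω p
  reverse-length here = refl
  reverse-length (step e j p) = begin
    walkLength ω (append (reverse p) (step e (joins-sym j) here))  ≡⟨ append-length (reverse p) _ ⟩
    walkLength ω (reverse p) + (ω e + 0)                           ≡⟨ cong₂ _+_ (reverse-length p) (+-identityʳ (ω e)) ⟩
    walkLength ω p + ω e                                           ≡⟨ +-comm (walkLength ω p) (ω e) ⟩
    ω e + walkLength ω p                                           ∎
    where open ≡-Reasoning

  short-refl : ∀ {u} → Short u u 0
  short-refl = here , z≤n

  short-edge : ∀ e → Short (source e) (target e) (ω e)
  short-edge e = step e (inj₁ refl) here , ≤-reflexive (+-identityʳ (ω e))

  short-trans : ∀ {u v w x y} → Short u v x → Short v w y → Short u w (x + y)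
  short-trans (p , p≤) (q , q≤) = append p q , ≤-trans (≤-reflexive (append-length p q)) (+-mono-≤ p≤ q≤)

  short-sym : ∀ {u v x} → Short u v x → Short v u x
  short-sym (p , p≤) = reverse p , ≤-trans (≤-reflexive (reverse-length p)) p≤

  short-mono : ∀ {u v x y} → x ≤ y → Short u v x → Short u v y
  short-mono x≤y (p , p≤) = p , ≤-trans p≤ x≤y

  -- A feasible potential, the dual certificate for shortest paths: it bounds all walks from below
  -- without any analysis of their shape.
  potential : (f : Fin n → ℕ) → (∀ e → Lipschitz (f (source e)) (f (target e)) (ω e)) →
              ∀ {u v} (p : Walk u v) → f v ≤ f u + walkLength ω p
  potential f lip {u} here = m≤m+n (f u) 0
  potential f lip {u} {v} (step {v = t} e j p) = begin
    f v                               ≤⟨ potential f lip p ⟩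
    f t + walkLength ω p              ≤⟨ +-monoˡ-≤ (walkLength ω p) (edge j) ⟩
    f u + ω e + walkLength ω p        ≡⟨ +-assoc (f u) (ω e) (walkLength ω p) ⟩
    f u + (ω e + walkLength ω p)      ∎
    where
    open ≤-Reasoning
    edge : ∀ {u t} → Joins e u t → f t ≤ f u + ω e
    edge (inj₁ q) rewrite sym (cong proj₁ q) | sym (cong proj₂ q) = proj₂ (lip e)
    edge (inj₂ q) rewrite sym (cong proj₁ q) | sym (cong proj₂ q) = proj₁ (lip e)

-- Rows are counted outwards from the middle: the row low k is N′ ∸ k and
-- the row up k is N′ + 1 + k.
module Metric (N′ m : ℕ) (1≤m : 1 ≤ m) where

  open Grid (N′ + suc N′) m public

  -- The length m · (H k + 4 k), which does not depend on k, plus 1 for the middle edge and 1 for a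
  -- satisfied column.
  top : ℕ
  top = m * (4 * (2 + N′)) + 2

  -- Going one row outwards on both sides adds vertical length 2 · 2 m, hence each of the m edges
  -- has to lose 4.
  H : ℕ → ℕ
  H k = 4 * (2 + N′ ∸ k)

  H-suc : ∀ {k} → k ≤ N′ → H k ≡ H (suc k) + 4
  H-suc {k} k≤ = trans (cong (4 *_) (+-∸-assoc 1 (≤-trans k≤ (n≤1+n N′)))) (eq (suc N′ ∸ k))
    where
    eq : ∀ x → 4 * suc x ≡ 4 * x + 4
    eq = solve-∀

  H-top : ∀ {k} → k ≤ N′ → m * (H k + 4 * k) + 2 ≡ top
  H-top {k} k≤ = cong (λ x → m * x + 2) (trans (sym (*-distribˡ-+ 4 (2 + N′ ∸ k) k)) (cong (4 *_) (m∸n+n≡m (≤-trans k≤ (≤-trans (n≤1+n N′) (n≤1+n (suc N′)))))))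

  H-anti : ∀ {k l} → k ≤ l → H l ≤ H k
  H-anti k≤l = *-monoʳ-≤ 4 (∸-monoʳ-≤ (2 + N′) k≤l)

  H-pos : ∀ {k} → k ≤ N′ → 1 ≤ H k
  H-pos {k} k≤ = *-mono-≤ {1} {4} (s≤s z≤n) (m<n⇒0<n∸m (s≤s (≤-trans k≤ (n≤1+n N′))))

  -- `M k c` and `w c` say whether the left assignment k and the right assignment satisfy column c.
  -- The lower edges carry differences of `M`, so that row prefixes telescope; `lower` is additive
  -- to avoid truncated subtraction. In the dummy columns `M` must not depend on k, as the potential
  -- is tight there, and the sum with `w` must be 1; this sum is split as 0 + 1 on the left and 1 +
  -- 0 on the right.
  record Weights (ω : Graph.Weighting grid) (M : ℕ → ℕ → ℕ) (w : ℕ → ℕ) : Set where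
    field
      M≤1     : ∀ k c → M k c ≤ 1
      w≤1     : ∀ c → w c ≤ 1
      M-first : ∀ k → M k 0 ≡ 0
      M-last  : ∀ k → M k m ≡ 1
      w-first : w 0 ≡ 1
      w-last  : w m ≡ 0
      middle  : ∀ y c → toℕ y ≡ N′ → ω (vertical y c) ≡ 1 + w (toℕ c)
      outer   : ∀ y c → toℕ y ≢ N′ → ω (vertical y c) ≡ 2 * m
      lower   : ∀ y c k → toℕ y + k ≡ N′ → ω (horizontal y c) + M k (toℕ c) ≡ H k + M k (suc (toℕ c))
      upper   : ∀ y c k → toℕ y ≡ suc N′ + k → ω (horizontal y c) ≡ H k

  -- The bounds are irrelevant arguments, so vertices can be named by plain numbers and
  -- `vertex-cong` is `refl`.
  vertex : ∀ y c → .(y < rows) → .(c < columns) → Fin vertices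
  vertex y c y< c< = combine (fromℕ< y<) (fromℕ< c<)

  vertex-cong : ∀ {y y′ c c′} .(y< : y < rows) .(y<′ : y′ < rows) .(c< : c < columns) .(c<′ : c′ < columns) →
                y ≡ y′ → c ≡ c′ → vertex y c y< c< ≡ vertex y′ c′ y<′ c<′
  vertex-cong _ _ _ _ refl refl = refl

  inject₁-fromℕ< : ∀ {i n} .(p : i < n) .(q : i < suc n) → inject₁ (fromℕ< p) ≡ fromℕ< q
  inject₁-fromℕ< p q = Fin.toℕ-injective (trans (Fin.toℕ-inject₁ (fromℕ< p)) (trans (Fin.toℕ-fromℕ< p) (sym (Fin.toℕ-fromℕ< q))))

  low< : ∀ k → N′ ∸ k < rows
  low< k = s≤s (≤-trans (m∸n≤m N′ k) (m≤m+n N′ (suc N′)))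

  up< : ∀ {k} → k ≤ N′ → suc N′ + k < rows
  up< {k} k≤ = s≤s (subst (suc N′ + k ≤_) (+-comm (suc N′) N′) (+-monoʳ-≤ (suc N′) k≤))

  low : ∀ k c → .(c ≤ m) → Fin vertices
  low k c c≤ = vertex (N′ ∸ k) c (low< k) (s≤s c≤)

  up : ∀ k c → .(k ≤ N′) → .(c ≤ m) → Fin vertices
  up k c k≤ c≤ = vertex (suc N′ + k) c (up< k≤) (s≤s c≤)

  data Place : Fin vertices → Set where
    inLow : ∀ k c → k ≤ N′ → (c≤ : c ≤ m) → Place (low k c c≤)
    inUp  : ∀ k c → (k≤ : k ≤ N′) (c≤ : c ≤ m) → Place (up k c k≤ c≤)

  place : ∀ v → Place v
  place v with remQuot {rows} columns v in eq
  ... | y , c with toℕ y ≤? N′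
  ... | yes y≤ = subst Place (trans (vertex-cong (low< k) (Fin.toℕ<n y) (s≤s c≤) (Fin.toℕ<n c) (m∸[m∸n]≡n y≤) refl) whole)
                   (inLow k (toℕ c) (m∸n≤m N′ (toℕ y)) c≤)
    where
    k = N′ ∸ toℕ y
    c≤ = s≤s⁻¹ (Fin.toℕ<n c)
    whole : vertex (toℕ y) (toℕ c) (Fin.toℕ<n y) (Fin.toℕ<n c) ≡ v
    whole = trans (cong₂ combine (Fin.fromℕ<-toℕ y (Fin.toℕ<n y)) (Fin.fromℕ<-toℕ c (Fin.toℕ<n c)))
                  (trans (cong (uncurry combine) (sym eq)) (Fin.combine-remQuot {rows} columns v))
  ... | no y≰ = subst Place (trans (vertex-cong (up< k≤) (Fin.toℕ<n y) (s≤s c≤) (Fin.toℕ<n c) (m+[n∸m]≡n (≰⇒> y≰)) refl) whole)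
                   (inUp k (toℕ c) k≤ c≤)
    where
    k = toℕ y ∸ suc N′
    k≤ : k ≤ N′
    k≤ = m≤n+o⇒m∸n≤o (toℕ y) (suc N′) (≤-trans (s≤s⁻¹ (Fin.toℕ<n y)) (≤-reflexive (+-comm N′ (suc N′))))
    c≤ = s≤s⁻¹ (Fin.toℕ<n c)
    whole : vertex (toℕ y) (toℕ c) (Fin.toℕ<n y) (Fin.toℕ<n c) ≡ v
    whole = trans (cong₂ combine (Fin.fromℕ<-toℕ y (Fin.toℕ<n y)) (Fin.fromℕ<-toℕ c (Fin.toℕ<n c)))
                  (trans (cong (uncurry combine) (sym eq)) (Fin.combine-remQuot {rows} columns v))

  module Distances {ω : Graph.Weighting grid} {M : ℕ → ℕ → ℕ} {w : ℕ → ℕ} (weights : Weights ω M w) where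
    open Weights weights
    open Walks grid ω
    open Graph grid using (Walk; walkLength; IsDistance; IsDiameter; Connected; source; target)

    along : ∀ {y c} .(y< : y < rows) .(c< : c < m) .(c<₁ : c < columns) .(c<₂ : suc c < columns) →
            Short (vertex y c y< c<₁) (vertex y (suc c) y< c<₂) (ω (horizontal (fromℕ< y<) (fromℕ< c<)))
    along {y} {c} y< c< c<₁ c<₂ = subst₂ (λ u v → Short u v (ω e))
        (trans (cong proj₁ (ends-horizontal (fromℕ< y<) (fromℕ< c<))) (cong (combine (fromℕ< y<)) (inject₁-fromℕ< c< c<₁)))
        (cong proj₂ (ends-horizontal (fromℕ< y<) (fromℕ< c<)))
        (short-edge e)
      where e = horizontal (fromℕ< y<) (fromℕ< c<)

    across : ∀ {y c} .(y< : y < N′ + suc N′) .(y<₁ : y < rows) .(y<₂ : suc y < rows) .(c< : c < columns) →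
             Short (vertex y c y<₁ c<) (vertex (suc y) c y<₂ c<) (ω (vertical (fromℕ< y<) (fromℕ< c<)))
    across {y} {c} y< y<₁ y<₂ c< = subst₂ (λ u v → Short u v (ω e))
        (trans (cong proj₁ (ends-vertical (fromℕ< y<) (fromℕ< c<))) (cong (λ i → combine i (fromℕ< c<)) (inject₁-fromℕ< y< y<₁)))
        (cong proj₂ (ends-vertical (fromℕ< y<) (fromℕ< c<)))
        (short-edge e)
      where e = vertical (fromℕ< y<) (fromℕ< c<)

    low-step : ∀ {k c} → k ≤ N′ → (c< : c < m) → ∃ λ x →
               Short (low k c (<⇒≤ c<)) (low k (suc c) c<) x × x + M k c ≡ H k + M k (suc c)
    low-step {k} {c} k≤ c< = ω e , along (low< k) c< (s≤s (<⇒≤ c<)) (s≤s c<) ,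
      subst (λ z → ω e + M k z ≡ H k + M k (suc z)) (Fin.toℕ-fromℕ< c<)
        (lower (fromℕ< (low< k)) (fromℕ< c<) k (trans (cong (_+ k) (Fin.toℕ-fromℕ< (low< k))) (m∸n+n≡m k≤)))
      where e = horizontal (fromℕ< (low< k)) (fromℕ< c<)

    -- The `M`-terms of consecutive edges cancel and leave those of the two ends.
    low-row : ∀ {k} d c → k ≤ N′ → (c≤ : c ≤ m) (c+d≤ : c + d ≤ m) → ∃ λ x →
              Short (low k c c≤) (low k (c + d) c+d≤) x × x + M k c ≡ d * H k + M k (c + d)
    low-row {k} zero c k≤ c≤ c+d≤ = 0 ,
      subst (λ u → Short (low k c c≤) u 0) (vertex-cong (low< k) (low< k) (s≤s c≤) (s≤s c+d≤) refl (sym (+-identityʳ c))) short-refl ,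
      cong (M k) (sym (+-identityʳ c))
    low-row {k} (suc d) c k≤ c≤ c+d≤
      with x , s , p ← low-step {k} {c} k≤ (≤-trans (s≤s (m≤m+n c d)) (≤-trans (≤-reflexive (sym (+-suc c d))) c+d≤))
      with y , t , q ← low-row {k} d (suc c) k≤ (≤-trans (s≤s (m≤m+n c d)) (≤-trans (≤-reflexive (sym (+-suc c d))) c+d≤)) (≤-trans (≤-reflexive (sym (+-suc c d))) c+d≤) =
      x + y ,
      subst (λ u → Short (low k c c≤) u (x + y)) (vertex-cong (low< k) (low< k) (s≤s (≤-trans (≤-reflexive (sym (+-suc c d))) c+d≤)) (s≤s c+d≤) refl (sym (+-suc c d))) (short-trans s t) ,
      (begin
        x + y + M k c                        ≡⟨ eq x y (M k c) ⟩
        y + (x + M k c)                      ≡⟨ cong (y +_) p ⟩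
        y + (H k + M k (suc c))              ≡⟨ eq′ y (H k) (M k (suc c)) ⟩
        H k + (y + M k (suc c))              ≡⟨ cong (H k +_) q ⟩
        H k + (d * H k + M k (suc c + d))    ≡⟨ +-assoc (H k) (d * H k) _ ⟨
        suc d * H k + M k (suc c + d)        ≡⟨ cong (λ z → suc d * H k + M k z) (+-suc c d) ⟨
        suc d * H k + M k (c + suc d)        ∎)
      where
      open ≡-Reasoning
      eq : ∀ x y z → x + y + z ≡ y + (x + z)
      eq = solve-∀
      eq′ : ∀ x y z → x + (y + z) ≡ y + (x + z)
      eq′ = solve-∀

    up-row : ∀ {k} d c → (k≤ : k ≤ N′) → (c≤ : c ≤ m) (c+d≤ : c + d ≤ m) →
             Short (up k c k≤ c≤) (up k (c + d) k≤ c+d≤) (d * H k)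
    up-row {k} zero c k≤ c≤ c+d≤ =
      subst (λ u → Short (up k c k≤ c≤) u 0) (vertex-cong (up< k≤) (up< k≤) (s≤s c≤) (s≤s c+d≤) refl (sym (+-identityʳ c))) short-refl
    up-row {k} (suc d) c k≤ c≤ c+d≤ =
      subst (λ u → Short (up k c k≤ c≤) u (suc d * H k)) (vertex-cong (up< k≤) (up< k≤) (s≤s c+d≤′) (s≤s c+d≤) refl (sym (+-suc c d)))
        (short-trans
          (subst (Short (up k c k≤ c≤) (up k (suc c) k≤ c<)) (upper (fromℕ< (up< k≤)) (fromℕ< c<) k (Fin.toℕ-fromℕ< (up< k≤)))
            (along (up< k≤) c< (s≤s c≤) (s≤s c<)))
          (up-row {k} d (suc c) k≤ c< c+d≤′))
      where
      c+d≤′ : suc c + d ≤ m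
      c+d≤′ = ≤-trans (≤-reflexive (sym (+-suc c d))) c+d≤
      c< : c < m
      c< = ≤-trans (s≤s (m≤m+n c d)) c+d≤′

    low-row-bound : ∀ {k} d c → k ≤ N′ → (c≤ : c ≤ m) (c+d≤ : c + d ≤ m) → Short (low k c c≤) (low k (c + d) c+d≤) (d * H k + 1)
    low-row-bound {k} d c k≤ c≤ c+d≤ with x , s , p ← low-row {k} d c k≤ c≤ c+d≤ =
      short-mono (≤-trans (m≤m+n x (M k c)) (≤-trans (≤-reflexive p) (+-monoʳ-≤ (d * H k) (M≤1 k (c + d))))) s

    ∣m+n-m∣≡n : ∀ m n → ∣ m + n - m ∣ ≡ n
    ∣m+n-m∣≡n m n = trans (∣-∣-comm (m + n) m) (∣m-m+n∣≡n m n)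

    low-row≤ : ∀ {k c c′} → k ≤ N′ → (c≤ : c ≤ m) (c′≤ : c′ ≤ m) → Short (low k c c≤) (low k c′ c′≤) (∣ c - c′ ∣ * H k + 1)
    low-row≤ {k} {c} {c′} k≤ c≤ c′≤ with ≤-total c c′
    ... | inj₁ le with d , refl ← m≤n⇒∃[o]m+o≡n le =
      subst (λ z → Short (low k c c≤) (low k (c + d) c′≤) (z * H k + 1)) (sym (∣m-m+n∣≡n c d)) (low-row-bound {k} d c k≤ c≤ c′≤)
    ... | inj₂ le with d , refl ← m≤n⇒∃[o]m+o≡n le =
      subst (λ z → Short (low k (c′ + d) c≤) (low k c′ c′≤) (z * H k + 1)) (sym (∣m+n-m∣≡n c′ d)) (short-sym (low-row-bound {k} d c′ k≤ c′≤ c≤))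

    up-row≤ : ∀ {k c c′} → (k≤ : k ≤ N′) → (c≤ : c ≤ m) (c′≤ : c′ ≤ m) → Short (up k c k≤ c≤) (up k c′ k≤ c′≤) (∣ c - c′ ∣ * H k)
    up-row≤ {k} {c} {c′} k≤ c≤ c′≤ with ≤-total c c′
    ... | inj₁ le with d , refl ← m≤n⇒∃[o]m+o≡n le =
      subst (λ z → Short (up k c k≤ c≤) (up k (c + d) k≤ c′≤) (z * H k)) (sym (∣m-m+n∣≡n c d)) (up-row {k} d c k≤ c≤ c′≤)
    ... | inj₂ le with d , refl ← m≤n⇒∃[o]m+o≡n le =
      subst (λ z → Short (up k (c′ + d) k≤ c≤) (up k c′ k≤ c′≤) (z * H k)) (sym (∣m+n-m∣≡n c′ d)) (short-sym (up-row {k} d c′ k≤ c′≤ c≤))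

    low-column : ∀ j {k c} → k + j ≤ N′ → (c≤ : c ≤ m) → Short (low (k + j) c c≤) (low k c c≤) (j * (2 * m))
    low-column zero {k} {c} _ c≤ =
      subst (λ u → Short (low (k + 0) c c≤) u 0) (vertex-cong (low< (k + 0)) (low< k) (s≤s c≤) (s≤s c≤) (cong (N′ ∸_) (+-identityʳ k)) refl) short-refl
    low-column (suc j) {k} {c} k+j≤ c≤ = short-trans edge (low-column j (≤-trans (n≤1+n (k + j)) sk+j≤) c≤)
      where
      sk+j≤ : suc (k + j) ≤ N′
      sk+j≤ = ≤-trans (≤-reflexive (sym (+-suc k j))) k+j≤
      y = N′ ∸ suc (k + j)
      sy≡ : suc y ≡ N′ ∸ (k + j)
      sy≡ = sym (+-∸-assoc 1 sk+j≤)
      y<N′ : y < N′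
      y<N′ = subst (_≤ N′) (sym sy≡) (m∸n≤m N′ (k + j))
      y<₀ : y < N′ + suc N′
      y<₀ = ≤-trans y<N′ (m≤m+n N′ (suc N′))
      y<₂ : suc y < rows
      y<₂ = s≤s y<₀
      edge : Short (low (k + suc j) c c≤) (low (k + j) c c≤) (2 * m)
      edge = subst₂ (λ u v → Short u v (2 * m))
        (vertex-cong (low< (suc (k + j))) (low< (k + suc j)) (s≤s c≤) (s≤s c≤) (cong (N′ ∸_) (sym (+-suc k j))) refl)
        (vertex-cong y<₂ (low< (k + j)) (s≤s c≤) (s≤s c≤) sy≡ refl)
        (subst (Short _ _) (outer (fromℕ< y<₀) (fromℕ< (s≤s c≤)) (<⇒≢ y<N′ ∘ trans (sym (Fin.toℕ-fromℕ< y<₀))))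
          (across y<₀ (low< (suc (k + j))) y<₂ (s≤s c≤)))

    up-column : ∀ j {k c} → (k≤ : k ≤ N′) (k+j≤ : k + j ≤ N′) → (c≤ : c ≤ m) → Short (up k c k≤ c≤) (up (k + j) c k+j≤ c≤) (j * (2 * m))
    up-column zero {k} {c} k≤ k+j≤ c≤ =
      subst (λ u → Short (up k c k≤ c≤) u 0) (vertex-cong (up< k≤) (up< k+j≤) (s≤s c≤) (s≤s c≤) (cong (suc N′ +_) (sym (+-identityʳ k))) refl) short-refl
    up-column (suc j) {k} {c} k≤ k+j≤ c≤ =
      subst (λ u → Short (up k c k≤ c≤) u (suc j * (2 * m))) (vertex-cong (up< sk+j≤) (up< k+j≤) (s≤s c≤) (s≤s c≤) (cong (suc N′ +_) (sym (+-suc k j))) refl)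
        (short-trans edge (up-column j sk≤ sk+j≤ c≤))
      where
      sk+j≤ : suc k + j ≤ N′
      sk+j≤ = ≤-trans (≤-reflexive (sym (+-suc k j))) k+j≤
      sk≤ : suc k ≤ N′
      sk≤ = ≤-trans (s≤s (m≤m+n k j)) sk+j≤
      y = suc N′ + k
      y<₀ : y < N′ + suc N′
      y<₀ = subst (_≤ N′ + suc N′) (trans (+-suc N′ (suc k)) (cong suc (+-suc N′ k))) (+-monoʳ-≤ N′ (s≤s sk≤))
      y<₂ : suc y < rows
      y<₂ = s≤s y<₀
      edge : Short (up k c k≤ c≤) (up (suc k) c sk≤ c≤) (2 * m)
      edge = subst (λ v → Short (up k c k≤ c≤) v (2 * m))
        (vertex-cong y<₂ (up< sk≤) (s≤s c≤) (s≤s c≤) (sym (+-suc (suc N′) k)) refl)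
        (subst (Short _ _) (outer (fromℕ< y<₀) (fromℕ< (s≤s c≤)) (λ p → <⇒≢ (s≤s (m≤m+n N′ k)) (sym (trans (sym (Fin.toℕ-fromℕ< y<₀)) p))))
          (across y<₀ (up< k≤) y<₂ (s≤s c≤)))

    middle-edge : ∀ {c} (c≤ : c ≤ m) → Short (low 0 c c≤) (up 0 c z≤n c≤) (1 + w c)
    middle-edge {c} c≤ = subst (λ v → Short (low 0 c c≤) v (1 + w c))
        (vertex-cong y<₂ (up< z≤n) (s≤s c≤) (s≤s c≤) (sym (+-identityʳ (suc N′))) refl)
        (subst (Short _ _) (trans (middle (fromℕ< y<₀) (fromℕ< (s≤s c≤)) (Fin.toℕ-fromℕ< y<₀)) (cong (λ z → 1 + w z) (Fin.toℕ-fromℕ< (s≤s c≤))))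
          (across y<₀ (low< 0) y<₂ (s≤s c≤)))
      where
      y<₀ : N′ < N′ + suc N′
      y<₀ = ≤-trans (s≤s (m≤m+n N′ N′)) (≤-reflexive (sym (+-suc N′ N′)))
      y<₂ : suc N′ < rows
      y<₂ = s≤s y<₀

    full-column : ∀ {k l c} (k≤ : k ≤ N′) (l≤ : l ≤ N′) (c≤ : c ≤ m) → Short (low k c c≤) (up l c l≤ c≤) (k * (2 * m) + ((1 + w c) + l * (2 * m)))
    full-column {k} {l} k≤ l≤ c≤ = short-trans (low-column k k≤ c≤) (short-trans (middle-edge c≤) (up-column l z≤n l≤ c≤))

    -- The bound is the predecessor of `top`.
    Close : Fin vertices → Fin vertices → Set
    Close u v = Short u v (m * (4 * (2 + N′)) + 1)

    close : ∀ {k u v x} → k ≤ N′ → x ≤ m * (H k + 4 * k) + 1 → Short u v x → Close u v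
    close {k} k≤ x≤ = short-mono (≤-trans x≤ (≤-reflexive (+-cancelʳ-≡ 1 _ _ (trans (+-assoc _ 1 1) (trans (H-top k≤) (sym (+-assoc _ 1 1)))))))

    distance≤m : ∀ {c c′} → c ≤ m → c′ ≤ m → ∣ c - c′ ∣ ≤ m
    distance≤m {c} {c′} c≤ c′≤ = ≤-trans (∣m-n∣≤m⊔n c c′) (⊔-lub c≤ c′≤)

    -- The horizontal part is walked in the outer row, where edges are shorter. Without a passage
    -- through the middle, the vertical part stays within the allowance 4 k m of that row.
    low-low : ∀ {k c c′} j → k + j ≤ N′ → (c≤ : c ≤ m) (c′≤ : c′ ≤ m) → Close (low (k + j) c c≤) (low k c′ c′≤)
    low-low {k} {c} {c′} j k+j≤ c≤ c′≤ = close k+j≤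
        (≤-by (*-monoˡ-≤ (H (k + j)) (distance≤m c≤ c′≤)) _ (eq m (H (k + j)) (∣ c - c′ ∣) k j))
        (short-trans (low-row≤ k+j≤ c≤ c′≤) (low-column j k+j≤ c′≤))
      where
      eq : ∀ m H s k j → m * (H + 4 * (k + j)) + 1 + s * H ≡ s * H + 1 + j * (2 * m) + m * H + (m * (4 * k) + 2 * m * j)
      eq = solve-∀

    up-up : ∀ {k c c′} j → (k≤ : k ≤ N′) (k+j≤ : k + j ≤ N′) → (c≤ : c ≤ m) (c′≤ : c′ ≤ m) → Close (up k c k≤ c≤) (up (k + j) c′ k+j≤ c′≤)
    up-up {k} {c} {c′} j k≤ k+j≤ c≤ c′≤ = close k+j≤
        (≤-by (*-monoˡ-≤ (H (k + j)) (distance≤m c≤ c′≤)) _ (eq m (H (k + j)) (∣ c - c′ ∣) k j))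
        (short-trans (up-column j k≤ k+j≤ c≤) (up-row≤ k+j≤ c≤ c′≤))
      where
      eq : ∀ m H s k j → m * (H + 4 * (k + j)) + 1 + s * H ≡ j * (2 * m) + s * H + m * H + (m * (4 * k) + 2 * m * j + 1)
      eq = solve-∀

    -- With the horizontal part in the outer row l = k + 1 + j, the vertical part falls short of its
    -- allowance by 2 m (l - k), which pays for `w c`.
    below : ∀ {k c c′} j → (k≤ : k ≤ N′) (l≤ : suc k + j ≤ N′) → (c≤ : c ≤ m) (c′≤ : c′ ≤ m) →
            Close (low k c c≤) (up (suc k + j) c′ l≤ c′≤)
    below {k} {c} {c′} j k≤ l≤ c≤ c′≤ = close l≤
        (≤-by (+-mono-≤ (*-monoˡ-≤ (H (suc k + j)) (distance≤m c≤ c′≤)) (+-mono-≤ (w≤1 c) 1≤m)) _ (eq m (H (suc k + j)) (∣ c - c′ ∣) k j (w c)))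
        (short-trans (full-column k≤ l≤ c≤) (up-row≤ l≤ c≤ c′≤))
      where
      eq : ∀ m H s k j w → m * (H + 4 * (suc k + j)) + 1 + (s * H + (w + 1)) ≡
           (k * (2 * m) + ((1 + w) + (suc k + j) * (2 * m))) + s * H + (m * H + (1 + m)) + (m + 2 * m * j)
      eq = solve-∀

    -- As in `below`; the spared 2 m also covers the perturbation by 1 along the lower row.
    above : ∀ {l c c′} j → (k≤ : suc l + j ≤ N′) (l≤ : l ≤ N′) → (c≤ : c ≤ m) (c′≤ : c′ ≤ m) →
            Close (low (suc l + j) c c≤) (up l c′ l≤ c′≤)
    above {l} {c} {c′} j k≤ l≤ c≤ c′≤ = close k≤
        (≤-by (+-mono-≤ (*-monoˡ-≤ (H (suc l + j)) (distance≤m c≤ c′≤)) (+-mono-≤ (w≤1 c′) (*-monoʳ-≤ 2 1≤m))) _ (eq m (H (suc l + j)) (∣ c - c′ ∣) l j (w c′)))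
        (short-trans (low-row≤ k≤ c≤ c′≤) (full-column k≤ l≤ c′≤))
      where
      eq : ∀ m H s l j w → m * (H + 4 * (suc l + j)) + 1 + (s * H + (w + 2 * 1)) ≡
           s * H + 1 + ((suc l + j) * (2 * m) + ((1 + w) + l * (2 * m))) + (m * H + (1 + 2 * m)) + 2 * m * j
      eq = solve-∀

    -- A horizontal distance below m saves at least one edge of length H k, and this pays for `w c`.
    level : ∀ {k c c′} → (k≤ : k ≤ N′) (c≤ : c ≤ m) (c′≤ : c′ ≤ m) → ∣ c - c′ ∣ < m → Close (low k c c≤) (up k c′ k≤ c′≤)
    level {k} {c} {c′} k≤ c≤ c′≤ s<m = close k≤
        (≤-by (+-mono-≤ (*-monoˡ-≤ (H k) s<m) (+-mono-≤ (w≤1 c) (H-pos k≤))) 0 (eq m (H k) (∣ c - c′ ∣) k (w c)))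
        (short-trans (full-column k≤ k≤ c≤) (up-row≤ k≤ c≤ c′≤))
      where
      eq : ∀ m H s k w → m * (H + 4 * k) + 1 + (suc s * H + (w + 1)) ≡
           (k * (2 * m) + ((1 + w) + k * (2 * m))) + s * H + (m * H + (1 + H)) + 0
      eq = solve-∀

    -- The passage is the last dummy column; as `w m` is 0, the opposite pair of ends stays below
    -- `top` for every k.
    backwards : ∀ {k} (k≤ : k ≤ N′) → Close (low k m ≤-refl) (up k 0 k≤ z≤n)
    backwards {k} k≤ = close k≤
        (≤-reflexive (trans (cong₂ (λ x s → k * (2 * m) + ((1 + x) + k * (2 * m)) + s * H k) w-last (∣-∣-identityʳ m)) (eq m (H k) k)))
        (short-trans (full-column k≤ k≤ ≤-refl) (up-row≤ k≤ ≤-refl z≤n))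
      where
      eq : ∀ m H k → k * (2 * m) + ((1 + 0) + k * (2 * m)) + m * H ≡ m * (H + 4 * k) + 1
      eq = solve-∀

    -- Whatever column is crossed, the main part of the length is m · H k + 2 k · 2 m; only the bits
    -- of column j make a difference. A column satisfied by neither side is a shortcut.
    detour : ∀ {k} (k≤ : k ≤ N′) j d → (j+d : j + d ≡ m) → Short (low k 0 z≤n) (up k m k≤ ≤-refl) (m * (H k + 4 * k) + (1 + (M k j + w j)))
    detour {k} k≤ j d refl with x , s , p ← low-row {k} j 0 k≤ z≤n (m≤m+n j d) =
      short-mono
        (≤-reflexive (trans (cong (λ z → z + (k * (2 * m) + ((1 + w j) + k * (2 * m))) + d * H k) x≡) (eq j d (H k) k (M k j) (w j))))
        (short-trans (short-trans s (full-column k≤ k≤ (m≤m+n j d))) (up-row {k} d j k≤ (m≤m+n j d) ≤-refl))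
      where
      x≡ : x ≡ j * H k + M k j
      x≡ = trans (sym (trans (cong (x +_) (M-first k)) (+-identityʳ x))) p
      eq : ∀ j d H k M w → j * H + M + (k * (2 * (j + d)) + ((1 + w) + k * (2 * (j + d)))) + d * H ≡ (j + d) * (H + 4 * k) + (1 + (M + w))
      eq = solve-∀

    Satisfied : ℕ → Set
    Satisfied k = ∀ j → j ≤ m → 1 ≤ M k j + w j

    search : ∀ k n → (∃ λ j → j ≤ n × M k j + w j ≡ 0) ⊎ (∀ j → j ≤ n → 1 ≤ M k j + w j)
    search k zero with M k 0 + w 0 in eq
    ... | zero  = inj₁ (0 , z≤n , eq)
    ... | suc x = inj₂ λ { _ z≤n → subst (1 ≤_) (sym eq) (s≤s z≤n) }
    search k (suc n) with search k n
    ... | inj₁ (j , j≤ , p) = inj₁ (j , ≤-trans j≤ (n≤1+n n) , p)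
    ... | inj₂ all with M k (suc n) + w (suc n) in eq
    ... | zero  = inj₁ (suc n , ≤-refl , eq)
    ... | suc x = inj₂ everywhere
      where
      everywhere : ∀ j → j ≤ suc n → 1 ≤ M k j + w j
      everywhere j j≤ with m≤n⇒m<n∨m≡n j≤
      ... | inj₁ j< = all j (s≤s⁻¹ j<)
      ... | inj₂ refl = subst (1 ≤_) (sym eq) (s≤s z≤n)

    Extreme : Fin vertices → Fin vertices → Set
    Extreme u v = ∃ λ k → k ≤ N′ × Satisfied k × Short u v top

    forwards : ∀ {k} (k≤ : k ≤ N′) → Close (low k 0 z≤n) (up k m k≤ ≤-refl) ⊎ Extreme (low k 0 z≤n) (up k m k≤ ≤-refl)
    forwards {k} k≤ with search k m
    ... | inj₁ (j , j≤ , p) with d , j+d ← m≤n⇒∃[o]m+o≡n j≤ =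
      inj₁ (close k≤ (≤-reflexive (cong (λ x → m * (H k + 4 * k) + (1 + x)) p)) (detour k≤ j d j+d))
    -- Without a shortcut, column 0 still gives a walk of length `top`, since its bits are 0 and 1.
    ... | inj₂ all = inj₂ (k , k≤ , all , short-mono (≤-reflexive (trans (cong (λ x → m * (H k + 4 * k) + (1 + x)) (cong₂ _+_ (M-first k) w-first)) (H-top k≤))) (detour k≤ 0 m refl))

    low-up : ∀ k c l c′ → (k≤ : k ≤ N′) (c≤ : c ≤ m) (l≤ : l ≤ N′) (c′≤ : c′ ≤ m) →
             Close (low k c c≤) (up l c′ l≤ c′≤) ⊎ Extreme (low k c c≤) (up l c′ l≤ c′≤)
    low-up k c l c′ k≤ c≤ l≤ c′≤ with <-cmp k l
    ... | tri< lt _ _ with j , refl ← m≤n⇒∃[o]m+o≡n lt = inj₁ (below j k≤ l≤ c≤ c′≤)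
    ... | tri> _ _ gt with j , refl ← m≤n⇒∃[o]m+o≡n gt = inj₁ (above j k≤ l≤ c≤ c′≤)
    ... | tri≈ _ refl _ with ∣ c - c′ ∣ <? m
    ... | yes s<m = inj₁ (level k≤ c≤ c′≤ s<m)
    ... | no s≮m with extreme c c′ c≤ c′≤ (≮⇒≥ s≮m)
      where
      extreme : ∀ c c′ → c ≤ m → c′ ≤ m → m ≤ ∣ c - c′ ∣ → (c ≡ 0 × c′ ≡ m) ⊎ (c ≡ m × c′ ≡ 0)
      extreme zero    c′       c≤ c′≤ p = inj₁ (refl , ≤-antisym c′≤ p)
      extreme (suc c) zero     c≤ c′≤ p = inj₂ (≤-antisym c≤ p , refl)
      extreme (suc c) (suc c′) c≤ c′≤ p = contradiction (≤-<-trans (≤-trans p (∣m-n∣≤m⊔n c c′)) (⊔-lub c≤ c′≤)) (<-irrefl refl)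
    ... | inj₁ (refl , refl) = forwards k≤
    ... | inj₂ (refl , refl) = inj₁ (backwards k≤)

    extreme-sym : ∀ {u v} → Close u v ⊎ Extreme u v → Close v u ⊎ Extreme v u
    extreme-sym (inj₁ s)                 = inj₁ (short-sym s)
    extreme-sym (inj₂ (k , k≤ , sat , s)) = inj₂ (k , k≤ , sat , short-sym s)

    -- Connectedness, the upper bound on the diameter, and the existence of a good k when the
    -- diameter reaches `top` are all read off from this alternative.
    separation : ∀ u v → Close u v ⊎ Extreme u v
    separation u v with place u | place v
    ... | inLow k c k≤ c≤ | inUp l c′ l≤ c′≤ = low-up k c l c′ k≤ c≤ l≤ c′≤
    ... | inUp l c′ l≤ c′≤ | inLow k c k≤ c≤ = extreme-sym (low-up k c l c′ k≤ c≤ l≤ c′≤)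
    ... | inLow k c k≤ c≤ | inLow l c′ l≤ c′≤ with ≤-total k l
    ...   | inj₁ le with j , refl ← m≤n⇒∃[o]m+o≡n le = inj₁ (short-sym (low-low j l≤ c′≤ c≤))
    ...   | inj₂ le with j , refl ← m≤n⇒∃[o]m+o≡n le = inj₁ (low-low j k≤ c≤ c′≤)
    separation u v | inUp k c k≤ c≤ | inUp l c′ l≤ c′≤ with ≤-total k l
    ...   | inj₁ le with j , refl ← m≤n⇒∃[o]m+o≡n le = inj₁ (up-up j k≤ l≤ c≤ c′≤)
    ...   | inj₂ le with j , refl ← m≤n⇒∃[o]m+o≡n le = inj₁ (short-sym (up-up j l≤ k≤ c′≤ c≤))

    connected : Connected
    connected u v with separation u v
    ... | inj₁ (p , _)             = p
    ... | inj₂ (_ , _ , _ , p , _) = p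

    -- A lower bound by a potential

    module _ (i : ℕ) (i≤ : i ≤ N′) (satisfied : Satisfied i) where

      -- The distance from the left end of the row low i, were every passage
      -- through the middle to have the same total length; in the upper half
      -- it is measured from the right end of the row up i.
      lowPotential upPotential : ℕ → ℕ → ℕ
      lowPotential k c = ∣ k - i ∣ * (2 * m) + (c * H (k ⊔ i) + M (k ⊔ i) c)
      upPotential  k c = top ∸ (∣ k - i ∣ * (2 * m) + (m ∸ c) * H (k ⊔ i))

      rowPotential : ℕ → ℕ → ℕ
      rowPotential y c with y ≤? N′
      ... | yes _ = lowPotential (N′ ∸ y) c
      ... | no _  = upPotential (y ∸ suc N′) c

      rowPotential-low : ∀ {y} k c → y + k ≡ N′ → rowPotential y c ≡ lowPotential k c
      rowPotential-low {y} k c eq with y ≤? N′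
      ... | yes _  = cong (λ z → lowPotential z c) (trans (cong (_∸ y) (sym eq)) (m+n∸m≡n y k))
      ... | no y≰ = contradiction (subst (y ≤_) eq (m≤m+n y k)) y≰

      rowPotential-up : ∀ {y} k c → y ≡ suc N′ + k → rowPotential y c ≡ upPotential k c
      rowPotential-up {y} k c refl with y ≤? N′
      ... | yes y≤ = contradiction (≤-trans (s≤s (m≤m+n N′ k)) y≤) 1+n≰n
      ... | no _   = cong (λ z → upPotential z c) (m+n∸m≡n (suc N′) k)

      vertexPotential : Fin vertices → ℕ
      vertexPotential v = rowPotential (toℕ (proj₁ (remQuot {rows} columns v))) (toℕ (proj₂ (remQuot {rows} columns v)))

      vertexPotential-combine : ∀ y c → vertexPotential (combine y c) ≡ rowPotential (toℕ y) (toℕ c)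
      vertexPotential-combine y c = cong (λ ((y , c) : Fin rows × Fin columns) → rowPotential (toℕ y) (toℕ c)) (Fin.remQuot-combine {rows} y c)

      outside : ∀ j → ∣ i + j - i ∣ ≡ j × (i + j) ⊔ i ≡ i + j
      outside j = ∣m+n-m∣≡n i j , m≥n⇒m⊔n≡m (m≤m+n i j)

      inside : ∀ {k} j → k + j ≡ i → ∣ k - i ∣ ≡ j × k ⊔ i ≡ i
      inside {k} j refl = ∣m-m+n∣≡n k j , m≤n⇒m⊔n≡n (m≤m+n k j)

      lowPotential-≡ : ∀ {k a b} c → ∣ k - i ∣ ≡ a × k ⊔ i ≡ b → lowPotential k c ≡ a * (2 * m) + (c * H b + M b c)
      lowPotential-≡ c (p , q) = cong₂ (λ a b → a * (2 * m) + (c * H b + M b c)) p q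

      upPotential-≡ : ∀ {k a b} c → ∣ k - i ∣ ≡ a × k ⊔ i ≡ b → upPotential k c ≡ top ∸ (a * (2 * m) + (m ∸ c) * H b)
      upPotential-≡ c (p , q) = cong₂ (λ a b → top ∸ (a * (2 * m) + (m ∸ c) * H b)) p q

      data Side (k : ℕ) : Set where
        farther : ∀ j → k ≡ i + j → Side k
        nearer  : ∀ j → suc k + j ≡ i → Side k

      side : ∀ k → Side k
      side k with k <? i
      ... | no k≮i  = let j , p = m≤n⇒∃[o]m+o≡n (≮⇒≥ k≮i) in farther j (sym p)
      ... | yes k<i = let j , p = m≤n⇒∃[o]m+o≡n k<i in nearer j p

      -- From row i outwards the potential follows the edges exactly. Nearer to the middle it still
      -- grows by about H i, which is at least 4 less than H k, enough room for the perturbations of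
      -- both rows.
      low-horizontal : ∀ k c x → x + M k c ≡ H k + M k (suc c) → Lipschitz (lowPotential k c) (lowPotential k (suc c)) x
      low-horizontal k c x eq with side k
      ... | farther j refl = subst₂ (λ a b → Lipschitz a b x) (sym (lowPotential-≡ c (outside j))) (sym (lowPotential-≡ (suc c) (outside j)))
        (lipschitz-≡ (begin
          d + (c * H k + M k c) + x            ≡⟨ regroup₁ d (c * H k) (M k c) x ⟩
          d + (c * H k + (x + M k c))          ≡⟨ cong (λ z → d + (c * H k + z)) eq ⟩
          d + (c * H k + (H k + M k (suc c)))  ≡⟨ regroup₂ d (c * H k) (H k) (M k (suc c)) ⟩
          d + (H k + c * H k + M k (suc c))    ∎))
        where
        open ≡-Reasoning
        d = j * (2 * m)
        regroup₁ : ∀ d a b x → d + (a + b) + x ≡ d + (a + (x + b))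
        regroup₁ = solve-∀
        regroup₂ : ∀ d a b x → d + (a + (b + x)) ≡ d + (b + a + x)
        regroup₂ = solve-∀
      ... | nearer j p = subst₂ (λ a b → Lipschitz a b x) (sym (lowPotential-≡ c k-inside)) (sym (lowPotential-≡ (suc c) k-inside))
        ( ≤-by (+-mono-≤ (M≤1 i c) (H-pos i≤)) _ (forth d (c * H i) (H i) (M i c) (M i (suc c)) x)
        , ≤-by (+-mono-≤ (≤-trans (+-monoˡ-≤ 4 (H-anti k<i)) (≤-reflexive (sym (H-suc (≤-trans (<⇒≤ k<i) i≤)))))
               (+-mono-≤ (M≤1 i (suc c)) (+-mono-≤ (M≤1 k c) (≤-reflexive (sym eq)))))
             _ (back d (c * H i) (H i) (H k) (M i c) (M i (suc c)) (M k c) (M k (suc c)) x))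
        where
        k-inside : ∣ k - i ∣ ≡ suc j × k ⊔ i ≡ i
        k-inside = inside (suc j) (trans (+-suc k j) p)
        k<i : k < i
        k<i = subst (k <_) p (s≤s (m≤m+n k j))
        d = suc j * (2 * m)
        forth : ∀ d a h p q x → (d + ((h + a) + q) + x) + (p + 1) ≡ (d + (a + p)) + (1 + h) + (q + x)
        forth = solve-∀
        back : ∀ d a h hk p q r s x → (d + (a + p) + x) + (h + 4 + (q + (r + (hk + s)))) ≡ (d + ((h + a) + q)) + (hk + (1 + (1 + (x + r)))) + (p + s + 2)
        back = solve-∀

      -- From row i outwards, the potentials of rows k and k + 1 differ by 4 c - 2 m plus a
      -- difference of `M`-values, which must lie between - 2 m and 2 m. This is tight at c = 0 and
      -- at c = m, hence `M-first` and `M-last`; in between there is room for the bits.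
      low-vertical : ∀ k c → suc k ≤ N′ → c ≤ m → Lipschitz (lowPotential (suc k) c) (lowPotential k c) (2 * m)
      low-vertical k c k< c≤ with side k
      ... | nearer j p = subst₂ (λ a b → Lipschitz a b (2 * m))
          (sym (lowPotential-≡ c (inside j p))) (sym (lowPotential-≡ c (inside (suc j) (trans (+-suc k j) p))))
          (lipschitz-≡ (eq j m (c * H i + M i c)))
        where
        eq : ∀ j m r → j * (2 * m) + r + 2 * m ≡ suc j * (2 * m) + r
        eq = solve-∀
      ... | farther j refl = subst₂ (λ a b → Lipschitz a b (2 * m))
          (trans (sym (lowPotential-≡ c (outside (suc j)))) (cong (λ k → lowPotential k c) (+-suc i j)))
          (trans (cong (λ h → j * (2 * m) + (c * h + M (i + j) c)) (sym H≡)) (sym (lowPotential-≡ c (outside j))))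
          (inner-bound c c≤ , outer-bound c c≤)
        where
        h = H (i + suc j)
        H≡ : H (i + j) ≡ h + 4
        H≡ = trans (H-suc (<⇒≤ k<)) (cong (λ k → H k + 4) (sym (+-suc i j)))
        M₀ M₁ : ℕ → ℕ
        M₀ = M (i + j)
        M₁ = M (i + suc j)
        outer-bound : ∀ c → c ≤ m → j * (2 * m) + (c * (h + 4) + M₀ c) ≤ suc j * (2 * m) + (c * h + M₁ c) + 2 * m
        outer-bound c c≤ with m≤n⇒m<n∨m≡n c≤
        ... | inj₁ c<m = ≤-by (+-mono-≤ (*-monoˡ-≤ 4 c<m) (M≤1 (i + j) c)) _ (eq j m c h (M₀ c) (M₁ c))
          where
          eq : ∀ j m c h p q → (suc j * (2 * m) + (c * h + q) + 2 * m) + (suc c * 4 + p) ≡ j * (2 * m) + (c * (h + 4) + p) + (m * 4 + 1) + (q + 3)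
          eq = solve-∀
        ... | inj₂ refl = ≤-reflexive (trans (cong (λ z → j * (2 * m) + (m * (h + 4) + z)) (M-last (i + j))) (trans (eq j m h) (cong (λ z → suc j * (2 * m) + (m * h + z) + 2 * m) (sym (M-last (i + suc j))))))
          where
          eq : ∀ j m h → j * (2 * m) + (m * (h + 4) + 1) ≡ suc j * (2 * m) + (m * h + 1) + 2 * m
          eq = solve-∀
        inner-bound : ∀ c → c ≤ m → suc j * (2 * m) + (c * h + M₁ c) ≤ j * (2 * m) + (c * (h + 4) + M₀ c) + 2 * m
        inner-bound zero    _ = ≤-reflexive (trans (cong (suc j * (2 * m) +_) (M-first (i + suc j))) (trans (eq j m) (cong (λ z → j * (2 * m) + z + 2 * m) (sym (M-first (i + j))))))
          where
          eq : ∀ j m → suc j * (2 * m) + 0 ≡ j * (2 * m) + 0 + 2 * m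
          eq = solve-∀
        inner-bound (suc c) _ = ≤-by (M≤1 (i + suc j) (suc c)) _ (eq j m c h (M₀ (suc c)) (M₁ (suc c)))
          where
          eq : ∀ j m c h p q → j * (2 * m) + (suc c * (h + 4) + p) + 2 * m + q ≡ suc j * (2 * m) + (suc c * h + q) + 1 + (c * 4 + 3 + p)
          eq = solve-∀

      up-horizontal : ∀ k c → suc c ≤ m → Lipschitz (upPotential k c) (upPotential k (suc c)) (H k)
      up-horizontal k c c< = lipschitz-∸ top
          ( ≤-trans (+-monoʳ-≤ e (≤-trans (≤-reflexive (cong (_* H (k ⊔ i)) (+-∸-assoc 1 c<))) (+-monoˡ-≤ ((m ∸ suc c) * H (k ⊔ i)) (H-anti (m≤m⊔n k i)))))
                    (≤-reflexive (eq e (H k) ((m ∸ suc c) * H (k ⊔ i))))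
          , ≤-trans (+-monoʳ-≤ e (*-monoˡ-≤ (H (k ⊔ i)) (∸-monoʳ-≤ m (n≤1+n c)))) (m≤m+n _ (H k)))
        where
        e = ∣ k - i ∣ * (2 * m)
        eq : ∀ e h x → e + (h + x) ≡ e + x + h
        eq = solve-∀

      up-vertical : ∀ k c → suc k ≤ N′ → Lipschitz (upPotential k c) (upPotential (suc k) c) (2 * m)
      up-vertical k c k< with side k
      ... | nearer j p = subst₂ (λ a b → Lipschitz a b (2 * m))
          (sym (upPotential-≡ c (inside (suc j) (trans (+-suc k j) p)))) (sym (upPotential-≡ c (inside j p)))
          (lipschitz-∸ top {suc j * (2 * m) + (m ∸ c) * H i} {j * (2 * m) + (m ∸ c) * H i} (lipschitz-sym (lipschitz-≡ (eq j m ((m ∸ c) * H i)))))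
        where
        eq : ∀ j m r → j * (2 * m) + r + 2 * m ≡ suc j * (2 * m) + r
        eq = solve-∀
      ... | farther j refl = subst₂ (λ a b → Lipschitz a b (2 * m))
          (trans (cong (λ h → top ∸ (j * (2 * m) + (m ∸ c) * h)) (sym H≡)) (sym (upPotential-≡ c (outside j))))
          (trans (sym (upPotential-≡ c (outside (suc j)))) (cong (λ k → upPotential k c) (+-suc i j)))
          (lipschitz-∸ top
            ( ≤-by (*-monoˡ-≤ 4 (m∸n≤m m c)) 0 (forth j m (m ∸ c) (H (i + suc j)))
            , ≤-from ((m ∸ c) * 4) (back j m (m ∸ c) (H (i + suc j)))))
        where
        H≡ : H (i + j) ≡ H (i + suc j) + 4
        H≡ = trans (H-suc (<⇒≤ k<)) (cong (λ k → H k + 4) (sym (+-suc i j)))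
        forth : ∀ j m r h → (suc j * (2 * m) + r * h + 2 * m) + r * 4 ≡ j * (2 * m) + r * (h + 4) + m * 4 + 0
        forth = solve-∀
        back : ∀ j m r h → j * (2 * m) + r * (h + 4) + 2 * m ≡ suc j * (2 * m) + r * h + r * 4
        back = solve-∀

      -- The potential jumps by 2 - `M i c`, which is at most 1 + `w c` exactly if one of the two
      -- bits is set: this is where satisfaction enters.
      passage : ∀ c → c ≤ m → Lipschitz (lowPotential 0 c) (upPotential 0 c) (1 + w c)
      passage c c≤ =
        subst₂ (λ a b → Lipschitz a b (1 + w c)) (sym (lowPotential-≡ c (inside i refl))) (sym (trans (upPotential-≡ c (inside i refl)) up≡))
          ( ≤-by (M≤1 i c) _ (forth (i * (2 * m)) (c * H i) (M i c) (w c))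
          , ≤-by (satisfied c c≤) 0 (back (i * (2 * m)) (c * H i) (M i c) (w c)))
        where
        eq : ∀ c d i h → (c + d) * (h + 4 * i) + 2 ≡ i * (2 * (c + d)) + c * h + 2 + (i * (2 * (c + d)) + d * h)
        eq = solve-∀
        top≡ : top ≡ i * (2 * m) + c * H i + 2 + (i * (2 * m) + (m ∸ c) * H i)
        top≡ = trans (sym (H-top i≤)) (subst (λ m′ → m′ * (H i + 4 * i) + 2 ≡ i * (2 * m′) + c * H i + 2 + (i * (2 * m′) + (m ∸ c) * H i)) (m+[n∸m]≡n c≤) (eq c (m ∸ c) i (H i)))
        up≡ : top ∸ (i * (2 * m) + (m ∸ c) * H i) ≡ i * (2 * m) + c * H i + 2
        up≡ = trans (cong (_∸ (i * (2 * m) + (m ∸ c) * H i)) top≡) (m+n∸n≡m (i * (2 * m) + c * H i + 2) (i * (2 * m) + (m ∸ c) * H i))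
        forth : ∀ e a p q → (e + a + 2 + (1 + q)) + p ≡ e + (a + p) + 1 + (2 + q)
        forth = solve-∀
        back : ∀ e a p q → (e + (a + p) + (1 + q)) + 1 ≡ e + a + 2 + (p + q) + 0
        back = solve-∀

      potential-vertex : ∀ {y c} .(y< : y < rows) .(c< : c < columns) → vertexPotential (vertex y c y< c<) ≡ rowPotential y c
      potential-vertex y< c< = trans (vertexPotential-combine (fromℕ< y<) (fromℕ< c<)) (cong₂ rowPotential (Fin.toℕ-fromℕ< y<) (Fin.toℕ-fromℕ< c<))

      vertical-lipschitz : ∀ y c → Lipschitz (rowPotential (toℕ y) (toℕ c)) (rowPotential (suc (toℕ y)) (toℕ c)) (ω (vertical y c))
      vertical-lipschitz y c with <-cmp (toℕ y) N′
      ... | tri< y<N′ y≢N′ _ with k , eq ← m≤n⇒∃[o]m+o≡n y<N′ = subst₂ (λ a b → Lipschitz a b (ω (vertical y c)))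
          (sym (rowPotential-low (suc k) (toℕ c) (trans (+-suc (toℕ y) k) eq)))
          (sym (rowPotential-low k (toℕ c) eq))
          (subst (Lipschitz _ _) (sym (outer y c y≢N′)) (low-vertical k (toℕ c) (subst (suc k ≤_) eq (s≤s (m≤n+m k (toℕ y)))) (s≤s⁻¹ (Fin.toℕ<n c))))
      ... | tri≈ _ y≡N′ _ = subst₂ (λ a b → Lipschitz a b (ω (vertical y c)))
          (sym (rowPotential-low 0 (toℕ c) (trans (+-identityʳ (toℕ y)) y≡N′)))
          (sym (rowPotential-up 0 (toℕ c) (trans (cong suc y≡N′) (sym (+-identityʳ (suc N′))))))
          (subst (Lipschitz _ _) (sym (middle y c y≡N′)) (passage (toℕ c) (s≤s⁻¹ (Fin.toℕ<n c))))
      ... | tri> _ y≢N′ N′<y with k , eq ← m≤n⇒∃[o]m+o≡n N′<y = subst₂ (λ a b → Lipschitz a b (ω (vertical y c)))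
          (sym (rowPotential-up k (toℕ c) (sym eq)))
          (sym (rowPotential-up (suc k) (toℕ c) (trans (cong suc (sym eq)) (sym (+-suc (suc N′) k)))))
          (subst (Lipschitz _ _) (sym (outer y c y≢N′)) (up-vertical k (toℕ c)
            (+-cancelˡ-≤ N′ (suc k) N′ (s≤s⁻¹ (subst₂ _≤_ (trans (cong suc (sym eq)) (cong suc (sym (+-suc N′ k)))) (+-suc N′ N′) (Fin.toℕ<n y))))))

      horizontal-lipschitz : ∀ y c → Lipschitz (rowPotential (toℕ y) (toℕ c)) (rowPotential (toℕ y) (suc (toℕ c))) (ω (horizontal y c))
      horizontal-lipschitz y c with ≤-<-connex (toℕ y) N′
      ... | inj₁ y≤N′ with k , eq ← m≤n⇒∃[o]m+o≡n y≤N′ = subst₂ (λ a b → Lipschitz a b (ω (horizontal y c)))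
          (sym (rowPotential-low k (toℕ c) eq)) (sym (rowPotential-low k (suc (toℕ c)) eq))
          (low-horizontal k (toℕ c) (ω (horizontal y c)) (lower y c k eq))
      ... | inj₂ N′<y with k , eq ← m≤n⇒∃[o]m+o≡n N′<y = subst₂ (λ a b → Lipschitz a b (ω (horizontal y c)))
          (sym (rowPotential-up k (toℕ c) (sym eq))) (sym (rowPotential-up k (suc (toℕ c)) (sym eq)))
          (subst (Lipschitz _ _) (sym (upper y c k (sym eq))) (up-horizontal k (toℕ c) (Fin.toℕ<n c)))

      edge-lipschitz : ∀ e → Lipschitz (vertexPotential (source e)) (vertexPotential (target e)) (ω e)
      edge-lipschitz e with view e
      ... | isVertical y c = subst₂ (λ a b → Lipschitz a b (ω (vertical y c)))
          (sym (trans (cong (vertexPotential ∘ proj₁) (ends-vertical y c)) (trans (vertexPotential-combine (inject₁ y) c) (cong (λ z → rowPotential z (toℕ c)) (Fin.toℕ-inject₁ y)))))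
          (sym (trans (cong (vertexPotential ∘ proj₂) (ends-vertical y c)) (vertexPotential-combine (Fin.suc y) c)))
          (vertical-lipschitz y c)
      ... | isHorizontal y c = subst₂ (λ a b → Lipschitz a b (ω (horizontal y c)))
          (sym (trans (cong (vertexPotential ∘ proj₁) (ends-horizontal y c)) (trans (vertexPotential-combine y (inject₁ c)) (cong (rowPotential (toℕ y)) (Fin.toℕ-inject₁ c)))))
          (sym (trans (cong (vertexPotential ∘ proj₂) (ends-horizontal y c)) (vertexPotential-combine y (Fin.suc c))))
          (horizontal-lipschitz y c)

      crossing-length : (p : Walk (low i 0 z≤n) (up i m i≤ ≤-refl)) → top ≤ walkLength ω p
      crossing-length p = subst₂ _≤_ right (cong (_+ walkLength ω p) left) (potential vertexPotential edge-lipschitz p)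
        where
        centred : ∣ i - i ∣ ≡ 0 × i ⊔ i ≡ i
        centred = ∣n-n∣≡0 i , ⊔-idem i
        left : vertexPotential (low i 0 z≤n) ≡ 0
        left = trans (potential-vertex (low< i) (s≤s z≤n)) (trans (rowPotential-low i 0 (m∸n+n≡m i≤)) (trans (lowPotential-≡ 0 centred) (M-first i)))
        right : vertexPotential (up i m i≤ ≤-refl) ≡ top
        right = trans (potential-vertex (up< i≤) (s≤s ≤-refl)) (trans (rowPotential-up i m refl) (trans (upPotential-≡ m centred) (cong (λ z → top ∸ z * H i) (n∸n≡0 m))))

    -- A shortest walk need not be found: the double negation suffices, because the goal is an
    -- inequality of naturals, which is stable.
    ¬¬-distance : ∀ {u v} → Walk u v → ¬ ¬ (∃ λ d → IsDistance ω u v d)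
    ¬¬-distance {u} {v} p none = descend (suc (walkLength ω p)) p ≤-refl
      where
      descend : ∀ b (p : Walk u v) → walkLength ω p < b → ⊥
      descend (suc b) p (s≤s p≤) = none (walkLength ω p , (p , refl) , λ q → ≮⇒≥ λ q<p → descend b q (<-≤-trans q<p p≤))

    diameter≤top : ∀ {D} → IsDiameter ω D → D ≤ top
    diameter≤top ((u , v , _ , shortest) , _) with separation u v
    ... | inj₁ (p , p≤)             = ≤-trans (shortest p) (≤-trans p≤ (+-monoʳ-≤ _ (s≤s z≤n)))
    ... | inj₂ (_ , _ , _ , p , p≤) = ≤-trans (shortest p) p≤

    satisfied⇒top≤diameter : ∀ {D k} → IsDiameter ω D → k ≤ N′ → Satisfied k → top ≤ D
    satisfied⇒top≤diameter {D} {k} (_ , largest) k≤ sat = ≮⇒≥ λ D<top →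
      ¬¬-distance (connected (low k 0 z≤n) (up k m k≤ ≤-refl)) λ { (d , dist@((p , p≡) , _)) →
        <⇒≱ D<top (≤-trans (crossing-length k k≤ sat p) (≤-trans (≤-reflexive p≡) (largest _ _ d dist))) }

    top≤diameter⇒satisfied : ∀ {D} → IsDiameter ω D → top ≤ D → ∃ λ k → k ≤ N′ × Satisfied k
    top≤diameter⇒satisfied ((u , v , _ , shortest) , _) top≤ with separation u v
    ... | inj₁ (p , p≤)          = contradiction (≤-trans top≤ (≤-trans (shortest p) p≤)) (<⇒≱ (+-monoʳ-< _ (s≤s (s≤s z≤n))))
    ... | inj₂ (k , k≤ , sat , _) = k , k≤ , sat

-- Partial assignments as numbers

half-digit : ∀ b k → b < 2 → (b + k * 2) / 2 ≡ k
half-digit b k b<2 = trans (+-distrib-/-∣ʳ b (divides k refl)) (cong₂ _+_ (m<n⇒m/n≡0 b<2) (m*n/n≡m k 2))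

lowBit : ℕ → ℕ
lowBit y = y ∸ 2 * (y / 2)

lowBit-digit : ∀ b k → b < 2 → lowBit (b + k * 2) ≡ b
lowBit-digit b k b<2 = trans (cong (λ z → b + k * 2 ∸ 2 * z) (half-digit b k b<2)) (trans (cong (b + k * 2 ∸_) (*-comm 2 k)) (m+n∸n≡m b (k * 2)))

data Digits : ℕ → Set where
  digits : ∀ b k → b < 2 → Digits (b + k * 2)

digits-of : ∀ x → Digits x
digits-of x = subst Digits (sym (m≡m%n+[m/n]*n x 2)) (digits (x % 2) (x / 2) (m%n<n x 2))

lowBit≤1 : ∀ y → lowBit y ≤ 1
lowBit≤1 y with digits-of y
... | digits b k b<2 = subst (_≤ 1) (sym (lowBit-digit b k b<2)) (s≤s⁻¹ b<2)

-- Repeated halving instead of a division by 2 ^ v, as the loop `halve` computes it.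
shift : ℕ → ℕ → ℕ
shift zero    z = z
shift (suc v) z = shift v (z / 2)

bit : ℕ → ℕ → ℕ
bit v z = lowBit (shift v z)

half-< : ∀ {z y} → z < 2 * y → z / 2 < y
half-< {z} {y} z< with digits-of z
... | digits b k b<2 = subst (_< y) (sym (half-digit b k b<2))
  (*-cancelʳ-< 2 k y (≤-<-trans (m≤n+m (k * 2) b) (<-≤-trans z< (≤-reflexive (*-comm 2 y)))))

shift-small : ∀ v {z} → z < 2 ^ v → shift v z ≡ 0
shift-small zero    (s≤s z≤n) = refl
shift-small (suc v) z<        = shift-small v (half-< z<)

shift-scaled : ∀ a v z → shift (a + v) (z * 2 ^ a) ≡ shift v z
shift-scaled zero    v z = cong (shift v) (*-identityʳ z)
shift-scaled (suc a) v z = trans (cong (shift (a + v)) (trans (cong (_/ 2) (eq z (2 ^ a))) (m*n/n≡m (z * 2 ^ a) 2))) (shift-scaled a v z)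
  where
  eq : ∀ z x → z * (2 * x) ≡ z * x * 2
  eq = solve-∀

bit-scaled : ∀ {a} v z → v < a → bit v (z * 2 ^ a) ≡ 0
bit-scaled {suc a} zero    z _ = trans (cong lowBit (eq z (2 ^ a))) (lowBit-digit 0 (z * 2 ^ a) (s≤s z≤n))
  where
  eq : ∀ z x → z * (2 * x) ≡ 0 + z * x * 2
  eq = solve-∀
bit-scaled {suc a} (suc v) z (s≤s v<a) = trans (cong (bit v) (trans (cong (_/ 2) (eq z (2 ^ a))) (m*n/n≡m (z * 2 ^ a) 2))) (bit-scaled v z v<a)
  where
  eq : ∀ z x → z * (2 * x) ≡ z * x * 2
  eq = solve-∀

complement-digit : ∀ b k y → b < 2 → k < y → 2 * y ∸ 1 ∸ (b + k * 2) ≡ (1 ∸ b) + (y ∸ 1 ∸ k) * 2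
complement-digit b k y b<2 k<y with d , refl ← m≤n⇒∃[o]m+o≡n k<y | c , bc ← m≤n⇒∃[o]m+o≡n (s≤s⁻¹ b<2) = begin
  2 * (suc k + d) ∸ 1 ∸ (b + k * 2)     ≡⟨ cong (λ z → z ∸ 1 ∸ (b + k * 2)) (eq k d) ⟩
  1 + k * 2 + d * 2 ∸ (b + k * 2)       ≡⟨ cong (_∸ (b + k * 2)) (trans (cong (λ z → z + k * 2 + d * 2) (sym bc)) (eq′ b c k d)) ⟩
  c + d * 2 + (b + k * 2) ∸ (b + k * 2) ≡⟨ m+n∸n≡m (c + d * 2) (b + k * 2) ⟩
  c + d * 2                             ≡⟨ cong₂ (λ x y → x + y * 2) (sym (trans (cong (_∸ b) (sym bc)) (m+n∸m≡n b c))) (sym (m+n∸m≡n k d)) ⟩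
  (1 ∸ b) + (k + d ∸ k) * 2             ∎
  where
  open ≡-Reasoning
  eq : ∀ k d → 2 * (suc k + d) ≡ 1 + (1 + k * 2 + d * 2)
  eq = solve-∀
  eq′ : ∀ b c k d → b + c + k * 2 + d * 2 ≡ c + d * 2 + (b + k * 2)
  eq′ = solve-∀

-- All a bits of 2 ^ a ∸ 1 are set, so the subtraction never borrows; the proof peels off one digit
-- at a time.
bit-complement : ∀ {a} v z → v < a → z < 2 ^ a → bit v (2 ^ a ∸ 1 ∸ z) ≡ 1 ∸ bit v z
bit-complement {suc a} v z v<a z< with digits-of z
bit-complement {suc a} zero    _ v<a z< | digits b k b<2 =
  trans (cong lowBit (complement-digit b k (2 ^ a) b<2 k<)) (trans (lowBit-digit (1 ∸ b) (2 ^ a ∸ 1 ∸ k) (s≤s (m∸n≤m 1 b))) (cong (1 ∸_) (sym (lowBit-digit b k b<2))))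
  where
  k< : k < 2 ^ a
  k< = subst (_< 2 ^ a) (half-digit b k b<2) (half-< z<)
bit-complement {suc a} (suc v) _ (s≤s v<a) z< | digits b k b<2 =
  trans (cong (bit v) (trans (cong (_/ 2) (complement-digit b k (2 ^ a) b<2 k<)) (half-digit (1 ∸ b) (2 ^ a ∸ 1 ∸ k) (s≤s (m∸n≤m 1 b)))))
    (trans (bit-complement v k v<a k<) (cong (λ z → 1 ∸ bit v z) (sym (half-digit b k b<2))))
  where
  k< : k < 2 ^ a
  k< = subst (_< 2 ^ a) (half-digit b k b<2) (half-< z<)

indicator : Bool → ℕ
indicator b = if b then 1 else 0

indicator<2 : ∀ b → indicator b < 2
indicator<2 false = s≤s z≤n
indicator<2 true  = s≤s (s≤s z≤n)

number : ℕ → (ℕ → Bool) → ℕ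
number zero    γ = 0
number (suc a) γ = indicator (γ 0) + number a (γ ∘ suc) * 2

number< : ∀ a γ → number a γ < 2 ^ a
number< zero    γ = s≤s z≤n
number< (suc a) γ = begin-strict
  indicator (γ 0) + number a (γ ∘ suc) * 2  <⟨ +-monoˡ-< (number a (γ ∘ suc) * 2) (indicator<2 (γ 0)) ⟩
  suc (number a (γ ∘ suc)) * 2              ≤⟨ *-monoˡ-≤ 2 (number< a (γ ∘ suc)) ⟩
  2 ^ a * 2                                 ≡⟨ *-comm (2 ^ a) 2 ⟩
  2 ^ suc a                                 ∎
  where open ≤-Reasoning

bit-number : ∀ {a} v γ → v < a → bit v (number a γ) ≡ indicator (γ v)
bit-number {suc a} zero    γ _         = lowBit-digit (indicator (γ 0)) (number a (γ ∘ suc)) (indicator<2 (γ 0))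
bit-number {suc a} (suc v) γ (s≤s v<a) = trans (cong (bit v) (half-digit (indicator (γ 0)) (number a (γ ∘ suc)) (indicator<2 (γ 0)))) (bit-number v (γ ∘ suc) v<a)

-- A partial assignment is a pair of numbers: a positive literal is true if
-- its bit of z₁ is set, a negative one if its bit of z₀ is set.
literalValue : ℕ → ℕ → ℕ → ℕ
literalValue z₀ z₁ x = bit (x / 2) ((1 ∸ (x ∸ 2 * (x / 2))) * z₀ + (x ∸ 2 * (x / 2)) * z₁)

literalValue≤1 : ∀ z₀ z₁ x → literalValue z₀ z₁ x ≤ 1
literalValue≤1 z₀ z₁ x = lowBit≤1 (shift (x / 2) ((1 ∸ (x ∸ 2 * (x / 2))) * z₀ + (x ∸ 2 * (x / 2)) * z₁))

-- On bits, 1 ∸ (1 ∸ u) * (1 ∸ v) is disjunction. The accumulator mirrors the loop that reads the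
-- literals of a clause.
disjoin : ℕ → ℕ → ℕ → List ℕ → ℕ
disjoin z₀ z₁ acc []       = acc
disjoin z₀ z₁ acc (x ∷ xs) = disjoin z₀ z₁ (1 ∸ (1 ∸ acc) * (1 ∸ literalValue z₀ z₁ x)) xs

clauseValue : ∀ {n} → ℕ → ℕ → Clause n → ℕ
clauseValue z₀ z₁ cl = disjoin z₀ z₁ 0 (map encodeLiteral cl)

literalValue-encode : ∀ {n} z₀ z₁ (i : Fin n) b → literalValue z₀ z₁ (encodeLiteral (i , b)) ≡ bit (toℕ i) (if b then z₁ else z₀)
literalValue-encode z₀ z₁ i b = begin
  literalValue z₀ z₁ (2 * toℕ i + indicator b)  ≡⟨ cong (literalValue z₀ z₁) (trans (+-comm (2 * toℕ i) (indicator b)) (cong (indicator b +_) (*-comm 2 (toℕ i)))) ⟩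
  literalValue z₀ z₁ x                          ≡⟨ cong₂ (λ v c → bit v ((1 ∸ c) * z₀ + c * z₁)) (half-digit (indicator b) (toℕ i) (indicator<2 b)) (lowBit-digit (indicator b) (toℕ i) (indicator<2 b)) ⟩
  bit (toℕ i) ((1 ∸ indicator b) * z₀ + indicator b * z₁)  ≡⟨ cong (bit (toℕ i)) (select b) ⟩
  bit (toℕ i) (if b then z₁ else z₀)            ∎
  where
  open ≡-Reasoning
  x = indicator b + toℕ i * 2
  select : ∀ b → (1 ∸ indicator b) * z₀ + indicator b * z₁ ≡ (if b then z₁ else z₀)
  select false = trans (+-identityʳ (1 * z₀)) (*-identityˡ z₀)
  select true  = *-identityˡ z₁

disjoin≤1 : ∀ z₀ z₁ {acc} xs → acc ≤ 1 → disjoin z₀ z₁ acc xs ≤ 1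
disjoin≤1 z₀ z₁       []       acc≤ = acc≤
disjoin≤1 z₀ z₁ {acc} (x ∷ xs) acc≤ = disjoin≤1 z₀ z₁ xs (m∸n≤m 1 ((1 ∸ acc) * (1 ∸ literalValue z₀ z₁ x)))

disjoin-true : ∀ z₀ z₁ xs → disjoin z₀ z₁ 1 xs ≡ 1
disjoin-true z₀ z₁ []       = refl
disjoin-true z₀ z₁ (x ∷ xs) = disjoin-true z₀ z₁ xs

True : ∀ {n} → ℕ → ℕ → Literal n → Set
True z₀ z₁ (i , b) = bit (toℕ i) (if b then z₁ else z₀) ≡ 1

disjoin-step : ∀ {n} z₀ z₁ (i : Fin n) b xs → True z₀ z₁ (i , b) → disjoin z₀ z₁ 0 (encodeLiteral (i , b) ∷ xs) ≡ 1
disjoin-step z₀ z₁ i b xs p rewrite trans (literalValue-encode z₀ z₁ i b) p = disjoin-true z₀ z₁ xs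

clause-true : ∀ {n} z₀ z₁ {cl : Clause n} → Any (True z₀ z₁) cl → clauseValue z₀ z₁ cl ≡ 1
clause-true z₀ z₁ {(i , b) ∷ cl} (here p) = disjoin-step z₀ z₁ i b (map encodeLiteral cl) p
clause-true z₀ z₁ {(i , b) ∷ cl} (there any) with literalValue z₀ z₁ (encodeLiteral (i , b))
... | zero  = clause-true z₀ z₁ any
... | suc y rewrite 0∸n≡0 y = disjoin-true z₀ z₁ (map encodeLiteral cl)

clause-true⁻¹ : ∀ {n} z₀ z₁ (cl : Clause n) → 1 ≤ clauseValue z₀ z₁ cl → Any (True z₀ z₁) cl
clause-true⁻¹ z₀ z₁ ((i , b) ∷ cl) p with literalValue z₀ z₁ (encodeLiteral (i , b)) in eq
... | zero        = there (clause-true⁻¹ z₀ z₁ cl p)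
... | suc zero    = here (trans (sym (literalValue-encode z₀ z₁ i b)) eq)
... | suc (suc y) = contradiction (subst (_≤ 1) eq (literalValue≤1 z₀ z₁ (encodeLiteral (i , b)))) λ { (s≤s ()) }

1∸-true : ∀ {u v} → v ≡ 1 ∸ u → v ≡ 1 → u ≡ 0
1∸-true {zero}  _ _ = refl
1∸-true {suc u} p q with () ← trans (sym (trans p (0∸n≡0 u))) q

module Split {n : ℕ} (a p : ℕ) (n≡ : n ≡ a + p) where

  -- The complement is taken within the a or p bits of the own half only. On the variables of the
  -- other half both numbers have bit 0, so there literals of either sign count as false.
  Left Right : ℕ → Literal n → Set
  Left  x = True (2 ^ a ∸ 1 ∸ x) x
  Right y = True ((2 ^ p ∸ 1 ∸ y) * 2 ^ a) (y * 2 ^ a)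

  variableOf : ∀ {i : Fin n} → a ≤ toℕ i → toℕ i ≡ a + (toℕ i ∸ a) × toℕ i ∸ a < p
  variableOf {i} a≤ = sym (m+[n∸m]≡n a≤) , +-cancelˡ-< a _ p (subst₂ _<_ (sym (m+[n∸m]≡n a≤)) n≡ (Fin.toℕ<n i))

  left⇒ : ∀ {x} → x < 2 ^ a → ∀ i b → Left x (i , b) → toℕ i < a × bit (toℕ i) x ≡ indicator b
  left⇒ {x} x< i b t with toℕ i <? a
  ... | no i≮a = contradiction t (absurd b)
    where
    below : ∀ z → z < 2 ^ a → bit (toℕ i) z ≡ 0
    below z z< = cong lowBit (shift-small (toℕ i) (<-≤-trans z< (^-monoʳ-≤ 2 (≮⇒≥ i≮a))))
    absurd : ∀ b → ¬ Left x (i , b)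
    absurd true  p with () ← trans (sym (below x x<)) p
    absurd false p with () ← trans (sym (below _ (≤-<-trans (m∸n≤m (2 ^ a ∸ 1) x) (∸-monoʳ-< {2 ^ a} {1} {0} (s≤s z≤n) (m^n>0 2 a))))) p
  ... | yes i<a = i<a , value b t
    where
    value : ∀ b → Left x (i , b) → bit (toℕ i) x ≡ indicator b
    value true  p = p
    value false p = 1∸-true (bit-complement (toℕ i) x i<a x<) p

  left⇐ : ∀ {x} → x < 2 ^ a → ∀ i b → toℕ i < a → bit (toℕ i) x ≡ indicator b → Left x (i , b)
  left⇐ x< i true  i<a q = q
  left⇐ {x} x< i false i<a q = trans (bit-complement (toℕ i) x i<a x<) (cong (1 ∸_) q)

  right-bit : ∀ (i : Fin n) → a ≤ toℕ i → ∀ z → bit (toℕ i) (z * 2 ^ a) ≡ bit (toℕ i ∸ a) z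
  right-bit i a≤ z = cong lowBit (trans (cong (λ v → shift v (z * 2 ^ a)) (sym (m+[n∸m]≡n a≤))) (shift-scaled a (toℕ i ∸ a) z))

  right⇒ : ∀ {y} → y < 2 ^ p → ∀ i b → Right y (i , b) → a ≤ toℕ i × bit (toℕ i ∸ a) y ≡ indicator b
  right⇒ {y} y< i b t with toℕ i <? a
  ... | yes i<a = contradiction t (absurd b)
    where
    absurd : ∀ b → ¬ Right y (i , b)
    absurd true  q with () ← trans (sym (bit-scaled (toℕ i) y i<a)) q
    absurd false q with () ← trans (sym (bit-scaled (toℕ i) (2 ^ p ∸ 1 ∸ y) i<a)) q
  ... | no i≮a = ≮⇒≥ i≮a , value b t
    where
    value : ∀ b → Right y (i , b) → bit (toℕ i ∸ a) y ≡ indicator b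
    value true  q = trans (sym (right-bit i (≮⇒≥ i≮a) y)) q
    value false q = 1∸-true (trans (right-bit i (≮⇒≥ i≮a) (2 ^ p ∸ 1 ∸ y)) (bit-complement (toℕ i ∸ a) y (proj₂ (variableOf {i} (≮⇒≥ i≮a))) y<)) q

  right⇐ : ∀ {y} → y < 2 ^ p → ∀ i b → a ≤ toℕ i → bit (toℕ i ∸ a) y ≡ indicator b → Right y (i , b)
  right⇐ {y} y< i true  a≤ q = trans (right-bit i a≤ y) q
  right⇐ {y} y< i false a≤ q = trans (right-bit i a≤ (2 ^ p ∸ 1 ∸ y)) (trans (bit-complement (toℕ i ∸ a) y (proj₂ (variableOf {i} a≤)) y<) (cong (1 ∸_) q))

  leftValue rightValue : ℕ → Clause n → ℕ
  leftValue  x = clauseValue (2 ^ a ∸ 1 ∸ x) x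
  rightValue y = clauseValue ((2 ^ p ∸ 1 ∸ y) * 2 ^ a) (y * 2 ^ a)

  Covers : CNF n → ℕ → ℕ → Set
  Covers φ x y = All (λ cl → 1 ≤ leftValue x cl + rightValue y cl) φ

  covers⇒satisfiable : ∀ {φ x y} → x < 2 ^ a → y < 2 ^ p → Covers φ x y → Satisfiable φ
  covers⇒satisfiable {φ} {x} {y} x< y< covers = assignment , All.map (λ {cl} → clause cl) covers
    where
    assignment : Fin n → Bool
    assignment i = does ((if does (toℕ i <? a) then bit (toℕ i) x else bit (toℕ i ∸ a) y) ≟ 1)
    decided : ∀ b {u} → u ≡ indicator b → does (u ≟ 1) ≡ b
    decided false refl = refl
    decided true  refl = refl
    from-left : ∀ (l : Literal n) → Left x l → assignment (proj₁ l) ≡ proj₂ l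
    from-left (i , b) t with i<a , q ← left⇒ x< i b t rewrite dec-true (toℕ i <? a) i<a = decided b q
    from-right : ∀ (l : Literal n) → Right y l → assignment (proj₁ l) ≡ proj₂ l
    from-right (i , b) t with a≤i , q ← right⇒ y< i b t rewrite dec-false (toℕ i <? a) (≤⇒≯ a≤i) = decided b q
    clause : ∀ cl → 1 ≤ leftValue x cl + rightValue y cl → Any (λ (i , b) → assignment i ≡ b) cl
    clause cl 1≤ with leftValue x cl in eq
    ... | zero  = Any.map (λ {l} → from-right l) (clause-true⁻¹ _ _ cl 1≤)
    ... | suc _ = Any.map (λ {l} → from-left l) (clause-true⁻¹ _ _ cl (subst (1 ≤_) (sym eq) (s≤s z≤n)))

  satisfiable⇒covers : ∀ {φ} → Satisfiable φ → ∃₂ λ x y → x < 2 ^ a × y < 2 ^ p × Covers φ x y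
  satisfiable⇒covers {φ} (α , sat) = x , y , number< a γ , number< p (γ ∘ (a +_)) , All.map (λ {cl} → clause cl) sat
    where
    -- `number` reads an infinite sequence, so the assignment is continued by false.
    γ : ℕ → Bool
    γ v with v <? n
    ... | yes v<n = α (fromℕ< v<n)
    ... | no _    = false
    γ-toℕ : ∀ i → γ (toℕ i) ≡ α i
    γ-toℕ i with toℕ i <? n
    ... | yes i<n = cong α (Fin.fromℕ<-toℕ i i<n)
    ... | no i≮n  = contradiction (Fin.toℕ<n i) i≮n
    x y : ℕ
    x = number a γ
    y = number p (γ ∘ (a +_))
    literal : ∀ (l : Literal n) → α (proj₁ l) ≡ proj₂ l → Left x l ⊎ Right y l
    literal (i , b) αi with toℕ i <? a
    ... | yes i<a = inj₁ (left⇐ (number< a γ) i b i<a (trans (bit-number (toℕ i) γ i<a) (cong indicator (trans (γ-toℕ i) αi))))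
    ... | no i≮a  = inj₂ (right⇐ (number< p (γ ∘ (a +_))) i b (≮⇒≥ i≮a)
      (trans (bit-number (toℕ i ∸ a) (γ ∘ (a +_)) (proj₂ (variableOf {i} (≮⇒≥ i≮a))))
             (cong indicator (trans (cong γ (m+[n∸m]≡n (≮⇒≥ i≮a))) (trans (γ-toℕ i) αi)))))
    either : ∀ {cl : Clause n} → Any (λ (i , b) → α i ≡ b) cl → Any (Left x) cl ⊎ Any (Right y) cl
    either {l ∷ _} (here q) = Sum.map here here (literal l q)
    either (there any)      = Sum.map there there (either any)
    clause : ∀ cl → Any (λ (i , b) → α i ≡ b) cl → 1 ≤ leftValue x cl + rightValue y cl
    clause cl any with either any
    ... | inj₁ l = ≤-trans (≤-reflexive (sym (clause-true _ _ l))) (m≤m+n _ _)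
    ... | inj₂ r = ≤-trans (≤-reflexive (sym (clause-true _ _ r))) (m≤n+m _ (leftValue x cl))

-- The default d is the value of the dummy column behind the clauses.
at : ℕ → List ℕ → ℕ → ℕ
at d []       c       = d
at d (x ∷ xs) zero    = x
at d (x ∷ xs) (suc c) = at d xs c

at-bound : ∀ {A : Set} {d b} (f : A → ℕ) → d ≤ b → (∀ x → f x ≤ b) → ∀ xs c → at d (map f xs) c ≤ b
at-bound f d≤ f≤ []       c       = d≤
at-bound f d≤ f≤ (x ∷ xs) zero    = f≤ x
at-bound f d≤ f≤ (x ∷ xs) (suc c) = at-bound f d≤ f≤ xs c

at-end : ∀ {A : Set} d (f : A → ℕ) xs → at d (map f xs) (length xs) ≡ d
at-end d f []       = refl
at-end d f (x ∷ xs) = at-end d f xs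

at-all : ∀ {A : Set} {d d′} (f g : A → ℕ) → 1 ≤ d + d′ → ∀ {xs} → All (λ x → 1 ≤ f x + g x) xs → ∀ c → 1 ≤ at d (map f xs) c + at d′ (map g xs) c
at-all f g 1≤ []       c       = 1≤
at-all f g 1≤ (p ∷ ps) zero    = p
at-all f g 1≤ (p ∷ ps) (suc c) = at-all f g 1≤ ps c

at-all⁻¹ : ∀ {A : Set} {d d′} (f g : A → ℕ) xs → (∀ c → c < length xs → 1 ≤ at d (map f xs) c + at d′ (map g xs) c) → All (λ x → 1 ≤ f x + g x) xs
at-all⁻¹ f g []       h = []
at-all⁻¹ f g (x ∷ xs) h = h 0 (s≤s z≤n) ∷ at-all⁻¹ f g xs (λ c c< → h (suc c) (s≤s c<))

-- The reduction

-- `row` is a row of the grid while the graph is written and the number of the right assignment in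
-- the queries. `negative` and `positive` hold the pair of numbers for the partial assignment being
-- evaluated.
answer nvars clauses base span epoch left right rowsLeft row columnsLeft column pen negative positive count pointer index shifted value previous : Fin 21
answer      = # 0
nvars       = # 1
clauses     = # 2
base        = # 3
span        = # 4
epoch       = # 5
left        = # 6
right       = # 7
rowsLeft    = # 8
row         = # 9
columnsLeft = # 10
column      = # 11
pen         = # 12
negative       = # 13
positive       = # 14
count       = # 15
pointer     = # 16
index       = # 17
shifted     = # 18
value       = # 19
previous    = # 20

environment : (ans n l b E e N P rl y cl c q z₀ z₁ k p i u v w : ℕ) → Env 21
environment ans n l b E e N P rl y cl c q z₀ z₁ k p i u v w =
  ans , n , l , b , E , e , N , P , rl , y , cl , c , q , z₀ , z₁ , k , p , i , u , v , w , tt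

open Virtual base span epoch hiding (value)

bitOf : Exp 21 → Exp 21
bitOf x = x ⊖ lit 2 ⊗ (x ⊘ lit 2)

-- `pointer` rests on the cell before the next literal, so the cell with the length of a clause is
-- the natural start.
halve literal skipClauses evalClause : Cmd
halve = for index (shifted ≐ var shifted ⊘ lit 2)
literal =
  pointer ≐ lit 1 ⊕ var pointer ⨾
  index ≐ mem[ var pointer ] ⊘ lit 2 ⨾
  shifted ≐ (lit 1 ⊖ bitOf mem[ var pointer ]) ⊗ var negative ⊕ bitOf mem[ var pointer ] ⊗ var positive ⨾
  halve ⨾
  value ≐ lit 1 ⊖ (lit 1 ⊖ var value) ⊗ (lit 1 ⊖ bitOf (var shifted))
skipClauses = for count (pointer ≐ lit 1 ⊕ mem[ var pointer ] ⊕ var pointer)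
evalClause =
  value ≐ lit 0 ⨾
  count ≐ mem[ var pointer ] ⨾
  for count literal

-- The parameter g is the value of the first dummy column, and the last one gets 1 ∸ g: 0 and 1 for
-- the rows, 1 and 0 for the middle edges.
columnValue : ℕ → Cmd
columnValue g =
  branch (var column)
    (branch (var column ⊖ var clauses)
      (value ≐ lit (1 ∸ g))
      (pointer ≐ lit 2 ⨾ count ≐ var column ⊖ lit 1 ⨾ skipClauses ⨾ evalClause))
    (value ≐ lit g)

power : Cmd
power = shifted ≐ lit 1 ⨾ for count (shifted ≐ var shifted ⊗ lit 2)

-- Skipping all clauses leaves `pointer` at the first free cell, which becomes the base. There are 1
-- + P epochs: number 0 for the preprocessing and one for each right assignment.
setup : ℕ → Cmd
setup D =
  nvars ≐ mem[ lit 0 ] ⨾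
  clauses ≐ mem[ lit 1 ] ⨾
  pointer ≐ lit 2 ⨾
  count ≐ var clauses ⨾
  skipClauses ⨾
  base ≐ var pointer ⨾
  count ≐ var nvars ⊘ lit D ⨾
  power ⨾
  left ≐ var shifted ⨾
  count ≐ var nvars ⊖ var nvars ⊘ lit D ⨾
  power ⨾
  right ≐ var shifted ⨾
  span ≐ lit 1 ⊕ var right

emit : Exp 21 → Cmd
emit e = save (address′ (var pen)) e ⨾ pen ≐ lit 1 ⊕ var pen

-- `fromMiddle` is an absolute difference, the sum of both truncated ones; it vanishes exactly at
-- the lower end of the middle edges.
breadth vertexHere vertexBelow fromMiddle : Exp 21
breadth     = lit 2 ⊕ var clauses
vertexHere  = breadth ⊗ var row ⊕ var column
vertexBelow = breadth ⊗ (lit 1 ⊕ var row) ⊕ var column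
fromMiddle  = (var row ⊖ (var left ⊖ lit 1)) ⊕ ((var left ⊖ lit 1) ⊖ var row)

verticalWeight : ℕ → Exp 21
verticalWeight x = (lit 1 ⊖ fromMiddle) ⊗ lit x ⊕ (lit 1 ⊖ (lit 1 ⊖ fromMiddle)) ⊗ (lit 2 ⊗ (lit 1 ⊕ var clauses))

-- One of the two truncated differences is 0, and the other is the number k of the row counted from
-- the middle; so one formula serves both halves.
horizontalWeight : Exp 21
horizontalWeight = lit 4 ⊗ (lit 1 ⊕ var left ⊖ (((var left ⊖ lit 1) ⊖ var row) ⊕ (var row ⊖ var left))) ⊕ var value ⊖ var previous

-- The order of the loops is the numbering of the edges, since the list has to be the `encodeGraph`
-- of the grid literally.
emitHeader emitHorizontal : Cmd
emitVertical : ℕ → Cmd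
emitHeader =
  emit (lit 2 ⊗ var left ⊗ breadth) ⨾
  emit ((lit 2 ⊗ var left ⊖ lit 1) ⊗ breadth ⊕ lit 2 ⊗ var left ⊗ (lit 1 ⊕ var clauses))
emitVertical x =
  row ≐ lit 0 ⨾
  rowsLeft ≐ lit 2 ⊗ var left ⊖ lit 1 ⨾
  for rowsLeft (
    column ≐ lit 0 ⨾
    columnsLeft ≐ breadth ⨾
    for columnsLeft (
      emit vertexHere ⨾
      emit vertexBelow ⨾
      emit (verticalWeight x) ⨾
      column ≐ lit 1 ⊕ var column) ⨾
    row ≐ lit 1 ⊕ var row)
emitHorizontal =
  row ≐ lit 0 ⨾
  rowsLeft ≐ lit 2 ⊗ var left ⨾
  for rowsLeft (
    positive ≐ var left ⊖ lit 1 ⊖ var row ⨾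
    negative ≐ var left ⊖ lit 1 ⊖ var positive ⨾
    value ≐ lit 0 ⨾
    column ≐ lit 0 ⨾
    columnsLeft ≐ lit 1 ⊕ var clauses ⨾
    for columnsLeft (
      previous ≐ var value ⨾
      emit vertexHere ⨾
      column ≐ lit 1 ⊕ var column ⨾
      branch (var left ⊖ var row) (columnValue 0) (value ≐ lit 0) ⨾
      emit vertexHere ⨾
      emit horizontalWeight) ⨾
    row ≐ lit 1 ⊕ var row)

-- A change is announced in the virtual registers 1 and 2, and the diameter is fetched from the
-- virtual register 0. Setting `epoch` at the start of a query is all that it takes to restore the
-- state.
change query : Cmd → Cmd
change update =
  columnValue 1 ⨾
  save (register (lit 1)) (breadth ⊗ (var left ⊖ lit 1) ⊕ var column) ⨾
  save (register (lit 2)) (lit 1 ⊕ var value) ⨾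
  virtual update ⨾
  column ≐ lit 1 ⊕ var column
query update =
  epoch ≐ lit 1 ⊕ var row ⨾
  positive ≐ var row ⊗ var left ⨾
  negative ≐ (var right ⊖ lit 1 ⊖ var row) ⊗ var left ⨾
  column ≐ lit 0 ⨾
  columnsLeft ≐ breadth ⨾
  for columnsLeft (change update) ⨾
  answer ≐ lit 1 ⊖ (lit 1 ⊖ var answer) ⊗ ((lit 1 ⊕ var clauses) ⊗ (lit 4 ⊗ (lit 1 ⊕ var left)) ⊕ lit 2 ⊖ fetch (register (lit 0))) ⨾
  row ≐ lit 1 ⊕ var row

decide : ℕ → ℕ → DynamicAlgorithm → Cmd
decide D x A =
  setup D ⨾
  emitHeader ⨾
  emitVertical x ⨾
  emitHorizontal ⨾
  virtual (DynamicAlgorithm.preprocess A) ⨾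
  row ≐ lit 0 ⨾
  rowsLeft ≐ var right ⨾
  for rowsLeft (query (DynamicAlgorithm.update A))

-- Reading the formula

Stored : Memory → ℕ → List ℕ → Set
Stored μ p []       = ⊤
Stored μ p (x ∷ xs) = μ p ≡ x × Stored μ (suc p) xs

stored-++ : ∀ {μ} p xs {ys} → Stored μ p (xs ++ ys) → Stored μ p xs × Stored μ (p + length xs) ys
stored-++ {μ} p []       {ys} st = tt , subst (λ p → Stored μ p ys) (sym (+-identityʳ p)) st
stored-++ {μ} p (x ∷ xs) {ys} (eq , st) = let l , r = stored-++ (suc p) xs st in
  (eq , l) , subst (λ p → Stored μ p ys) (sym (+-suc p (length xs))) r

stored-contents : ∀ {μ} p xs → (∀ j → j < length xs → μ (p + j) ≡ contents xs j) → Stored μ p xs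
stored-contents {μ} p []       h = tt
stored-contents {μ} p (x ∷ xs) h = trans (cong μ (sym (+-identityʳ p))) (h 0 (s≤s z≤n)) ,
  stored-contents (suc p) xs (λ j j< → trans (cong μ (sym (+-suc p j))) (h (suc j) (s≤s j<)))

block : ∀ {n} → Clause n → List ℕ
block cl = length cl ∷ map encodeLiteral cl

blocks : ∀ {n} → CNF n → List ℕ
blocks = concatMap block

length-block : ∀ {n} (cl : Clause n) → length (block cl) ≡ suc (length cl)
length-block cl = cong suc (length-map encodeLiteral cl)

length-blocks : ∀ {n} (cl : Clause n) φ → length (blocks (cl ∷ φ)) ≡ suc (length cl) + length (blocks φ)
length-blocks cl φ = trans (length-++ (block cl)) (cong (_+ length (blocks φ)) (length-block cl))

clauses≤blocks : ∀ {n} (φ : CNF n) → length φ ≤ length (blocks φ)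
clauses≤blocks []       = z≤n
clauses≤blocks (cl ∷ φ) = ≤-trans (+-mono-≤ (s≤s {0} {length cl} z≤n) (clauses≤blocks φ)) (≤-reflexive (sym (length-blocks cl φ)))

stored-block : ∀ {μ n} p (cl : Clause n) φ → Stored μ p (blocks (cl ∷ φ)) →
               Stored μ p (block cl) × Stored μ (suc (μ p + p)) (blocks φ) × suc (μ p + p) + length (blocks φ) ≡ p + length (blocks (cl ∷ φ))
stored-block {μ} p cl φ st with first@(eq , _) , rest ← stored-++ p (block cl) {blocks φ} st =
  first , subst (λ q → Stored μ q (blocks φ)) next rest ,
  trans (cong (_+ length (blocks φ)) (sym next)) (trans (+-assoc p (length (block cl)) (length (blocks φ))) (cong (p +_) (sym (length-++ (block cl)))))
  where
  next : p + length (block cl) ≡ suc (μ p + p)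
  next = trans (cong (p +_) (length-block cl)) (trans (+-suc p (length cl)) (cong suc (trans (+-comm p (length cl)) (cong (_+ p) (sym eq)))))

module Reading (S X : ℕ) (1≤S : 1 ≤ S) (small : ∀ {x} → x ≤ X → bits x ≤ S) where
  open Rules {21} S 1≤S

  small-1 : ∀ {x} → x ≤ 1 → bits x ≤ S
  small-1 x≤1 = ≤-trans (bits-mono x≤1) 1≤S

  module _ {n : ℕ} (2n≤X : 2 * n ≤ X) (ans l b E e N P rl y cl c q z₀ z₁ w : ℕ) where

    state : (k p i u v : ℕ) → Env 21
    state k p i u v = environment ans n l b E e N P rl y cl c q z₀ z₁ k p i u v w

    exec-halve : ∀ {μ k p v} i u → Exec S halve (state k p i u v , μ) (state k p 0 (shift i u) v , μ) (i * 24 + 4)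
    exec-halve zero    u = exec-for-zero index refl
    exec-halve (suc i) u = exec-for-suc index (λ ())
      (exec-assign shifted (var shifted ⊘ lit 2) (tt , tt) (λ sm → ≤-trans (bits-mono (m/n≤m u 2)) (sm shifted)))
      (exec-halve i (u / 2))

    select : ∀ x → bits ((1 ∸ lowBit x) * z₀ + lowBit x * z₁) ≤ bits z₀ ⊔ bits z₁
    select x with lowBit x | lowBit≤1 x
    ... | zero     | _ = ≤-trans (≤-reflexive (cong bits (trans (+-identityʳ (1 * z₀)) (*-identityˡ z₀)))) (m≤m⊔n (bits z₀) (bits z₁))
    ... | suc zero | _ = ≤-trans (≤-reflexive (cong bits (*-identityˡ z₁))) (m≤n⊔m (bits z₀) (bits z₁))
    ... | suc (suc _) | s≤s ()

    -- The loop `halve` runs once for each unit of the variable number x / 2 ≤ n, at 24 units of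
    -- cost; 190 collects the rest.
    exec-literal : ∀ {μ k p i u v} → suc p ≤ X → μ (suc p) ≤ 2 * n → v ≤ 1 → ∃ λ u′ →
                   Exec S literal (state k p i u v , μ) (state k (suc p) 0 u′ (1 ∸ (1 ∸ v) * (1 ∸ literalValue z₀ z₁ (μ (suc p)))) , μ) (n * 24 + 190)
    exec-literal {μ} {k} {p} {i} {u} {v} p< x≤ v≤ = _ , exec-mono (≤-by i≤n 0 (eq (x / 2) n))
        (exec-seq (exec-assign pointer (lit 1 ⊕ var pointer) {state k p i u v} (tt , tt) (λ _ → small p<))
        (exec-seq (exec-assign index (mem[ var pointer ] ⊘ lit 2) {state k (suc p) i u v} ((tt , small x≤X) , tt) (λ _ → small (≤-trans (m/n≤m x 2) x≤X)))
        (exec-seq (exec-assign shifted ((lit 1 ⊖ bitOf mem[ var pointer ]) ⊗ var negative ⊕ bitOf mem[ var pointer ] ⊗ var positive)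
                    {state k (suc p) (x / 2) u v}
                    (((tt , (tt , small x≤X) , tt , (tt , small x≤X) , tt) , tt) , ((tt , small x≤X) , tt , (tt , small x≤X) , tt) , tt)
                    (λ sm → ≤-trans (select x) (⊔-lub (sm negative) (sm positive))))
        (exec-seq (exec-halve (x / 2) ((1 ∸ lowBit x) * z₀ + lowBit x * z₁))
                  (exec-assign value (lit 1 ⊖ (lit 1 ⊖ var value) ⊗ (lit 1 ⊖ bitOf (var shifted)))
                    {state k (suc p) 0 (shift (x / 2) ((1 ∸ lowBit x) * z₀ + lowBit x * z₁)) v} _
                    (λ _ → small-1 (m∸n≤m 1 ((1 ∸ v) * (1 ∸ literalValue z₀ z₁ x)))))))))
      where
      x = μ (suc p)
      x≤X : x ≤ X
      x≤X = ≤-trans x≤ 2n≤X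
      i≤n : x / 2 * 24 ≤ n * 24
      i≤n = *-monoˡ-≤ 24 (≤-trans (/-monoˡ-≤ 2 x≤) (≤-reflexive (trans (cong (_/ 2) (*-comm 2 n)) (m*n/n≡m n 2))))
      eq : ∀ i n → n * 24 + 190 + i * 24 ≡ 9 + (13 + (103 + (i * 24 + 4 + 61))) + n * 24 + 0
      eq = solve-∀

    exec-literals : ∀ {μ} xs p i u v → Stored μ (suc p) xs → All (_≤ 2 * n) xs → p + length xs ≤ X → v ≤ 1 → ∃₂ λ i′ u′ →
                    Exec S (for count literal) (state (length xs) p i u v , μ) (state 0 (p + length xs) i′ u′ (disjoin z₀ z₁ v xs) , μ)
                         (length xs * (n * 24 + 203) + 4)
    exec-literals {μ} [] p i u v st _ _ _ = i , u ,
      subst (λ q → Exec S (for count literal) (state 0 p i u v , μ) (state 0 q i u v , μ) 4) (sym (+-identityʳ p)) (exec-for-zero count refl)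
    exec-literals {μ} (_ ∷ xs) p i u v (refl , st) (x≤ ∷ xs≤) p≤ v≤ =
      let p+≤ = ≤-trans (≤-reflexive (sym (+-suc p (length xs)))) p≤
          v′ = 1 ∸ (1 ∸ v) * (1 ∸ literalValue z₀ z₁ (μ (suc p)))
          u₁ , E = exec-literal {μ} {suc (length xs)} {p} {i} {u} {v} (≤-trans (s≤s (m≤m+n p (length xs))) p+≤) x≤ v≤
          i₂ , u₂ , F = exec-literals {μ} xs (suc p) 0 u₁ v′ st xs≤ p+≤ (m∸n≤m 1 ((1 ∸ v) * (1 ∸ literalValue z₀ z₁ (μ (suc p)))))
      in i₂ , u₂ , exec-mono {B = n * 24 + 190 + 13 + (length xs * (n * 24 + 203) + 4)} (≤-reflexive (eq (length xs) n))
           (subst (λ q → Exec S (for count literal) (state (suc (length xs)) p i u v , μ) (state 0 q i₂ u₂ (disjoin z₀ z₁ v′ xs) , μ) (n * 24 + 190 + 13 + (length xs * (n * 24 + 203) + 4)))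
             (sym (+-suc p (length xs)))
             (exec-for-suc count (λ ()) E F))
      where
      eq : ∀ l n → n * 24 + 190 + 13 + (l * (n * 24 + 203) + 4) ≡ suc l * (n * 24 + 203) + 4
      eq = solve-∀

    literals≤ : (cl : Clause n) → All (_≤ 2 * n) (map encodeLiteral cl)
    literals≤ []             = []
    literals≤ ((i , b) ∷ cl) = ≤-by (+-mono-≤ (*-monoʳ-≤ 2 (Fin.toℕ<n i)) (indicator<2 b)) 1 (eq n (toℕ i) (indicator b)) ∷ literals≤ cl
      where
      eq : ∀ n i b → 2 * n + (2 * suc i + suc b) ≡ 2 * i + b + (2 * n + 2) + 1
      eq = solve-∀

    exec-clause : ∀ {μ} (cl : Clause n) k p i u v → Stored μ p (block cl) → p + length cl ≤ X → ∃₂ λ i′ u′ →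
                  Exec S evalClause (state k p i u v , μ) (state 0 (p + length cl) i′ u′ (clauseValue z₀ z₁ cl) , μ) (length cl * (n * 24 + 203) + 16)
    exec-clause {μ} cl k p i u v (eq , st) p≤ =
      let i′ , u′ , E = exec-literals {μ} (map encodeLiteral cl) p i u 0 st (literals≤ cl) (subst (λ l → p + l ≤ X) (sym (length-map encodeLiteral cl)) p≤) z≤n
          F = exec-seq (exec-assign value (lit 0) {state k p i u v} tt (λ _ → small-1 z≤n))
              (exec-seq (exec-assign count mem[ var pointer ] {state k p i u 0} (tt , len) (λ _ → len))
              (subst (λ l → Exec S (for count literal) (state l p i u 0 , μ) (state 0 (p + length (map encodeLiteral cl)) i′ u′ (clauseValue z₀ z₁ cl) , μ) (length (map encodeLiteral cl) * (n * 24 + 203) + 4))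
                (trans (length-map encodeLiteral cl) (sym eq)) E))
      in i′ , u′ ,
         subst (λ l → Exec S evalClause (state k p i u v , μ) (state 0 (p + l) i′ u′ (clauseValue z₀ z₁ cl) , μ) (l * (n * 24 + 203) + 16)) (length-map encodeLiteral cl)
           (exec-mono (≤-reflexive (total (length (map encodeLiteral cl)) n)) F)
      where
      len : bits (μ p) ≤ S
      len = small (≤-trans (≤-reflexive eq) (≤-trans (m≤n+m (length cl) p) p≤))
      total : ∀ l n → 4 + (8 + (l * (n * 24 + 203) + 4)) ≡ l * (n * 24 + 203) + 16
      total = solve-∀

    -- The last equation fixes the end of the stored formula. It keeps the pointer below X and, once
    -- all clauses are skipped, identifies the pointer with the end.
    exec-skip-clauses : ∀ {μ} c (φ : CNF n) p i u v → Stored μ p (blocks φ) → c ≤ length φ → p + length (blocks φ) ≤ X → ∃ λ p′ →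
                        Exec S skipClauses (state c p i u v , μ) (state 0 p′ i u v , μ) (c * 30 + 4)
                        × Stored μ p′ (blocks (drop c φ)) × p′ + length (blocks (drop c φ)) ≡ p + length (blocks φ)
    exec-skip-clauses zero    φ        p i u v st _ _ = p , exec-for-zero count refl , st , refl
    exec-skip-clauses {μ} (suc c) (cl ∷ φ) p i u v st (s≤s c≤) p≤ =
      let _ , st₁ , p₁≡ = stored-block p cl φ st
          bound = ≤-trans (m≤m+n (suc (μ p + p)) (length (blocks φ))) (≤-trans (≤-reflexive p₁≡) p≤)
          p′ , E , st′ , p′≡ = exec-skip-clauses {μ} c φ (suc (μ p + p)) i u v st₁ c≤ (≤-trans (≤-reflexive p₁≡) p≤)
      in p′ , exec-for-suc count (λ ())
             (exec-assign pointer (lit 1 ⊕ mem[ var pointer ] ⊕ var pointer) {state (suc c) p i u v}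
               ((tt , tt , small (≤-trans (≤-trans (m≤m+n (μ p) p) (n≤1+n _)) bound)) , tt) (λ _ → small bound))
             E ,
      st′ , trans p′≡ p₁≡

at-drop : ∀ {A : Set} c (xs : List A) → c < length xs → ∃₂ λ x ys → drop c xs ≡ x ∷ ys × (∀ d (f : A → ℕ) → at d (map f xs) c ≡ f x)
at-drop zero    (x ∷ xs) _        = x , xs , refl , λ d f → refl
at-drop (suc c) (x ∷ xs) (s≤s c<) = at-drop c xs c<

at-beyond : ∀ {A : Set} c (xs : List A) d (f : A → ℕ) → length xs ≤ c → at d (map f xs) c ≡ d
at-beyond c       []       d f _        = refl
at-beyond (suc c) (x ∷ xs) d f (s≤s c≥) = at-beyond c xs d f c≥

columnCost : ℕ → ℕ → ℕ
columnCost n L = L * (n * 24 + 233) + 48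

blocks-drop : ∀ {n} c (φ : CNF n) → length (blocks (drop c φ)) ≤ length (blocks φ)
blocks-drop zero    φ        = ≤-refl
blocks-drop (suc c) []       = z≤n
blocks-drop (suc c) (cl ∷ φ) = ≤-trans (blocks-drop c φ) (≤-trans (m≤n+m _ (suc (length cl))) (≤-reflexive (sym (length-blocks cl φ))))

module ReadingColumn (S X : ℕ) (1≤S : 1 ≤ S) (small : ∀ {x} → x ≤ X → bits x ≤ S) {n : ℕ} (2n≤X : 2 * n ≤ X) (φ : CNF n)
                     (L≤X : 2 + length (blocks φ) ≤ X) {μ : Memory} (stored : Stored μ 2 (blocks φ)) where
  open Rules {21} S 1≤S
  open Reading S X 1≤S small

  module _ (ans b E e N P rl y cl c q z₀ z₁ w : ℕ) where

    environmentAt : (k p i u v : ℕ) → Env 21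
    environmentAt k p i u v = environment ans n (length φ) b E e N P rl y cl c q z₀ z₁ k p i u v w

    evaluate : ∀ c₁ k p i u v → suc c₁ ≡ c → c₁ < length φ → c ≤ X → ∀ d → ∃₂ λ p′ i′ → ∃ λ u′ →
               Exec S (pointer ≐ lit 2 ⨾ count ≐ var column ⊖ lit 1 ⨾ skipClauses ⨾ evalClause)
                    (environmentAt k p i u v , μ) (environmentAt 0 p′ i′ u′ (at d (map (clauseValue z₀ z₁) φ) c₁) , μ) (length (blocks φ) * (n * 24 + 233) + 34)
    evaluate c₁ k p i u v refl c₁< c≤ d =
      let p₁ , E₁ , st₁ , p₁≡ = exec-skip-clauses 2n≤X ans (length φ) b E e N P rl y cl c q z₀ z₁ w {μ} c₁ φ 2 i u v stored (<⇒≤ c₁<) L≤X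
          x , rest , drop≡ , value≡ = at-drop c₁ φ c₁<
          st₂ = subst (λ ψ → Stored μ p₁ (blocks ψ)) drop≡ st₁
          p₂≡ = trans (cong (λ ψ → p₁ + length (blocks ψ)) (sym drop≡)) p₁≡
          len≤ = ≤-trans (≤-trans (n≤1+n (length x)) (m≤m+n (suc (length x)) (length (blocks rest)))) (≤-reflexive (sym (length-blocks x rest)))
          i₂ , u₂ , E₂ = exec-clause 2n≤X ans (length φ) b E e N P rl y cl c q z₀ z₁ w {μ} x 0 p₁ i u v (proj₁ (stored-block p₁ x rest st₂))
                           (≤-trans (+-monoʳ-≤ p₁ len≤) (≤-trans (≤-reflexive p₂≡) L≤X))
          size≤ = ≤-trans len≤ (≤-trans (≤-reflexive (cong (length ∘ blocks) (sym drop≡))) (blocks-drop c₁ φ))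
      in p₁ + length x , i₂ , u₂ ,
         subst (λ z → Exec S (pointer ≐ lit 2 ⨾ count ≐ var column ⊖ lit 1 ⨾ skipClauses ⨾ evalClause) (environmentAt k p i u v , μ) (environmentAt 0 (p₁ + length x) i₂ u₂ z , μ) (length (blocks φ) * (n * 24 + 233) + 34))
           (sym (value≡ d (clauseValue z₀ z₁)))
           (exec-mono {B = 5 + (9 + (c₁ * 30 + 4 + (length x * (n * 24 + 203) + 16)))} (≤-by (+-mono-≤ (*-monoˡ-≤ 30 (≤-trans (<⇒≤ c₁<) (clauses≤blocks φ))) (*-monoˡ-≤ (n * 24 + 203) size≤)) 0 (eq (length (blocks φ)) n c₁ (length x)))
             (exec-seq (exec-assign pointer (lit 2) {environmentAt k p i u v} tt (λ _ → small (≤-trans (s≤s (s≤s z≤n)) L≤X)))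
             (exec-seq (exec-assign count (var column ⊖ lit 1) {environmentAt k 2 i u v} (tt , tt) (λ _ → small (≤-trans (n≤1+n c₁) c≤)))
             (exec-seq E₁ E₂))))
      where
      eq : ∀ L n c x → L * (n * 24 + 233) + 34 + (c * 30 + x * (n * 24 + 203)) ≡ 5 + (9 + (c * 30 + 4 + (x * (n * 24 + 203) + 16))) + (L * 30 + L * (n * 24 + 203)) + 0
      eq = solve-∀

    exec-column : ∀ g → g ≤ 1 → ∀ k p i u v → c ≤ X → ∃₂ λ k′ p′ → ∃₂ λ i′ u′ →
                  Exec S (columnValue g) (environmentAt k p i u v , μ)
                       (environmentAt k′ p′ i′ u′ (at (1 ∸ g) (g ∷ map (clauseValue z₀ z₁) φ) c) , μ) (columnCost n (length (blocks φ)))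
    exec-column g g≤1 k p i u v c≤ = at-column c refl
      where
      L = length (blocks φ)
      bound : ∀ {x} → x ≤ 48 → x ≤ columnCost n L
      bound x≤ = ≤-trans x≤ (m≤n+m 48 (L * (n * 24 + 233)))
      bits-g : bits g ≤ 1
      bits-g = bits-mono g≤1
      bits-1∸g : bits (1 ∸ g) ≤ 1
      bits-1∸g = bits-mono (m∸n≤m 1 g)
      at-column : ∀ c₀ → c₀ ≡ c → ∃₂ λ k′ p′ → ∃₂ λ i′ u′ →
                  Exec S (columnValue g) (environmentAt k p i u v , μ)
                       (environmentAt k′ p′ i′ u′ (at (1 ∸ g) (g ∷ map (clauseValue z₀ z₁) φ) c₀) , μ) (columnCost n L)
      at-column zero refl = k , p , i , u ,
        exec-mono (bound (≤-trans (+-monoʳ-≤ 4 (+-monoˡ-≤ 3 bits-g)) (m≤m+n 8 40)))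
          (exec-branch-z 1 ≤-refl (var column) tt refl
            (exec-assign value (lit g) {environmentAt k p i u v} tt (λ _ → small-1 g≤1)))
      at-column (suc c₁) refl with c₁ <? length φ
      ... | no c₁≮ = k , p , i , u ,
        exec-mono (bound (≤-trans (+-monoʳ-≤ 14 (+-monoˡ-≤ 3 bits-1∸g)) (m≤m+n 18 30)))
          (exec-branch-nz 1 ≤-refl (var column) tt (λ ())
          (exec-branch-nz 1 ≤-refl (var column ⊖ var clauses) (tt , tt) (m>n⇒m∸n≢0 (s≤s (≮⇒≥ c₁≮)))
          (subst (λ z → Exec S (value ≐ lit (1 ∸ g)) (environmentAt k p i u v , μ) (environmentAt k p i u z , μ) (bits (1 ∸ g) + 3))
            (sym (at-beyond c₁ φ (1 ∸ g) (clauseValue z₀ z₁) (≮⇒≥ c₁≮)))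
            (exec-assign value (lit (1 ∸ g)) {environmentAt k p i u v} tt (λ _ → small-1 (m∸n≤m 1 g))))))
      ... | yes c₁< =
        let p′ , i′ , u′ , E = evaluate c₁ k p i u v refl c₁< c≤ (1 ∸ g) in
        0 , p′ , i′ , u′ ,
        exec-mono (≤-reflexive (eq (L * (n * 24 + 233))))
          (exec-branch-nz 1 ≤-refl (var column) tt (λ ())
          (exec-branch-z 1 ≤-refl (var column ⊖ var clauses) (tt , tt) (m≤n⇒m∸n≡0 c₁<) E))
        where
        eq : ∀ x → 4 + (10 + (x + 34)) ≡ x + 48
        eq = solve-∀

module Setup (S X : ℕ) (1≤S : 1 ≤ S) (small : ∀ {x} → x ≤ X → bits x ≤ S) {n : ℕ} (φ : CNF n)
             (2n≤X : 2 * n ≤ X) (L≤X : 2 + length (blocks φ) ≤ X) (D′ : ℕ) where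
  open Rules {21} S 1≤S
  open Reading S X 1≤S small

  exec-power-loop : ∀ {μ ans l b E e N P rl y cl q z₀ z₁ p i v w col} k u → u * 2 ^ k ≤ X →
    Exec S (for count (shifted ≐ var shifted ⊗ lit 2))
         (environment ans n l b E e N P rl y cl col q z₀ z₁ k p i u v w , μ)
         (environment ans n l b E e N P rl y cl col q z₀ z₁ 0 p i (u * 2 ^ k) v w , μ) (k * 24 + 4)
  exec-power-loop {μ} {ans} {l} {b} {E} {e} {N} {P} {rl} {y} {cl} {q} {z₀} {z₁} {p} {i} {v} {w} {col} zero u u≤ =
    subst (λ x → Exec S (for count (shifted ≐ var shifted ⊗ lit 2)) (environment ans n l b E e N P rl y cl col q z₀ z₁ 0 p i u v w , μ)
                   (environment ans n l b E e N P rl y cl col q z₀ z₁ 0 p i x v w , μ) 4)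
      (sym (*-identityʳ u)) (exec-for-zero count refl)
  exec-power-loop {μ} {ans} {l} {b} {E} {e} {N} {P} {rl} {y} {cl} {q} {z₀} {z₁} {p} {i} {v} {w} {col} (suc k) u u≤ =
    subst (λ x → Exec S (for count (shifted ≐ var shifted ⊗ lit 2)) (environment ans n l b E e N P rl y cl col q z₀ z₁ (suc k) p i u v w , μ)
                   (environment ans n l b E e N P rl y cl col q z₀ z₁ 0 p i x v w , μ) (suc k * 24 + 4))
      (*-assoc u 2 (2 ^ k))
      (exec-for-suc count (λ ())
        (exec-assign shifted (var shifted ⊗ lit 2) {environment ans n l b E e N P rl y cl col q z₀ z₁ (suc k) p i u v w} (tt , tt)
          (λ _ → small (≤-trans (m≤m*n (u * 2) (2 ^ k) {{m^n≢0 2 k}}) u*2≤)))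
        (exec-power-loop k (u * 2) u*2≤))
    where
    u*2≤ : u * 2 * 2 ^ k ≤ X
    u*2≤ = ≤-trans (≤-reflexive (*-assoc u 2 (2 ^ k))) u≤

  exec-power : ∀ {μ ans l b E e N P rl y cl col q z₀ z₁ p i u v w} k → 2 ^ k ≤ X →
    Exec S power
         (environment ans n l b E e N P rl y cl col q z₀ z₁ k p i u v w , μ)
         (environment ans n l b E e N P rl y cl col q z₀ z₁ 0 p i (2 ^ k) v w , μ) (4 + (k * 24 + 4))
  exec-power {μ} {ans} {l} {b} {E} {e} {N} {P} {rl} {y} {cl} {col} {q} {z₀} {z₁} {p} {i} {u} {v} {w} k k≤ =
    exec-seq (exec-assign shifted (lit 1) {environment ans n l b E e N P rl y cl col q z₀ z₁ k p i u v w} tt (λ _ → small-1 ≤-refl))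
      (subst (λ x → Exec S (for count (shifted ≐ var shifted ⊗ lit 2)) (environment ans n l b E e N P rl y cl col q z₀ z₁ k p i 1 v w , μ)
                      (environment ans n l b E e N P rl y cl col q z₀ z₁ 0 p i x v w , μ) (k * 24 + 4))
        (*-identityˡ (2 ^ k)) (exec-power-loop k 1 (≤-trans (≤-reflexive (*-identityˡ (2 ^ k))) k≤)))

  a = n / suc D′

  setupCost : ℕ
  setupCost = length φ * 30 + (n * 24 + (bits (suc D′) * 5 + 89))

  exec-setup : 2 ^ a ≤ X → suc (2 ^ (n ∸ a)) ≤ X →
    ∃₂ λ p u → Exec S (setup (suc D′)) (zeros 21 , contents (encodeCNF φ))
      (environment 0 n (length φ) (2 + length (blocks φ)) (suc (2 ^ (n ∸ a))) 0 (2 ^ a) (2 ^ (n ∸ a)) 0 0 0 0 0 0 0 0 p 0 u 0 0 , contents (encodeCNF φ))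
      setupCost
  exec-setup N≤ P< =
    let l = length φ
        μ = contents (encodeCNF φ)
        l≤X = ≤-trans (clauses≤blocks φ) (≤-trans (≤-trans (n≤1+n _) (n≤1+n _)) L≤X)
        n≤X = ≤-trans (m≤m+n n (n + 0)) 2n≤X
        stored = stored-contents 2 (blocks φ) (λ j j< → refl)
        p′ , E , _ , p′≡ = exec-skip-clauses 2n≤X 0 l 0 0 0 0 0 0 0 0 0 0 0 0 0 {μ} l φ 2 0 0 0 stored ≤-refl L≤X
        p≡ = trans (sym (+-identityʳ p′)) (trans (cong (λ ψ → p′ + length (blocks ψ)) (sym (drop-all φ))) p′≡)
        env = λ b N P k p u E → environment 0 n l b E 0 N P 0 0 0 0 0 0 0 k p 0 u 0 0
        b≤X = ≤-trans (≤-reflexive p≡) L≤X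
    in p′ , 2 ^ (n ∸ a) ,
       subst (λ b → Exec S (setup (suc D′)) (zeros 21 , μ) (env b (2 ^ a) (2 ^ (n ∸ a)) 0 p′ (2 ^ (n ∸ a)) (suc (2 ^ (n ∸ a))) , μ) setupCost) p≡
       (exec-mono (≤-reflexive (eq l a (n ∸ a) n (bits (suc D′)) (m+[n∸m]≡n (m/n≤m n (suc D′)))))
       (exec-seq (exec-assign nvars mem[ lit 0 ] {zeros 21} {μ} (tt , small n≤X) (λ _ → small n≤X))
       (exec-seq (exec-assign clauses mem[ lit 1 ] {environment 0 n 0 0 0 0 0 0 0 0 0 0 0 0 0 0 0 0 0 0 0} {μ} (tt , small l≤X) (λ _ → small l≤X))
       (exec-seq (exec-assign pointer (lit 2) {env 0 0 0 0 0 0 0} {μ} tt (λ _ → small (≤-trans (s≤s (s≤s z≤n)) L≤X)))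
       (exec-seq (exec-assign count (var clauses) {env 0 0 0 0 2 0 0} {μ} tt (λ sm → sm clauses))
       (exec-seq E
       (exec-seq (exec-assign base (var pointer) {env 0 0 0 0 p′ 0 0} {μ} tt (λ sm → sm pointer))
       (exec-seq (exec-assign count (var nvars ⊘ lit (suc D′)) {env p′ 0 0 0 p′ 0 0} {μ} (tt , tt) (λ sm → ≤-trans (bits-mono (m/n≤m n (suc D′))) (sm nvars)))
       (exec-seq (exec-power a N≤)
       (exec-seq (exec-assign left (var shifted) {env p′ 0 0 0 p′ (2 ^ a) 0} {μ} tt (λ sm → sm shifted))
       (exec-seq (exec-assign count (var nvars ⊖ var nvars ⊘ lit (suc D′)) {env p′ (2 ^ a) 0 0 p′ (2 ^ a) 0} {μ} (tt , (tt , tt)) (λ sm → ≤-trans (bits-mono (m∸n≤m n a)) (sm nvars)))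
       (exec-seq (exec-power (n ∸ a) (≤-trans (n≤1+n _) P<))
       (exec-seq (exec-assign right (var shifted) {env p′ (2 ^ a) 0 0 p′ (2 ^ (n ∸ a)) 0} {μ} tt (λ sm → sm shifted))
                 (exec-assign span (lit 1 ⊕ var right) {env p′ (2 ^ a) (2 ^ (n ∸ a)) 0 p′ (2 ^ (n ∸ a)) 0} {μ} (tt , tt) (λ _ → small P<)))))))))))))))
    where
    drop-all : ∀ {A : Set} (xs : List A) → drop (length xs) xs ≡ []
    drop-all []       = refl
    drop-all (x ∷ xs) = drop-all xs
    eq : ∀ l a p n d → a + p ≡ n →
         6 + (6 + (5 + (6 + (l * 30 + 4 + (6 + (3 + d + (1 + d) + 3 + (4 + (a * 24 + 4) + (6 + (3 + (3 + d + (1 + d)) + (1 + (1 + d)) + 3 + (4 + (p * 24 + 4) + (6 + 9)))))))))))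
         ≡ l * 30 + (n * 24 + (d * 5 + 89))
    eq l a p _ d refl = identity l a p d
      where
      identity : ∀ l a p d →
        6 + (6 + (5 + (6 + (l * 30 + 4 + (6 + (3 + d + (1 + d) + 3 + (4 + (a * 24 + 4) + (6 + (3 + (3 + d + (1 + d)) + (1 + (1 + d)) + 3 + (4 + (p * 24 + 4) + (6 + 9)))))))))))
        ≡ l * 30 + ((a + p) * 24 + (d * 5 + 89))
      identity = solve-∀

-- Writing the graph into epoch 0

record Emitted (b E : ℕ) (μ₀ μ : Memory) (xs : List ℕ) : Set where
  constructor emitted
  field
    noRegisters : ∀ r → decode b E 0 μ (r * 2) ≡ 0
    listed      : ∀ a → decode b E 0 μ (a * 2 + 1) ≡ contents xs a
    elsewhere   : ∀ x → (∀ i → x ≢ address b E 0 i) → μ x ≡ μ₀ x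

contents-beyond : ∀ xs a → length xs ≤ a → contents xs a ≡ 0
contents-beyond []       a       _        = refl
contents-beyond (x ∷ xs) (suc a) (s≤s le) = contents-beyond xs a le

contents-last : ∀ xs x → contents (xs ++ x ∷ []) (length xs) ≡ x
contents-last []       x = refl
contents-last (y ∷ xs) x = contents-last xs x

contents-other : ∀ xs x a → a ≢ length xs → contents (xs ++ x ∷ []) a ≡ contents xs a
contents-other []       x zero    a≢ = contradiction refl a≢
contents-other []       x (suc a) a≢ = refl
contents-other (y ∷ xs) x zero    a≢ = refl
contents-other (y ∷ xs) x (suc a) a≢ = contents-other xs x a (a≢ ∘ cong suc)

-- The memory behind the input is 0, and an unwritten cell of epoch 0 decodes to 0: the virtual
-- machine is in its initial state without any work.
emitted-[] : ∀ {b E} xs → b ≡ length xs → Emitted b E (contents xs) (contents xs) []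
emitted-[] {b} {E} xs refl = emitted (blank ∘ (_* 2)) (λ a → blank (a * 2 + 1)) (λ x x≢ → refl)
  where
  blank : ∀ i → decode b E 0 (contents xs) i ≡ 0
  blank i = trans (decode-fresh b E 0 (contents xs) i (contents-beyond xs _ (≤-trans (m≤n+m (length xs) (i * E)) (m≤m+n (i * E + length xs) 0))))
                  (cong (_∸ 1) (contents-beyond xs (i * E + length xs) (m≤n+m (length xs) (i * E))))

emitted-∷ʳ : ∀ {b E μ₀ μ xs} x → 0 < E → Emitted b E μ₀ μ xs →
             Emitted b E μ₀ (μ [ address b E 0 (length xs * 2 + 1) ↦ suc x ]) (xs ++ x ∷ [])
emitted-∷ʳ {b} {E} {μ₀} {μ} {xs} x 0<E (emitted none listed elsewhere) = emitted
    (λ r → trans (decode-update-other b E 0 μ x 0<E (*2≢*2+1 r (length xs))) (none r))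
    cells
    (λ y y≢ → trans (update-other μ (suc x) (y≢ (length xs * 2 + 1))) (elsewhere y y≢))
  where
  cells : ∀ a → decode b E 0 (μ [ address b E 0 (length xs * 2 + 1) ↦ suc x ]) (a * 2 + 1) ≡ contents (xs ++ x ∷ []) a
  cells a with a ≟ length xs
  ... | yes refl = trans (decode-update b E 0 μ (a * 2 + 1) x) (sym (contents-last xs x))
  ... | no a≢    = trans (decode-update-other b E 0 μ x 0<E (a≢ ∘ *2-injective ∘ +-cancelʳ-≡ 1 _ _)) (trans (listed a) (sym (contents-other xs x a a≢)))

-- Indexed by the start and the number of remaining rounds, as the counting loops are, so that their
-- invariants follow by associativity of `_++_`.
range : (ℕ → List ℕ) → ℕ → ℕ → List ℕ
range f c zero    = []
range f c (suc j) = f c ++ range f (suc c) j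

emitCost : Exp 21 → ℕ
emitCost e = (effort (cell (address′ (var pen))) + effort (e ⊕ lit 1) + (width (cell (address′ (var pen))) + width (e ⊕ lit 1))) * 1 + 9

module Emission (S X : ℕ) (1≤S : 1 ≤ S) (small : ∀ {x} → x ≤ X → bits x ≤ S) where
  open Rules {21} S 1≤S

  infix 3 _▷_[_]_

  -- A triple of total correctness with cost. The final state is existential, so the contents of
  -- auxiliary variables can be forgotten.
  _▷_[_]_ : Cmd → Conf 21 → ℕ → (Conf 21 → Set) → Set
  c ▷ s [ B ] Q = ∃ λ s′ → Exec S c s s′ B × Q s′

  ▷-mono : ∀ {c s B B′ Q} → B ≤ B′ → c ▷ s [ B ] Q → c ▷ s [ B′ ] Q
  ▷-mono B≤ (s′ , E , q) = s′ , exec-mono B≤ E , q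

  ▷-map : ∀ {c s B Q R} → (∀ {s′} → Q s′ → R s′) → c ▷ s [ B ] Q → c ▷ s [ B ] R
  ▷-map f (s′ , E , q) = s′ , E , f q

  infixr 4 _»_ _»=_

  _»_ : ∀ {c d s s₁ B B′ R} → Exec S c s s₁ B → d ▷ s₁ [ B′ ] R → (c ⨾ d) ▷ s [ B + B′ ] R
  E » (s′ , F , r) = s′ , exec-seq E F , r

  _»=_ : ∀ {c d s B B′ Q R} → c ▷ s [ B ] Q → (∀ s₁ → Q s₁ → d ▷ s₁ [ B′ ] R) → (c ⨾ d) ▷ s [ B + B′ ] R
  (s₁ , E , q) »= f = E » f s₁ q

  done : ∀ {c s s′ B} {Q : Conf 21 → Set} → Exec S c s s′ B → Q s′ → c ▷ s [ B ] Q
  done E q = _ , E , q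

  -- The postcondition of the body is the triple of the remaining loop, because the state after the
  -- body is only known existentially.
  for-suc : ∀ i {c o μ B B′ R} → get i o ≢ 0 → c ▷ (o , μ) [ B ] (λ (o′ , μ′) → for i c ▷ (put i (get i o′ ∸ 1) o′ , μ′) [ B′ ] R) →
            for i c ▷ (o , μ) [ B + 13 + B′ ] R
  for-suc i nz (_ , E , s′ , F , r) = s′ , exec-for-suc i nz E F , r

  Lists : Memory → Env 21 → List ℕ → Conf 21 → Set
  Lists μ₀ o xs (o′ , μ′) = o′ ≡ o × get pen o ≡ length xs × Emitted (get base o) (get span o) μ₀ μ′ xs

  length-∷ʳ : ∀ (xs : List ℕ) z → length (xs ++ z ∷ []) ≡ suc (length xs)
  length-∷ʳ xs z = trans (length-++ xs) (+-comm (length xs) 1)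

  exec-emit : ∀ e {o μ μ₀ xs} → get epoch o ≡ 0 → 0 < get span o → get pen o ≡ length xs → suc (get pen o) ≤ X →
              Loads (1 * S) e o μ → Emitted (get base o) (get span o) μ₀ μ xs →
              emit e ▷ (o , μ) [ emitCost e ] Lists μ₀ (put pen (suc (get pen o)) o) (xs ++ eval e o μ ∷ [])
  exec-emit e {o} {μ} {μ₀} {xs} e≡0 0<E q≡ q< ld em =
    save-correct S 1≤S 1 ≤-refl (address′ (var pen)) e {o} {μ} ((tt , tt) , tt) ld »
    done (exec-assign pen (lit 1 ⊕ var pen) {o} {μ′} (tt , tt) (λ _ → small q<))
      (refl , trans (cong suc q≡) (sym (length-∷ʳ xs (eval e o μ))) ,
       subst₂ (λ z q → Emitted (get base o) (get span o) μ₀ (μ [ address (get base o) (get span o) z (q * 2 + 1) ↦ suc (eval e o μ) ]) (xs ++ eval e o μ ∷ []))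
         (sym e≡0) (sym q≡) (emitted-∷ʳ (eval e o μ) 0<E em))
    where
    μ′ : Memory
    μ′ = μ [ place o (get pen o * 2 + 1) ↦ suc (eval e o μ) ]

verticalEdge : (l N′ x y c : ℕ) → List ℕ
verticalEdge l N′ x y c =
  (2 + l) * y + c ∷ (2 + l) * suc y + c ∷
  (1 ∸ d) * x + (1 ∸ (1 ∸ d)) * (2 * suc l) ∷ []
  where
  d = (y ∸ N′) + (N′ ∸ y)

module EmissionVertical (S X : ℕ) (1≤S : 1 ≤ S) (small : ∀ {x} → x ≤ X → bits x ≤ S) (n l b N′ P x z₀ z₁ k p i u v w : ℕ) (μ₀ : Memory) where
  open Rules {21} S 1≤S
  open Emission S X 1≤S small

  st : (rl y cl c q : ℕ) → Env 21
  st rl y cl c q = environment 0 n l b (suc P) 0 (suc N′) P rl y cl c q z₀ z₁ k p i u v w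

  body rowBody : Cmd
  body = emit vertexHere ⨾ emit vertexBelow ⨾ emit (verticalWeight x) ⨾ column ≐ lit 1 ⊕ var column
  rowBody = column ≐ lit 0 ⨾ columnsLeft ≐ breadth ⨾ for columnsLeft body ⨾ row ≐ lit 1 ⊕ var row

  cost rowCost : ℕ
  cost = emitCost (verticalWeight x) + 213
  rowCost = (2 + l) * cost + 41

  Columns : (rl y q : ℕ) → List ℕ → Conf 21 → Set
  Columns rl y q xs (o′ , μ′) = ∃ λ c → o′ ≡ st rl y 0 c q × q ≡ length xs × Emitted b (suc P) μ₀ μ′ xs

  exec-edge : ∀ j c q rl y μ xs → q ≡ length xs → suc (suc (suc q)) ≤ X → suc c ≤ X → Emitted b (suc P) μ₀ μ xs →
              body ▷ (st rl y (suc j) c q , μ) [ 92 + (99 + (emitCost (verticalWeight x) + 9)) ]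
              Lists μ₀ (st rl y (suc j) (suc c) (suc (suc (suc q)))) (xs ++ verticalEdge l N′ x y c)
  exec-edge j c q rl y μ xs q≡ q< c< em =
    exec-emit vertexHere {st rl y (suc j) c q} {μ} {μ₀} {xs} refl (s≤s z≤n) q≡ (≤-trans (≤-trans (n≤1+n _) (n≤1+n _)) q<) _ em
      »= λ { (_ , μ₁) (refl , q₁≡ , em₁) →
    exec-emit vertexBelow {st rl y (suc j) c (suc q)} {μ₁} {μ₀} {xs ++ s ∷ []} refl (s≤s z≤n) q₁≡ (≤-trans (n≤1+n _) q<) _ em₁
      »= λ { (_ , μ₂) (refl , q₂≡ , em₂) →
    exec-emit (verticalWeight x) {st rl y (suc j) c (suc (suc q))} {μ₂} {μ₀} {(xs ++ s ∷ []) ++ t ∷ []} refl (s≤s z≤n) q₂≡ q< _ em₂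
      »= λ { (_ , μ₃) (refl , q₃≡ , em₃) →
    done (exec-assign column (lit 1 ⊕ var column) {st rl y (suc j) c (suc (suc (suc q)))} {μ₃} (tt , tt) (λ _ → small c<))
      (refl , trans q₃≡ (cong length xs≡) , subst (Emitted b (suc P) μ₀ μ₃) xs≡ em₃) } } }
    where
    s t z : ℕ
    s = (2 + l) * y + c
    t = (2 + l) * suc y + c
    z = eval (verticalWeight x) (st rl y (suc j) c q) μ
    xs≡ : ((xs ++ s ∷ []) ++ t ∷ []) ++ z ∷ [] ≡ xs ++ verticalEdge l N′ x y c
    xs≡ = trans (cong (_++ z ∷ []) (++-assoc xs (s ∷ []) (t ∷ []))) (++-assoc xs (s ∷ t ∷ []) (z ∷ []))

  exec-columns : ∀ j c q rl y μ xs → q ≡ length xs → q + j * 3 ≤ X → c + j ≤ X → Emitted b (suc P) μ₀ μ xs →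
    for columnsLeft body ▷ (st rl y j c q , μ) [ j * cost + 4 ] Columns rl y (q + j * 3) (xs ++ range (verticalEdge l N′ x y) c j)
  exec-columns zero c q rl y μ xs q≡ q≤ c≤ em = done (exec-for-zero columnsLeft refl)
    (c , cong (st rl y 0 c) (sym (+-identityʳ q)) , trans (+-identityʳ q) (trans q≡ (cong length (sym (++-identityʳ xs)))) ,
     subst (Emitted b (suc P) μ₀ μ) (sym (++-identityʳ xs)) em)
  exec-columns (suc j) c q rl y μ xs q≡ q≤ c≤ em = ▷-mono (≤-reflexive (eq (emitCost (verticalWeight x)) j))
    (for-suc columnsLeft (λ ())
      (▷-map next (exec-edge j c q rl y μ xs q≡ (≤-trans (m≤m+n (suc (suc (suc q))) (j * 3)) q+3≤) (≤-trans (s≤s (m≤m+n c j)) c+1≤) em)))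
    where
    eq₃ : ∀ q j → suc (suc (suc q)) + j * 3 ≡ q + suc j * 3
    eq₃ = solve-∀
    q+3≤ : suc (suc (suc q)) + j * 3 ≤ X
    q+3≤ = ≤-trans (≤-reflexive (eq₃ q j)) q≤
    c+1≤ : suc c + j ≤ X
    c+1≤ = ≤-trans (≤-reflexive (sym (+-suc c j))) c≤
    eq : ∀ V j → 92 + (99 + (V + 9)) + 13 + (j * (V + 213) + 4) ≡ suc j * (V + 213) + 4
    eq = solve-∀
    next : ∀ {s′} → Lists μ₀ (st rl y (suc j) (suc c) (suc (suc (suc q)))) (xs ++ verticalEdge l N′ x y c) s′ →
           for columnsLeft body ▷ (put columnsLeft (get columnsLeft (proj₁ s′) ∸ 1) (proj₁ s′) , proj₂ s′) [ j * cost + 4 ]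
           Columns rl y (q + suc j * 3) (xs ++ range (verticalEdge l N′ x y) c (suc j))
    next {_ , μ₁} (refl , q₁≡ , em₁) = subst₂ (λ q′ ys → for columnsLeft body ▷ (st rl y j (suc c) (suc (suc (suc q))) , μ₁) [ j * cost + 4 ] Columns rl y q′ ys)
      (eq₃ q j) (++-assoc xs (verticalEdge l N′ x y c) (range (verticalEdge l N′ x y) (suc c) j))
      (exec-columns j (suc c) (suc (suc (suc q))) rl y μ₁ (xs ++ verticalEdge l N′ x y c) q₁≡ q+3≤ c+1≤ em₁)

  verticalRow : ℕ → List ℕ
  verticalRow y = range (verticalEdge l N′ x y) 0 (2 + l)

  Rows : ℕ → List ℕ → Conf 21 → Set
  Rows q xs (o′ , μ′) = ∃₂ λ y c → ∃ λ cl → o′ ≡ st 0 y cl c q × q ≡ length xs × Emitted b (suc P) μ₀ μ′ xs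

  exec-row : ∀ j cl c q y μ xs → q ≡ length xs → q + (2 + l) * 3 ≤ X → suc y ≤ X → 2 + l ≤ X → Emitted b (suc P) μ₀ μ xs →
    rowBody ▷ (st (suc j) y cl c q , μ) [ 4 + (11 + ((2 + l) * cost + 4 + 9)) ]
    λ (o′ , μ′) → ∃ λ c′ → o′ ≡ st (suc j) (suc y) 0 c′ (q + (2 + l) * 3) × q + (2 + l) * 3 ≡ length (xs ++ verticalRow y) × Emitted b (suc P) μ₀ μ′ (xs ++ verticalRow y)
  exec-row j cl c q y μ xs q≡ q≤ y≤ l≤ em =
    exec-assign column (lit 0) {st (suc j) y cl c q} {μ} tt (λ _ → small z≤n) »
    exec-assign columnsLeft breadth {st (suc j) y cl 0 q} {μ} (tt , tt) (λ _ → small l≤) »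
    exec-columns (2 + l) 0 q (suc j) y μ xs q≡ q≤ l≤ em »= λ { (_ , μ₁) (c₁ , refl , q₁≡ , em₁) →
    done (exec-assign row (lit 1 ⊕ var row) {st (suc j) y 0 c₁ (q + (2 + l) * 3)} {μ₁} (tt , tt) (λ _ → small y≤))
      (c₁ , refl , q₁≡ , em₁) }

  exec-rows : ∀ j cl c q y μ xs → q ≡ length xs → q + j * ((2 + l) * 3) ≤ X → y + j ≤ X → 2 + l ≤ X → Emitted b (suc P) μ₀ μ xs →
    for rowsLeft rowBody ▷ (st j y cl c q , μ) [ j * rowCost + 4 ] Rows (q + j * ((2 + l) * 3)) (xs ++ range verticalRow y j)
  exec-rows zero cl c q y μ xs q≡ q≤ y≤ l≤ em = done (exec-for-zero rowsLeft refl)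
    (y , c , cl , cong (st 0 y cl c) (sym (+-identityʳ q)) , trans (+-identityʳ q) (trans q≡ (cong length (sym (++-identityʳ xs)))) ,
     subst (Emitted b (suc P) μ₀ μ) (sym (++-identityʳ xs)) em)
  exec-rows (suc j) cl c q y μ xs q≡ q≤ y≤ l≤ em = ▷-mono (≤-reflexive (eq ((2 + l) * cost) j))
    (for-suc rowsLeft (λ ())
      (▷-map next (exec-row j cl c q y μ xs q≡ (≤-trans (m≤m+n (q + qs) (j * qs)) q+≤) (≤-trans (s≤s (m≤m+n y j)) y+1≤) l≤ em)))
    where
    qs : ℕ
    qs = (2 + l) * 3
    q+≤ : q + qs + j * qs ≤ X
    q+≤ = ≤-trans (≤-reflexive (+-assoc q qs (j * qs))) q≤
    y+1≤ : suc y + j ≤ X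
    y+1≤ = ≤-trans (≤-reflexive (sym (+-suc y j))) y≤
    eq : ∀ V j → 4 + (11 + (V + 4 + 9)) + 13 + (j * (V + 41) + 4) ≡ suc j * (V + 41) + 4
    eq = solve-∀
    next : ∀ {s′} → (∃ λ c′ → proj₁ s′ ≡ st (suc j) (suc y) 0 c′ (q + qs) × q + qs ≡ length (xs ++ verticalRow y) × Emitted b (suc P) μ₀ (proj₂ s′) (xs ++ verticalRow y)) →
           for rowsLeft rowBody ▷ (put rowsLeft (get rowsLeft (proj₁ s′) ∸ 1) (proj₁ s′) , proj₂ s′) [ j * rowCost + 4 ]
           Rows (q + suc j * qs) (xs ++ range verticalRow y (suc j))
    next {_ , μ₁} (c₁ , refl , q₁≡ , em₁) = subst₂ (λ q′ ys → for rowsLeft rowBody ▷ (st j (suc y) 0 c₁ (q + qs) , μ₁) [ j * rowCost + 4 ] Rows q′ ys)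
      (+-assoc q qs (j * qs)) (++-assoc xs (verticalRow y) (range verticalRow (suc y) j))
      (exec-rows j 0 c₁ (q + qs) (suc y) μ₁ (xs ++ verticalRow y) q₁≡ q+≤ y+1≤ l≤ em₁)

  exec-vertical : ∀ rl y cl c q μ xs → q ≡ length xs → q + (N′ + suc N′) * ((2 + l) * 3) ≤ X → N′ + suc N′ ≤ X → 2 + l ≤ X → Emitted b (suc P) μ₀ μ xs →
    emitVertical x ▷ (st rl y cl c q , μ) [ (N′ + suc N′) * rowCost + 24 ] Rows (q + (N′ + suc N′) * ((2 + l) * 3)) (xs ++ range verticalRow 0 (N′ + suc N′))
  exec-vertical rl y cl c q μ xs q≡ q≤ h≤ l≤ em =
    ▷-mono (≤-reflexive (eq ((N′ + suc N′) * rowCost)))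
      (exec-assign row (lit 0) {st rl y cl c q} {μ} tt (λ _ → small z≤n) »
       subst (λ r → Exec S (rowsLeft ≐ lit 2 ⊗ var left ⊖ lit 1) (st rl 0 cl c q , μ) (st r 0 cl c q , μ) 16) rows≡
         (exec-assign rowsLeft (lit 2 ⊗ var left ⊖ lit 1) {st rl 0 cl c q} {μ} ((tt , tt) , tt) (λ _ → small (≤-trans (≤-reflexive rows≡) h≤))) »
       exec-rows (N′ + suc N′) cl c q 0 μ xs q≡ q≤ h≤ l≤ em)
    where
    rows≡ : 2 * suc N′ ∸ 1 ≡ N′ + suc N′
    rows≡ = cong (λ z → N′ + suc z) (+-identityʳ N′)
    eq : ∀ z → 4 + (16 + (z + 4)) ≡ z + 24
    eq = solve-∀

-- The value 0 in the upper half makes the weight H k there, with the same formula as in the lower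
-- half.
rowValue : ∀ {n} → ℕ → CNF n → ℕ → ℕ → ℕ
rowValue N′ φ y c = if does (y ≤? N′) then at 1 (0 ∷ map (clauseValue (N′ ∸ (N′ ∸ y)) (N′ ∸ y)) φ) c else 0

rowValue-first : ∀ {n} N′ (φ : CNF n) y → rowValue N′ φ y 0 ≡ 0
rowValue-first N′ φ y with does (y ≤? N′)
... | true  = refl
... | false = refl

rowValue-low : ∀ {n} N′ (φ : CNF n) {y} c → y ≤ N′ → rowValue N′ φ y c ≡ at 1 (0 ∷ map (clauseValue (N′ ∸ (N′ ∸ y)) (N′ ∸ y)) φ) c
rowValue-low N′ φ {y} c y≤ = cong (λ b → if b then at 1 (0 ∷ map (clauseValue (N′ ∸ (N′ ∸ y)) (N′ ∸ y)) φ) c else 0) (dec-true (y ≤? N′) y≤)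

rowValue-up : ∀ {n} N′ (φ : CNF n) {y} c → ¬ y ≤ N′ → rowValue N′ φ y c ≡ 0
rowValue-up N′ φ {y} c y≰ = cong (λ b → if b then at 1 (0 ∷ map (clauseValue (N′ ∸ (N′ ∸ y)) (N′ ∸ y)) φ) c else 0) (dec-false (y ≤? N′) y≰)

horizontalEdge : ∀ {n} → ℕ → CNF n → (y c : ℕ) → List ℕ
horizontalEdge N′ φ y c =
  (2 + length φ) * y + c ∷ (2 + length φ) * y + suc c ∷
  4 * (2 + N′ ∸ ((N′ ∸ y) + (y ∸ suc N′))) + rowValue N′ φ y (suc c) ∸ rowValue N′ φ y c ∷ []

stored-cong : ∀ {μ μ₀} p xs → (∀ x → x < p + length xs → μ x ≡ μ₀ x) → Stored μ₀ p xs → Stored μ p xs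
stored-cong p []       h st        = tt
stored-cong p (x ∷ xs) h (eq , st) = trans (h p (m<m+n p (s≤s z≤n))) eq ,
  stored-cong (suc p) xs (λ y y< → h y (≤-trans y< (≤-reflexive (sym (+-suc p (length xs)))))) st

module EmissionHorizontal (S X : ℕ) (1≤S : 1 ≤ S) (small : ∀ {x} → x ≤ X → bits x ≤ S) {n : ℕ} (2n≤X : 2 * n ≤ X) (φ : CNF n)
  (L≤X : 2 + length (blocks φ) ≤ X) (N′ P : ℕ) (N≤X : N′ + suc (suc N′) ≤ X) (μ₀ : Memory) (stored : Stored μ₀ 2 (blocks φ)) where
  open Rules {21} S 1≤S
  open Emission S X 1≤S small

  l b C : ℕ
  l = length φ
  b = 2 + length (blocks φ)
  C = columnCost n (length (blocks φ))

  l+2≤X : 2 + l ≤ X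
  l+2≤X = ≤-trans (+-monoʳ-≤ 2 (clauses≤blocks φ)) L≤X

  st : (rl y cl c q z₀ z₁ k p i u v w : ℕ) → Env 21
  st rl y cl c q z₀ z₁ k p i u v w = environment 0 n l b (suc P) 0 (suc N′) P rl y cl c q z₀ z₁ k p i u v w

  body rowBody : Cmd
  body =
    previous ≐ var value ⨾ emit vertexHere ⨾ column ≐ lit 1 ⊕ var column ⨾
    branch (var left ⊖ var row) (columnValue 0) (value ≐ lit 0) ⨾ emit vertexHere ⨾ emit horizontalWeight
  rowBody =
    positive ≐ var left ⊖ lit 1 ⊖ var row ⨾ negative ≐ var left ⊖ lit 1 ⊖ var positive ⨾ value ≐ lit 0 ⨾
    column ≐ lit 0 ⨾ columnsLeft ≐ lit 1 ⊕ var clauses ⨾ for columnsLeft body ⨾ row ≐ lit 1 ⊕ var row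

  module Row (y : ℕ) where

    z₁ z₀ : ℕ
    z₁ = N′ ∸ y
    z₀ = N′ ∸ z₁

    edge : ℕ → List ℕ
    edge = horizontalEdge N′ φ y

    InRow : (rl cl c q : ℕ) → List ℕ → Conf 21 → Set
    InRow rl cl c q xs (o′ , μ′) = ∃₂ λ k p → ∃₂ λ i u → ∃ λ w →
      o′ ≡ st rl y cl c q z₀ z₁ k p i u (rowValue N′ φ y c) w × q ≡ length xs × Emitted b (suc P) μ₀ μ′ xs

    exec-value : ∀ {rl cl c q k p i u v w μ xs} → c ≤ X → q ≡ length xs → Emitted b (suc P) μ₀ μ xs →
      branch (var left ⊖ var row) (columnValue 0) (value ≐ lit 0) ▷ (st rl y cl c q z₀ z₁ k p i u v w , μ) [ 10 + C ]
      λ (o′ , μ′) → ∃₂ λ k p → ∃₂ λ i u → o′ ≡ st rl y cl c q z₀ z₁ k p i u (rowValue N′ φ y c) w × q ≡ length xs × Emitted b (suc P) μ₀ μ′ xs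
    exec-value {rl} {cl} {c} {q} {k} {p} {i} {u} {v} {w} {μ} {xs} c≤ q≡ em with ≤-<-connex y N′
    ... | inj₁ y≤ =
      -- Emission writes only from address b on, so the formula is still in place.
      let open ReadingColumn S X 1≤S small 2n≤X φ L≤X {μ}
                (stored-cong 2 (blocks φ) (λ x x< → Emitted.elsewhere em x (λ j x≡ → <⇒≱ x< (≤-trans (m≤n+m b (j * suc P)) (≤-trans (m≤m+n (j * suc P + b) 0) (≤-reflexive (sym x≡)))))) stored)
          k′ , p′ , i′ , u′ , E = exec-column 0 b (suc P) 0 (suc N′) P rl y cl c q z₀ z₁ w 0 z≤n k p i u v c≤
      in done
           (exec-branch-nz 1 ≤-refl (var left ⊖ var row) {columnValue 0} {value ≐ lit 0} {st rl y cl c q z₀ z₁ k p i u v w} {μ} (tt , tt) (m>n⇒m∸n≢0 (s≤s y≤))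
             (subst (λ z → Exec S (columnValue 0) (st rl y cl c q z₀ z₁ k p i u v w , μ) (st rl y cl c q z₀ z₁ k′ p′ i′ u′ z w , μ) C)
               (sym (rowValue-low N′ φ c y≤)) E))
           (k′ , p′ , i′ , u′ , refl , q≡ , em)
    ... | inj₂ N′<y = done
      (exec-mono (+-monoʳ-≤ 10 (≤-trans (m≤m+n 4 44) (m≤n+m 48 (length (blocks φ) * (n * 24 + 233)))))
        (exec-branch-z 1 ≤-refl (var left ⊖ var row) {columnValue 0} {value ≐ lit 0} {st rl y cl c q z₀ z₁ k p i u v w} {μ} (tt , tt) (m≤n⇒m∸n≡0 N′<y)
          (subst (λ z → Exec S (value ≐ lit 0) (st rl y cl c q z₀ z₁ k p i u v w , μ) (st rl y cl c q z₀ z₁ k p i u z w , μ) 4)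
            (sym (rowValue-up N′ φ c (<⇒≱ N′<y)))
            (exec-assign value (lit 0) {st rl y cl c q z₀ z₁ k p i u v w} {μ} tt (λ _ → small z≤n)))))
      (k , p , i , u , refl , q≡ , em)

    exec-edge : ∀ {rl cl c q k p i u w μ xs} → q ≡ length xs → suc (suc (suc q)) ≤ X → suc c ≤ X → Emitted b (suc P) μ₀ μ xs →
      body ▷ (st rl y cl c q z₀ z₁ k p i u (rowValue N′ φ y c) w , μ) [ 6 + (92 + (9 + (10 + C + (92 + 163)))) ]
      InRow rl cl (suc c) (suc (suc (suc q))) (xs ++ edge c)
    exec-edge {rl} {cl} {c} {q} {k} {p} {i} {u} {w} {μ} {xs} q≡ q< c< em =
      exec-assign previous (var value) {st rl y cl c q z₀ z₁ k p i u m₀ w} {μ} tt (λ sm → sm value) »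
      exec-emit vertexHere {st rl y cl c q z₀ z₁ k p i u m₀ m₀} {μ} {μ₀} {xs} refl (s≤s z≤n) q≡ (≤-trans (≤-trans (n≤1+n _) (n≤1+n _)) q<) _ em
        »= λ { (_ , μ₁) (refl , q₁≡ , em₁) →
      exec-assign column (lit 1 ⊕ var column) {st rl y cl c (suc q) z₀ z₁ k p i u m₀ m₀} {μ₁} (tt , tt) (λ _ → small c<) »
      exec-value {rl} {cl} {suc c} {suc q} {k} {p} {i} {u} {m₀} {m₀} {μ₁} {xs ++ s ∷ []} c< q₁≡ em₁
        »= λ { (_ , μ₂) (k₂ , p₂ , i₂ , u₂ , refl , q₂≡ , em₂) →
      exec-emit vertexHere {st rl y cl (suc c) (suc q) z₀ z₁ k₂ p₂ i₂ u₂ m₁ m₀} {μ₂} {μ₀} {xs ++ s ∷ []} refl (s≤s z≤n) q₂≡ (≤-trans (n≤1+n _) q<) _ em₂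
        »= λ { (_ , μ₃) (refl , q₃≡ , em₃) →
      ▷-map (λ { {_ , μ₄} (refl , q₄≡ , em₄) → k₂ , p₂ , i₂ , u₂ , m₀ , refl , trans q₄≡ (cong length xs≡) , subst (Emitted b (suc P) μ₀ μ₄) xs≡ em₄ })
        (exec-emit horizontalWeight {st rl y cl (suc c) (suc (suc q)) z₀ z₁ k₂ p₂ i₂ u₂ m₁ m₀} {μ₃} {μ₀} {(xs ++ s ∷ []) ++ t ∷ []} refl (s≤s z≤n) q₃≡ q< _ em₃) } } }
      where
      m₀ m₁ s t z : ℕ
      m₀ = rowValue N′ φ y c
      m₁ = rowValue N′ φ y (suc c)
      s = (2 + l) * y + c
      t = (2 + l) * y + suc c
      z = 4 * (2 + N′ ∸ ((N′ ∸ y) + (y ∸ suc N′))) + m₁ ∸ m₀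
      xs≡ : ((xs ++ s ∷ []) ++ t ∷ []) ++ z ∷ [] ≡ xs ++ edge c
      xs≡ = trans (cong (_++ z ∷ []) (++-assoc xs (s ∷ []) (t ∷ []))) (++-assoc xs (s ∷ t ∷ []) (z ∷ []))

    exec-columns : ∀ j {c q rl k p i u w μ xs} → q ≡ length xs → q + j * 3 ≤ X → c + j ≤ X → Emitted b (suc P) μ₀ μ xs →
      for columnsLeft body ▷ (st rl y j c q z₀ z₁ k p i u (rowValue N′ φ y c) w , μ) [ j * (C + 385) + 4 ] InRow rl 0 (c + j) (q + j * 3) (xs ++ range edge c j)
    exec-columns zero {c} {q} {rl} {k} {p} {i} {u} {w} {μ} {xs} q≡ q≤ c≤ em =
      subst₂ (λ c′ q′ → for columnsLeft body ▷ (st rl y 0 c q z₀ z₁ k p i u (rowValue N′ φ y c) w , μ) [ 4 ] InRow rl 0 c′ q′ (xs ++ []))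
        (sym (+-identityʳ c)) (sym (+-identityʳ q))
        (done (exec-for-zero columnsLeft refl)
          (k , p , i , u , w , refl , trans q≡ (cong length (sym (++-identityʳ xs))) , subst (Emitted b (suc P) μ₀ μ) (sym (++-identityʳ xs)) em))
    exec-columns (suc j) {c} {q} {rl} {k} {p} {i} {u} {w} {μ} {xs} q≡ q≤ c≤ em = ▷-mono (≤-reflexive (eq C j))
      (for-suc columnsLeft (λ ())
        (▷-map next (exec-edge {rl} {suc j} {c} {q} {k} {p} {i} {u} {w} {μ} {xs} q≡ (≤-trans (m≤m+n (suc (suc (suc q))) (j * 3)) q+3≤) (≤-trans (s≤s (m≤m+n c j)) c+1≤) em)))
      where
      eq₃ : ∀ q j → suc (suc (suc q)) + j * 3 ≡ q + suc j * 3
      eq₃ = solve-∀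
      q+3≤ : suc (suc (suc q)) + j * 3 ≤ X
      q+3≤ = ≤-trans (≤-reflexive (eq₃ q j)) q≤
      c+1≤ : suc c + j ≤ X
      c+1≤ = ≤-trans (≤-reflexive (sym (+-suc c j))) c≤
      eq : ∀ C j → 6 + (92 + (9 + (10 + C + (92 + 163)))) + 13 + (j * (C + 385) + 4) ≡ suc j * (C + 385) + 4
      eq = solve-∀
      Next : ℕ → ℕ → List ℕ → Conf 21 → Set
      Next c′ q′ ys (o , μ) = for columnsLeft body ▷ (put columnsLeft (get columnsLeft o ∸ 1) o , μ) [ j * (C + 385) + 4 ] InRow rl 0 c′ q′ ys
      next : ∀ {s′} → InRow rl (suc j) (suc c) (suc (suc (suc q))) (xs ++ edge c) s′ → Next (c + suc j) (q + suc j * 3) (xs ++ range edge c (suc j)) s′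
      next {_ , μ₁} (k₁ , p₁ , i₁ , u₁ , w₁ , refl , q₁≡ , em₁) =
        subst (λ c′ → Next c′ (q + suc j * 3) (xs ++ range edge c (suc j)) (st rl y (suc j) (suc c) (suc (suc (suc q))) z₀ z₁ k₁ p₁ i₁ u₁ (rowValue N′ φ y (suc c)) w₁ , μ₁)) (sym (+-suc c j))
        (subst₂ (λ q′ ys → Next (suc c + j) q′ ys (st rl y (suc j) (suc c) (suc (suc (suc q))) z₀ z₁ k₁ p₁ i₁ u₁ (rowValue N′ φ y (suc c)) w₁ , μ₁))
          (eq₃ q j) (++-assoc xs (edge c) (range edge (suc c) j))
          (exec-columns j {suc c} {suc (suc (suc q))} {rl} {k₁} {p₁} {i₁} {u₁} {w₁} {μ₁} {xs ++ edge c} q₁≡ q+3≤ c+1≤ em₁))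

  horizontalRow : ℕ → List ℕ
  horizontalRow y = range (horizontalEdge N′ φ y) 0 (suc l)

  Rows : (rl y q : ℕ) → List ℕ → Conf 21 → Set
  Rows rl y q xs (o′ , μ′) = ∃₂ λ cl c → ∃₂ λ z₀ z₁ → ∃₂ λ k p → ∃₂ λ i u → ∃₂ λ v w →
    o′ ≡ st rl y cl c q z₀ z₁ k p i u v w × q ≡ length xs × Emitted b (suc P) μ₀ μ′ xs

  exec-row : ∀ {rl y q xs s} → Rows rl y q xs s → q + suc l * 3 ≤ X → suc y ≤ X →
    rowBody ▷ s [ 15 + (15 + (4 + (4 + (9 + (suc l * (C + 385) + 4 + 9))))) ] Rows rl (suc y) (q + suc l * 3) (xs ++ horizontalRow y)
  exec-row {rl} {y} {q} {xs} {_ , μ} (cl , c , a₀ , a₁ , k , p , i , u , v , w , refl , q≡ , em) q≤ y≤ =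
    exec-assign positive (var left ⊖ lit 1 ⊖ var row) {st rl y cl c q a₀ a₁ k p i u v w} {μ} _ (λ sm → ≤-trans (bits-mono (≤-trans (m∸n≤m N′ y) (n≤1+n N′))) (sm left)) »
    exec-assign negative (var left ⊖ lit 1 ⊖ var positive) {st rl y cl c q a₀ z₁ k p i u v w} {μ} _ (λ sm → ≤-trans (bits-mono (≤-trans (m∸n≤m N′ z₁) (n≤1+n N′))) (sm left)) »
    exec-assign value (lit 0) {st rl y cl c q z₀ z₁ k p i u v w} {μ} tt (λ _ → small z≤n) »
    exec-assign column (lit 0) {st rl y cl c q z₀ z₁ k p i u 0 w} {μ} tt (λ _ → small z≤n) »
    exec-assign columnsLeft (lit 1 ⊕ var clauses) {st rl y cl 0 q z₀ z₁ k p i u 0 w} {μ} _ (λ _ → small (≤-trans (n≤1+n _) l+2≤X)) »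
    subst (λ m → for columnsLeft body ▷ (st rl y (suc l) 0 q z₀ z₁ k p i u m w , μ) [ suc l * (C + 385) + 4 ] InRow rl 0 (suc l) (q + suc l * 3) (xs ++ horizontalRow y))
      (rowValue-first N′ φ y)
      (exec-columns (suc l) {0} {q} {rl} {k} {p} {i} {u} {w} {μ} {xs} q≡ q≤ (≤-trans (n≤1+n _) l+2≤X) em)
      »= λ { (_ , μ₁) (k₁ , p₁ , i₁ , u₁ , w₁ , refl , q₁≡ , em₁) →
    done (exec-assign row (lit 1 ⊕ var row) {st rl y 0 (suc l) (q + suc l * 3) z₀ z₁ k₁ p₁ i₁ u₁ (rowValue N′ φ y (suc l)) w₁} {μ₁} _ (λ _ → small y≤))
      (0 , suc l , z₀ , z₁ , k₁ , p₁ , i₁ , u₁ , rowValue N′ φ y (suc l) , w₁ , refl , q₁≡ , em₁) }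
    where open Row y

  rowCost : ℕ
  rowCost = suc l * (C + 385) + 73

  exec-rows : ∀ j {y q xs s} → Rows j y q xs s → q + j * (suc l * 3) ≤ X → y + j ≤ X →
    for rowsLeft rowBody ▷ s [ j * rowCost + 4 ] Rows 0 (y + j) (q + j * (suc l * 3)) (xs ++ range horizontalRow y j)
  exec-rows zero {y} {q} {xs} {_ , μ} (cl , c , a₀ , a₁ , k , p , i , u , v , w , refl , q≡ , em) q≤ y≤ =
    subst₂ (λ y′ q′ → for rowsLeft rowBody ▷ (st 0 y cl c q a₀ a₁ k p i u v w , μ) [ 4 ] Rows 0 y′ q′ (xs ++ []))
      (sym (+-identityʳ y)) (sym (+-identityʳ q))
      (done (exec-for-zero rowsLeft refl)
        (cl , c , a₀ , a₁ , k , p , i , u , v , w , refl , trans q≡ (cong length (sym (++-identityʳ xs))) , subst (Emitted b (suc P) μ₀ μ) (sym (++-identityʳ xs)) em))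
  exec-rows (suc j) {y} {q} {xs} {_ , μ} r@(_ , _ , _ , _ , _ , _ , _ , _ , _ , _ , refl , _) q≤ y≤ = ▷-mono (≤-reflexive (eq (suc l * (C + 385)) j))
    (for-suc rowsLeft (λ ()) (▷-map next (exec-row r (≤-trans (m≤m+n (q + qs) (j * qs)) q+≤) (≤-trans (s≤s (m≤m+n y j)) y+1≤))))
    where
    qs : ℕ
    qs = suc l * 3
    q+≤ : q + qs + j * qs ≤ X
    q+≤ = ≤-trans (≤-reflexive (+-assoc q qs (j * qs))) q≤
    y+1≤ : suc y + j ≤ X
    y+1≤ = ≤-trans (≤-reflexive (sym (+-suc y j))) y≤
    eq : ∀ V j → 15 + (15 + (4 + (4 + (9 + (V + 4 + 9))))) + 13 + (j * (V + 73) + 4) ≡ suc j * (V + 73) + 4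
    eq = solve-∀
    next : ∀ {s′} → Rows (suc j) (suc y) (q + qs) (xs ++ horizontalRow y) s′ →
           for rowsLeft rowBody ▷ (put rowsLeft (get rowsLeft (proj₁ s′) ∸ 1) (proj₁ s′) , proj₂ s′) [ j * rowCost + 4 ]
           Rows 0 (y + suc j) (q + suc j * qs) (xs ++ range horizontalRow y (suc j))
    next {_ , μ₁} (cl , c , a₀ , a₁ , k , p , i , u , v , w , refl , q₁≡ , em₁) =
      subst (λ y′ → for rowsLeft rowBody ▷ (st j (suc y) cl c (q + qs) a₀ a₁ k p i u v w , μ₁) [ j * rowCost + 4 ] Rows 0 y′ (q + suc j * qs) (xs ++ range horizontalRow y (suc j))) (sym (+-suc y j))
      (subst₂ (λ q′ ys → for rowsLeft rowBody ▷ (st j (suc y) cl c (q + qs) a₀ a₁ k p i u v w , μ₁) [ j * rowCost + 4 ] Rows 0 (suc y + j) q′ ys)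
        (+-assoc q qs (j * qs)) (++-assoc xs (horizontalRow y) (range horizontalRow (suc y) j))
        (exec-rows j (cl , c , a₀ , a₁ , k , p , i , u , v , w , refl , q₁≡ , em₁) q+≤ y+1≤))

  exec-horizontal : ∀ {rl y q xs s} → Rows rl y q xs s → q + suc (N′ + suc N′) * (suc l * 3) ≤ X →
    emitHorizontal ▷ s [ suc (N′ + suc N′) * rowCost + 19 ] Rows 0 (suc (N′ + suc N′)) (q + suc (N′ + suc N′) * (suc l * 3)) (xs ++ range horizontalRow 0 (suc (N′ + suc N′)))
  exec-horizontal {rl} {y} {q} {xs} {_ , μ} (cl , c , a₀ , a₁ , k , p , i , u , v , w , refl , q≡ , em) q≤ =
    ▷-mono (≤-reflexive (eq (suc (N′ + suc N′) * rowCost)))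
      (exec-assign row (lit 0) {st rl y cl c q a₀ a₁ k p i u v w} {μ} tt (λ _ → small z≤n) »
       subst (λ r → Exec S (rowsLeft ≐ lit 2 ⊗ var left) (st rl 0 cl c q a₀ a₁ k p i u v w , μ) (st r 0 cl c q a₀ a₁ k p i u v w , μ) 11) rows≡
         (exec-assign rowsLeft (lit 2 ⊗ var left) {st rl 0 cl c q a₀ a₁ k p i u v w} {μ} _ (λ _ → small (≤-trans (≤-reflexive rows≡) rows≤))) »
       exec-rows (suc (N′ + suc N′)) (cl , c , a₀ , a₁ , k , p , i , u , v , w , refl , q≡ , em) q≤ rows≤)
    where
    rows≡ : 2 * suc N′ ≡ suc (N′ + suc N′)
    rows≡ = cong (λ z → suc (N′ + suc z)) (+-identityʳ N′)
    rows≤ : suc (N′ + suc N′) ≤ X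
    rows≤ = ≤-trans (≤-reflexive (sym (+-suc N′ (suc N′)))) N≤X
    eq : ∀ z → 4 + (11 + (z + 4)) ≡ z + 19
    eq = solve-∀

-- The edge list of the grid as nested ranges

collect : ∀ {A : Set} n → (Fin n → List A) → List A
collect n f = concatMap f (allFin n)

concatMap-tabulate : ∀ {A B : Set} n (g : Fin n → B) (f : B → List A) → concatMap f (List.tabulate g) ≡ collect n (f ∘ g)
concatMap-tabulate n g f = cong List.concat (trans (map-tabulate g f) (sym (map-tabulate (λ i → i) (f ∘ g))))

collect-suc : ∀ {A : Set} n (f : Fin (suc n) → List A) → collect (suc n) f ≡ f Fin.zero ++ collect n (f ∘ Fin.suc)
collect-suc n f = cong (f Fin.zero ++_) (concatMap-tabulate n Fin.suc f)

collect-cong : ∀ {A : Set} n {f g : Fin n → List A} → (∀ i → f i ≡ g i) → collect n f ≡ collect n g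
collect-cong n h = cong List.concat (map-cong h (allFin n))

collect-+ : ∀ {A : Set} a b (f : Fin (a + b) → List A) → collect (a + b) f ≡ collect a (f ∘ (_↑ˡ b)) ++ collect b (f ∘ (a ↑ʳ_))
collect-+ zero    b f = refl
collect-+ (suc a) b f = begin
  collect (suc (a + b)) f                                                              ≡⟨ collect-suc (a + b) f ⟩
  f Fin.zero ++ collect (a + b) (f ∘ Fin.suc)                                          ≡⟨ cong (f Fin.zero ++_) (collect-+ a b (f ∘ Fin.suc)) ⟩
  f Fin.zero ++ collect a (f ∘ Fin.suc ∘ (_↑ˡ b)) ++ collect b (f ∘ (suc a ↑ʳ_))       ≡⟨ ++-assoc (f Fin.zero) _ _ ⟨
  (f Fin.zero ++ collect a (f ∘ Fin.suc ∘ (_↑ˡ b))) ++ collect b (f ∘ (suc a ↑ʳ_))     ≡⟨ cong (_++ collect b (f ∘ (suc a ↑ʳ_))) (collect-suc a (f ∘ (_↑ˡ b))) ⟨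
  collect (suc a) (f ∘ (_↑ˡ b)) ++ collect b (f ∘ (suc a ↑ʳ_))                         ∎
  where open ≡-Reasoning

collect-* : ∀ {A : Set} a b (f : Fin (a * b) → List A) → collect (a * b) f ≡ collect a (λ i → collect b (λ j → f (combine i j)))
collect-* zero    b f = refl
collect-* (suc a) b f = begin
  collect (b + a * b) f                                                     ≡⟨ collect-+ b (a * b) f ⟩
  collect b (f ∘ (_↑ˡ (a * b))) ++ collect (a * b) (f ∘ (b ↑ʳ_))            ≡⟨ cong (collect b (f ∘ (_↑ˡ (a * b))) ++_) (collect-* a b (f ∘ (b ↑ʳ_))) ⟩
  collect b (f ∘ (_↑ˡ (a * b))) ++ collect a (λ i → collect b (λ j → f (b ↑ʳ combine i j)))
                                                                            ≡⟨ collect-suc a (λ i → collect b (λ j → f (combine i j))) ⟨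
  collect (suc a) (λ i → collect b (λ j → f (combine i j)))                 ∎
  where open ≡-Reasoning

range-shift : ∀ f c j → range (f ∘ suc) c j ≡ range f (suc c) j
range-shift f c zero    = refl
range-shift f c (suc j) = cong (f (suc c) ++_) (range-shift f (suc c) j)

collect-range : ∀ n f → collect n (f ∘ toℕ) ≡ range f 0 n
collect-range zero    f = refl
collect-range (suc n) f = trans (collect-suc n (f ∘ toℕ)) (cong (f 0 ++_) (trans (collect-range n (f ∘ suc)) (range-shift f 0 n)))

module Listing (h m : ℕ) where
  open Grid h m

  weigh : (vw hw : ℕ → ℕ → ℕ) → Graph.Weighting grid
  weigh vw hw e = [ (λ (y , c) → vw (toℕ y) (toℕ c)) ∘ remQuot {h} columns , (λ (y , c) → hw (toℕ y) (toℕ c)) ∘ remQuot {rows} m ] (splitAt (h * columns) e)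

  module _ (vw hw : ℕ → ℕ → ℕ) where

    weigh-vertical : ∀ y c → weigh vw hw (vertical y c) ≡ vw (toℕ y) (toℕ c)
    weigh-vertical y c rewrite Fin.splitAt-↑ˡ (h * columns) (combine y c) (rows * m) =
      cong (λ ((y , c) : Fin h × Fin columns) → vw (toℕ y) (toℕ c)) (Fin.remQuot-combine y c)

    weigh-horizontal : ∀ y c → weigh vw hw (horizontal y c) ≡ hw (toℕ y) (toℕ c)
    weigh-horizontal y c rewrite Fin.splitAt-↑ʳ (h * columns) (rows * m) (combine y c) =
      cong (λ ((y , c) : Fin rows × Fin m) → hw (toℕ y) (toℕ c)) (Fin.remQuot-combine y c)

    weigh-≤ : ∀ {b} → (∀ y c → vw y c ≤ b) → (∀ y c → hw y c ≤ b) → ∀ e → weigh vw hw e ≤ b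
    weigh-≤ {b} v≤ h≤ e with view e
    ... | isVertical y c   = subst (_≤ b) (sym (weigh-vertical y c)) (v≤ (toℕ y) (toℕ c))
    ... | isHorizontal y c = subst (_≤ b) (sym (weigh-horizontal y c)) (h≤ (toℕ y) (toℕ c))

    verticalTriple horizontalTriple : ℕ → ℕ → List ℕ
    verticalTriple   y c = columns * y + c ∷ columns * suc y + c ∷ vw y c ∷ []
    horizontalTriple y c = columns * y + c ∷ columns * y + suc c ∷ hw y c ∷ []

    encodeGrid : encodeGraph grid (weigh vw hw) ≡
                 vertices ∷ size ∷ range (λ y → range (verticalTriple y) 0 columns) 0 h ++ range (λ y → range (horizontalTriple y) 0 m) 0 rows
    encodeGrid = cong (λ xs → vertices ∷ size ∷ xs) (trans (collect-+ (h * columns) (rows * m) triple) (cong₂ _++_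
        (trans (collect-* h columns _) (trans (collect-cong h λ y → trans (collect-cong columns (λ c → triple-vertical y c)) (collect-range columns (verticalTriple (toℕ y))))
          (collect-range h (λ y → range (verticalTriple y) 0 columns))))
        (trans (collect-* rows m _) (trans (collect-cong rows λ y → trans (collect-cong m (λ c → triple-horizontal y c)) (collect-range m (horizontalTriple (toℕ y))))
          (collect-range rows (λ y → range (horizontalTriple y) 0 m))))))
      where
      triple : Fin size → List ℕ
      triple e = toℕ (proj₁ (ends e)) ∷ toℕ (proj₂ (ends e)) ∷ weigh vw hw e ∷ []
      toℕ-vertex : ∀ (y : Fin rows) (c : Fin columns) {y′ c′} → toℕ y ≡ y′ → toℕ c ≡ c′ → toℕ (combine y c) ≡ columns * y′ + c′
      toℕ-vertex y c refl refl = Fin.toℕ-combine y c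
      triple-vertical : ∀ y c → triple (vertical y c) ≡ verticalTriple (toℕ y) (toℕ c)
      triple-vertical y c = cong₂ _∷_ (trans (cong (toℕ ∘ proj₁) (ends-vertical y c)) (toℕ-vertex (inject₁ y) c (Fin.toℕ-inject₁ y) refl))
        (cong₂ _∷_ (trans (cong (toℕ ∘ proj₂) (ends-vertical y c)) (toℕ-vertex (Fin.suc y) c refl refl)) (cong (_∷ []) (weigh-vertical y c)))
      triple-horizontal : ∀ y c → triple (horizontal y c) ≡ horizontalTriple (toℕ y) (toℕ c)
      triple-horizontal y c = cong₂ _∷_ (trans (cong (toℕ ∘ proj₁) (ends-horizontal y c)) (toℕ-vertex y (inject₁ c) refl (Fin.toℕ-inject₁ c)))
        (cong₂ _∷_ (trans (cong (toℕ ∘ proj₂) (ends-horizontal y c)) (toℕ-vertex y (Fin.suc c) refl refl)) (cong (_∷ []) (weigh-horizontal y c)))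

-- The changes of one query

applyAll : ∀ {n} (G : Graph n) → Graph.Weighting G → List (Change G) → Graph.Weighting G
applyAll G ω []       = ω
applyAll G ω (c ∷ cs) = applyAll G (apply G ω c) cs

module Changes (N′ m : ℕ) (w : ℕ → ℕ) where
  open Grid (N′ + suc N′) m

  N′<h : N′ < N′ + suc N′
  N′<h = m<m+n N′ (s≤s z≤n)

  middleEdge : ∀ c → .(c < columns) → Fin size
  middleEdge c c< = vertical (fromℕ< N′<h) (fromℕ< c<)

  toℕ-middleEdge : ∀ c .(c< : c < columns) → toℕ (middleEdge c c<) ≡ columns * N′ + c
  toℕ-middleEdge c c< = trans (Fin.toℕ-↑ˡ (combine (fromℕ< N′<h) (fromℕ< c<)) (rows * m))
    (trans (Fin.toℕ-combine (fromℕ< N′<h) (fromℕ< c<)) (cong₂ (λ y c → columns * y + c) (Fin.toℕ-fromℕ< N′<h) (Fin.toℕ-fromℕ< c<)))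

  -- The recursion counts down like `for columnsLeft`, so that executing the loop and serving the
  -- list proceed in step.
  changesFrom : ∀ j c → c + j ≡ columns → List (Change grid)
  changesFrom zero    c _  = []
  changesFrom (suc j) c eq = (middleEdge c (subst (suc c ≤_) (trans (sym (+-suc c j)) eq) (s≤s (m≤m+n c j))) , 1 + w c) ∷
                             changesFrom j (suc c) (trans (sym (+-suc c j)) eq)

  changes : List (Change grid)
  changes = changesFrom columns 0 refl

  length-changesFrom : ∀ j c eq → length (changesFrom j c eq) ≡ j
  length-changesFrom zero    c eq = refl
  length-changesFrom (suc j) c eq = cong suc (length-changesFrom j (suc c) (trans (sym (+-suc c j)) eq))

-- The loop over the right assignments

module Queries (S X : ℕ) (1≤S : 1 ≤ S) (small : ∀ {x} → x ≤ X → bits x ≤ S) {n : ℕ} (2n≤X : 2 * n ≤ X) (φ : CNF n)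
  (L≤X : 2 + length (blocks φ) ≤ X) (N′ P : ℕ) (NP≤X : P * suc N′ ≤ X) (P≤X : suc P ≤ X)
  (spare : bits (suc (length φ) * (4 * (2 + N′)) + 2) + 1 ≤ S) (A : DynamicAlgorithm) where
  open Rules {21} S 1≤S
  open Emission S X 1≤S small
  open DynamicAlgorithm A

  l b C top : ℕ
  l = length φ
  b = 2 + length (blocks φ)
  C = columnCost n (length (blocks φ))
  top = suc l * (4 * (2 + N′)) + 2

  l+2≤X : 2 + l ≤ X
  l+2≤X = ≤-trans (+-monoʳ-≤ 2 (clauses≤blocks φ)) L≤X

  columnWeight : ℕ → ℕ → ℕ
  columnWeight y = at 0 (1 ∷ map (clauseValue ((P ∸ 1 ∸ y) * suc N′) (y * suc N′)) φ)

  st : (ans e rl y cl c q z₀ z₁ k p i u v w : ℕ) → Env 21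
  st ans e rl y cl c q z₀ z₁ k p i u v w = environment ans n l b (suc P) e (suc N′) P rl y cl c q z₀ z₁ k p i u v w

  open Grid (N′ + suc N′) (suc l) using (grid; vertices; size)

  Input : Memory → Set
  Input μ = ∀ x → x < b → μ x ≡ contents (encodeCNF φ) x

  input-stored : ∀ {μ} → Input μ → Stored μ 2 (blocks φ)
  input-stored input = stored-cong 2 (blocks φ) input (stored-contents 2 (blocks φ) (λ j j< → refl))

  below-base : ∀ {x} e i → x < b → x ≢ address b (suc P) e i
  below-base e i x<b refl = <⇒≱ x<b (≤-trans (m≤n+m b (i * suc P)) (m≤m+n (i * suc P + b) e))

  module Query (y : ℕ) (y<P : y < P) where
    open Changes N′ (suc l) (columnWeight y)

    z₀ z₁ : ℕ
    z₀ = (P ∸ 1 ∸ y) * suc N′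
    z₁ = y * suc N′

    e<E : suc y < suc P
    e<E = s≤s y<P

    Serving : (ans rl q w : ℕ) → Memory → Graph.Weighting grid → Conf 21 → Set
    Serving ans rl q w μ ω (o′ , μ′) = ∃₂ λ c k → ∃₂ λ p i → ∃₂ λ u v → ∃ λ τ →
      o′ ≡ st ans (suc y) rl y 0 c q z₀ z₁ k p i u v w × Simulates o′ μ′ τ × Untouched o′ μ μ′ × Graph.IsDiameter grid ω (reg τ 0)

    exec-change : ∀ {ans rl cl c q k p i u v w μ τ t τ′} (c< : c < suc (suc l)) → Input μ →
      Simulates (st ans (suc y) rl y cl c q z₀ z₁ k p i u v w) μ τ →
      Run update (announce grid (middleEdge c c< , 1 + columnWeight y c) τ) τ′ t →
      change update ▷ (st ans (suc y) rl y cl c q z₀ z₁ k p i u v w , μ) [ C + (79 + (55 + (overhead update * t + 9))) ]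
      λ (o′ , μ′) → ∃₂ λ k p → ∃₂ λ i u → ∃ λ v → o′ ≡ st ans (suc y) rl y cl (suc c) q z₀ z₁ k p i u v w × Simulates o′ μ′ τ′ × Untouched o′ μ μ′
    exec-change {ans} {rl} {cl} {c} {q} {k} {p} {i} {u} {v} {w} {μ} {⟪ ρ , ν ⟫} {t} {τ′} c< input sim run =
      (let open ReadingColumn S X 1≤S small 2n≤X φ L≤X {μ} (input-stored input)
           k′ , p′ , i′ , u′ , E = exec-column ans b (suc P) (suc y) (suc N′) P rl y cl c q z₀ z₁ w 1 ≤-refl k p i u v (≤-trans (<⇒≤ c<) l+2≤X)
       in column-value k′ p′ i′ u′ E) »= λ { (_ , _) (k′ , p′ , i′ , u′ , refl , refl) → rest k′ p′ i′ u′ }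
      where
      column-value : ∀ k′ p′ i′ u′ →
        Exec S (columnValue 1) (st ans (suc y) rl y cl c q z₀ z₁ k p i u v w , μ) (st ans (suc y) rl y cl c q z₀ z₁ k′ p′ i′ u′ (columnWeight y c) w , μ) C →
        columnValue 1 ▷ (st ans (suc y) rl y cl c q z₀ z₁ k p i u v w , μ) [ C ]
        λ (o′ , μ′) → ∃₂ λ k p → ∃₂ λ i u → o′ ≡ st ans (suc y) rl y cl c q z₀ z₁ k p i u (columnWeight y c) w × μ′ ≡ μ
      column-value k′ p′ i′ u′ E = done E (k′ , p′ , i′ , u′ , refl , refl)
      id : ℕ
      id = (2 + l) * N′ + c
      x : ℕ
      x = 1 + columnWeight y c
      rest : ∀ k p i u →
        (save (register (lit 1)) (breadth ⊗ (var left ⊖ lit 1) ⊕ var column) ⨾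
         save (register (lit 2)) (lit 1 ⊕ var value) ⨾ virtual update ⨾ column ≐ lit 1 ⊕ var column)
        ▷ (st ans (suc y) rl y cl c q z₀ z₁ k p i u (columnWeight y c) w , μ) [ 79 + (55 + (overhead update * t + 9)) ]
        λ (o′ , μ′) → ∃₂ λ k p → ∃₂ λ i u → ∃ λ v → o′ ≡ st ans (suc y) rl y cl (suc c) q z₀ z₁ k p i u v w × Simulates o′ μ′ τ′ × Untouched o′ μ μ′
      rest k p i u =
        save-correct S 1≤S 1 ≤-refl (register (lit 1)) (breadth ⊗ (var left ⊖ lit 1) ⊕ var column) {o} {μ} _ _ »
        save-correct S 1≤S 1 ≤-refl (register (lit 2)) (lit 1 ⊕ var value) {o} {μ₁} _ _ »
        run-update (simulate S 1≤S {o} e<E run′ {μ₂} sim₂)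
        where
        o : Env 21
        o = st ans (suc y) rl y cl c q z₀ z₁ k p i u (columnWeight y c) w
        μ₁ μ₂ : Memory
        μ₁ = μ [ place o 2 ↦ suc id ]
        μ₂ = μ₁ [ place o 4 ↦ suc x ]
        sim₂ : Simulates o μ₂ ⟪ (ρ [ 1 ↦ id ]) [ 2 ↦ x ] , ν ⟫
        sim₂ = simulates-register S 1≤S {o} e<E 2 x (simulates-register S 1≤S {o} e<E 1 id (simulates (Simulates.registers sim) (Simulates.cells sim)))
        run′ : Run update ⟪ (ρ [ 1 ↦ id ]) [ 2 ↦ x ] , ν ⟫ τ′ t
        run′ = subst (λ z → Run update ⟪ (ρ [ 1 ↦ z ]) [ 2 ↦ x ] , ν ⟫ τ′ t) (toℕ-middleEdge c c<) run
        run-update : Simulation S 1≤S {o} e<E (virtual update) μ₂ τ′ (overhead update * t) →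
          (virtual update ⨾ column ≐ lit 1 ⊕ var column) ▷ (o , μ₂) [ overhead update * t + 9 ]
          λ (o′ , μ′) → ∃₂ λ k p → ∃₂ λ i u → ∃ λ v → o′ ≡ st ans (suc y) rl y cl (suc c) q z₀ z₁ k p i u v w × Simulates o′ μ′ τ′ × Untouched o′ μ μ′
        run-update (μ₃ , E , sim₃ , un₃) =
          E » done (exec-assign column (lit 1 ⊕ var column) {o} {μ₃} (tt , tt) (λ _ → small (≤-trans c< l+2≤X)))
            (k , p , i , u , columnWeight y c , refl , simulates (Simulates.registers sim₃) (Simulates.cells sim₃) ,
             λ z z≢ → trans (un₃ z z≢) (trans (update-other μ₁ (suc x) (z≢ 4)) (update-other μ (suc id) (z≢ 2))))

    exec-changes : ∀ j c (eq : c + j ≡ suc (suc l)) {ans rl q k p i u v w μ τ ω T} → Input μ →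
      Simulates (st ans (suc y) rl y j c q z₀ z₁ k p i u v w) μ τ → Graph.IsDiameter grid ω (reg τ 0) →
      Serves grid A τ ω (changesFrom j c eq) T →
      for columnsLeft (change update) ▷ (st ans (suc y) rl y j c q z₀ z₁ k p i u v w , μ) [ j * (C + 156) + overhead update * T + 4 ]
      Serving ans rl q w μ (applyAll grid ω (changesFrom j c eq))
    exec-changes zero c eq {k = k} {p} {i} {u} {v} {τ = τ} input sim dia [] =
      ▷-mono (≤-reflexive (cong (_+ 4) (sym (*-zeroʳ (overhead update)))))
        (done (exec-for-zero columnsLeft refl) (c , k , p , i , u , v , τ , refl , sim , (λ x x≢ → refl) , dia))
    exec-changes (suc j) c eq {ans} {rl} {q} {k} {p} {i} {u} {v} {w} {μ} {τ} {ω} input sim dia (_∷_ {σ′ = τ₁} {t = t} {T} (run , dia₁) serves) =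
      ▷-mono (≤-reflexive (total C j (overhead update) t T))
        (for-suc columnsLeft (λ ()) (▷-map next (exec-change c< input sim run)))
      where
      c< : c < suc (suc l)
      c< = subst (suc c ≤_) (trans (sym (+-suc c j)) eq) (s≤s (m≤m+n c j))
      total : ∀ C j K t T → C + (79 + (55 + (K * t + 9))) + 13 + (j * (C + 156) + K * T + 4) ≡ suc j * (C + 156) + K * (t + T) + 4
      total = solve-∀
      ω′ : Graph.Weighting grid
      ω′ = applyAll grid ω (changesFrom (suc j) c eq)
      next : ∀ {s′} → (∃₂ λ k p → ∃₂ λ i u → ∃ λ v → proj₁ s′ ≡ st ans (suc y) rl y (suc j) (suc c) q z₀ z₁ k p i u v w × Simulates (proj₁ s′) (proj₂ s′) τ₁ × Untouched (proj₁ s′) μ (proj₂ s′)) →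
             for columnsLeft (change update) ▷ (put columnsLeft (get columnsLeft (proj₁ s′) ∸ 1) (proj₁ s′) , proj₂ s′) [ j * (C + 156) + overhead update * T + 4 ] Serving ans rl q w μ ω′
      next {_ , μ₁} (k₁ , p₁ , i₁ , u₁ , v₁ , refl , sim₁ , un₁) =
        ▷-map later (exec-changes j (suc c) (trans (sym (+-suc c j)) eq) {ans} {rl} {q} {k₁} {p₁} {i₁} {u₁} {v₁} {w} {μ₁}
          (λ x x<b → trans (un₁ x (λ i → below-base (suc y) i x<b)) (input x x<b))
          (simulates (Simulates.registers sim₁) (Simulates.cells sim₁)) dia₁ serves)
        where
        later : ∀ {s″} → Serving ans rl q w μ₁ ω′ s″ → Serving ans rl q w μ ω′ s″
        later (c₂ , k₂ , p₂ , i₂ , u₂ , v₂ , τ₂ , refl , sim₂ , un₂ , dia₂) =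
          c₂ , k₂ , p₂ , i₂ , u₂ , v₂ , τ₂ , refl , sim₂ , (λ x x≢ → trans (un₂ x x≢) (un₁ x x≢)) , dia₂

  module Decision (σ : State) (ω : Graph.Weighting grid) (start-diameter : Graph.IsDiameter grid ω (reg σ 0)) (Good : ℕ → Set) (T : ℕ)
    (serves : ∀ y → y < P → ∃ λ t → Serves grid A σ ω (Changes.changes N′ (suc l) (columnWeight y)) t × t ≤ T)
    (decided : ∀ y → y < P → ∀ D → Graph.IsDiameter grid (applyAll grid ω (Changes.changes N′ (suc l) (columnWeight y))) D → D ≤ top × (top ≤ D ⇔ Good y))
    (μ₁ : Memory) (after-preprocessing : ∀ x → (∀ i → x ≢ address b (suc P) 0 i) → μ₁ x ≡ contents (encodeCNF φ) x)
    (registers₁ : ∀ r → decode b (suc P) 0 μ₁ (r * 2) ≡ reg σ r) (cells₁ : ∀ a → decode b (suc P) 0 μ₁ (a * 2 + 1) ≡ mem σ a) where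

    Clean : ℕ → Memory → Set
    Clean y μ = ∀ x → (∀ e i → 0 < e → e ≤ y → x ≢ address b (suc P) e i) → μ x ≡ μ₁ x

    clean-input : ∀ {y μ} → Clean y μ → Input μ
    clean-input clean x x<b = trans (clean x λ e i _ _ → below-base e i x<b) (after-preprocessing x λ i → below-base 0 i x<b)

    -- A cell of epoch y + 1 lies behind the input and belongs to no epoch used so far; it is still
    -- 0, and decoding falls back on epoch 0, which the earlier queries have left alone.
    clean-decode : ∀ {y μ} → y < P → Clean y μ → ∀ i → decode b (suc P) (suc y) μ i ≡ decode b (suc P) 0 μ₁ i
    clean-decode {y} {μ} y<P clean i = begin
      decode b (suc P) (suc y) μ i   ≡⟨ decode-fresh b (suc P) (suc y) μ i fresh ⟩
      μ (i * suc P + b) ∸ 1          ≡⟨ cong (_∸ 1) (clean (i * suc P + b) old) ⟩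
      μ₁ (i * suc P + b) ∸ 1         ≡⟨ cong (λ x → μ₁ x ∸ 1) (sym (+-identityʳ (i * suc P + b))) ⟩
      decode b (suc P) 0 μ₁ i        ∎
      where
      open ≡-Reasoning
      old : ∀ e j → 0 < e → e ≤ y → i * suc P + b ≢ address b (suc P) e j
      old e j 0<e e≤y p with _ , refl ← address-injective b {suc P} {0} {e} i j (s≤s z≤n) (s≤s (≤-trans e≤y (<⇒≤ y<P))) (trans (+-identityʳ _) p) with () ← 0<e
      new : ∀ e j → 0 < e → e ≤ y → address b (suc P) (suc y) i ≢ address b (suc P) e j
      new e j _ e≤y p with _ , refl ← address-injective b i j (s≤s y<P) (s≤s (≤-trans e≤y (<⇒≤ y<P))) p = 1+n≰n e≤y
      zeroth : ∀ j → address b (suc P) (suc y) i ≢ address b (suc P) 0 j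
      zeroth j p with () ← proj₂ (address-injective b {suc P} {suc y} {0} i j (s≤s y<P) (s≤s z≤n) p)
      fresh : μ (address b (suc P) (suc y) i) ≡ 0
      fresh = trans (clean _ new) (trans (after-preprocessing _ zeroth)
        (contents-beyond (encodeCNF φ) _ (≤-trans (m≤n+m b (i * suc P)) (m≤m+n (i * suc P + b) (suc y)))))

    Answers : ℕ → ℕ → Set
    Answers y ans = ans ≤ 1 × (ans ≡ 1 ⇔ (∃ λ x → x < y × Good x))

    State′ : (rl y : ℕ) → Conf 21 → Set
    State′ rl y (o , μ) = ∃₂ λ ans e → ∃₂ λ cl c → ∃₂ λ q z₀ → ∃₂ λ z₁ k → ∃₂ λ p i → ∃₂ λ u v → ∃ λ w →
      o ≡ st ans e rl y cl c q z₀ z₁ k p i u v w × Answers y ans × Clean y μ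

    answers-zero : Answers 0 0
    answers-zero = z≤n , mk⇔ (λ ()) λ { (_ , () , _) }

    -- `top ∸ D` is 0 exactly if the diameter reaches `top`. Once the answer is 1, the factor 1 ∸
    -- `ans` keeps it so.
    answers-suc : ∀ {y ans} D → Answers y ans → top ≤ D ⇔ Good y → Answers (suc y) (1 ∸ (1 ∸ ans) * (top ∸ D))
    answers-suc {y} {ans} D (ans≤1 , iff) good = m∸n≤m 1 ((1 ∸ ans) * (top ∸ D)) , mk⇔ (forth ans ans≤1 iff) (back ans ans≤1 iff)
      where
      forth : ∀ ans → ans ≤ 1 → ans ≡ 1 ⇔ (∃ λ x → x < y × Good x) → 1 ∸ (1 ∸ ans) * (top ∸ D) ≡ 1 → ∃ λ x → x < suc y × Good x
      forth zero       _ _   p = y , ≤-refl , Equivalence.to good (m∸n≡0⇒m≤n (1∸-true refl (trans (cong (1 ∸_) (sym (+-identityʳ (top ∸ D)))) p)))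
      forth (suc zero) _ iff _ = let x , x<y , g = Equivalence.to iff refl in x , m<n⇒m<1+n x<y , g
      forth (suc (suc _)) (s≤s ()) _ _
      back : ∀ ans → ans ≤ 1 → ans ≡ 1 ⇔ (∃ λ x → x < y × Good x) → (∃ λ x → x < suc y × Good x) → 1 ∸ (1 ∸ ans) * (top ∸ D) ≡ 1
      back (suc zero) _ _ _ = refl
      back (suc (suc _)) (s≤s ()) _ _
      back zero _ iff (x , s≤s x≤y , g) with m≤n⇒m<n∨m≡n x≤y
      ... | inj₁ x<y  with () ← Equivalence.from iff (x , x<y , g)
      ... | inj₂ refl = cong (1 ∸_) (trans (+-identityʳ (top ∸ D)) (m≤n⇒m∸n≡0 (Equivalence.from good g)))

    queryCost : ℕ
    queryCost = suc (suc l) * (C + 156) + overhead update * T + 250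

    exec-query : ∀ {rl y s} → y < P → State′ rl y s → query update ▷ s [ queryCost ] State′ rl (suc y)
    exec-query {rl} {y} {_ , μ} y<P (ans , e , cl , c , q , a₀ , a₁ , k , p , i , u , v , w , refl , answers , clean) =
      ▷-mono (≤-by (*-monoʳ-≤ (overhead update) t≤T) 0 (total (suc (suc l) * (C + 156)) (overhead update) t T))
        (exec-assign epoch (lit 1 ⊕ var row) {st ans e rl y cl c q a₀ a₁ k p i u v w} {μ} _ (λ _ → small (≤-trans y<P (≤-trans (n≤1+n P) P≤X))) »
         exec-assign positive (var row ⊗ var left) {st ans (suc y) rl y cl c q a₀ a₁ k p i u v w} {μ} _
           (λ _ → small (≤-trans (*-monoˡ-≤ (suc N′) (<⇒≤ y<P)) NP≤X)) »
         exec-assign negative ((var right ⊖ lit 1 ⊖ var row) ⊗ var left) {st ans (suc y) rl y cl c q a₀ z₁ k p i u v w} {μ} _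
           (λ _ → small (≤-trans (*-monoˡ-≤ (suc N′) (≤-trans (m∸n≤m (P ∸ 1) y) (m∸n≤m P 1))) NP≤X)) »
         exec-assign column (lit 0) {st ans (suc y) rl y cl c q z₀ z₁ k p i u v w} {μ} tt (λ _ → small z≤n) »
         exec-assign columnsLeft breadth {st ans (suc y) rl y cl 0 q z₀ z₁ k p i u v w} {μ} _ (λ _ → small l+2≤X) »
         exec-changes (suc (suc l)) 0 refl {ans} {rl} {q} {k} {p} {i} {u} {v} {w} {μ} {σ} (clean-input clean)
           (simulates (λ r → trans (clean-decode y<P clean (r * 2)) (registers₁ r)) (λ a → trans (clean-decode y<P clean (a * 2 + 1)) (cells₁ a)))
           start-diameter served
         »= λ { (_ , μ₂) serving → finish μ₂ serving })
      where
      open Query y y<P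
      t = proj₁ (serves y y<P)
      served = proj₁ (proj₂ (serves y y<P))
      t≤T = proj₂ (proj₂ (serves y y<P))
      total : ∀ x K t T → x + K * T + 250 + K * t ≡ 9 + (11 + (22 + (4 + (11 + (x + K * t + 4 + (180 + 9)))))) + K * T + 0
      total = solve-∀
      topExp : Exp 21
      topExp = (lit 1 ⊕ var clauses) ⊗ (lit 4 ⊗ (lit 1 ⊕ var left)) ⊕ lit 2
      finish : ∀ {o₂} μ₂ → Serving ans rl q w μ (applyAll grid ω (Changes.changes N′ (suc l) (columnWeight y))) (o₂ , μ₂) →
        (answer ≐ lit 1 ⊖ (lit 1 ⊖ var answer) ⊗ (topExp ⊖ fetch (register (lit 0))) ⨾ row ≐ lit 1 ⊕ var row) ▷ (o₂ , μ₂) [ 180 + 9 ] State′ rl (suc y)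
      finish μ₂ (c₂ , k₂ , p₂ , i₂ , u₂ , v₂ , τ , refl , sim , un , dia) =
        exec-assign answer (lit 1 ⊖ (lit 1 ⊖ var answer) ⊗ (topExp ⊖ fetch (register (lit 0)))) {o₂} {μ₂}
          (tt , _ , _ , fetch-loads S (register (lit 0)) o₂ μ₂ _ D-small)
          (λ _ → ≤-trans (bits-mono (m∸n≤m 1 ((1 ∸ ans) * (top ∸ D)))) 1≤S) »
        done (exec-assign row (lit 1 ⊕ var row) {st (1 ∸ (1 ∸ ans) * (top ∸ D)) (suc y) rl y 0 c₂ q z₀ z₁ k₂ p₂ i₂ u₂ v₂ w} {μ₂} _
               (λ _ → small (≤-trans y<P (≤-trans (n≤1+n P) P≤X))))
          (_ , suc y , 0 , c₂ , q , z₀ , z₁ , k₂ , p₂ , i₂ , u₂ , v₂ , w , refl ,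
           answers-suc D answers (subst (λ d → top ≤ d ⇔ Good y) (sym D≡) (proj₂ decision)) ,
           λ x x≢ → trans (un x (λ j → x≢ (suc y) j (s≤s z≤n) ≤-refl)) (clean x (λ e j 0<e e≤y → x≢ e j 0<e (≤-trans e≤y (n≤1+n y)))))
        where
        o₂ = st ans (suc y) rl y 0 c₂ q z₀ z₁ k₂ p₂ i₂ u₂ v₂ w
        D : ℕ
        D = decode b (suc P) (suc y) μ₂ 0
        D≡ : D ≡ reg τ 0
        D≡ = Simulates.registers sim 0
        decision = decided y y<P (reg τ 0) dia
        D-small : bits D + 1 ≤ S
        -- The upper bound `top` on the diameter is what keeps the fetched number short; the extra
        -- bit is for the successor in its cell.
        D-small = ≤-trans (+-monoˡ-≤ 1 (bits-mono (≤-trans (≤-reflexive D≡) (proj₁ decision)))) spare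

    exec-queries : ∀ j {y s} → y + j ≡ P → State′ j y s → for rowsLeft (query update) ▷ s [ j * (queryCost + 13) + 4 ] State′ 0 P
    exec-queries zero {y} {s} eq state = done (exec-for-zero rowsLeft (no-rows state)) (subst (λ y → State′ 0 y s) (trans (sym (+-identityʳ y)) eq) state)
      where
      no-rows : ∀ {s} → State′ 0 y s → get rowsLeft (proj₁ s) ≡ 0
      no-rows (_ , _ , _ , _ , _ , _ , _ , _ , _ , _ , _ , _ , _ , refl , _) = refl
    exec-queries (suc j) {y} {_ , μ} eq state@(_ , _ , _ , _ , _ , _ , _ , _ , _ , _ , _ , _ , _ , refl , _) =
      ▷-mono (≤-reflexive (total queryCost j)) (for-suc rowsLeft (λ ()) (▷-map next (exec-query y<P state)))
      where
      y<P : y < P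
      y<P = subst (suc y ≤_) (trans (sym (+-suc y j)) eq) (s≤s (m≤m+n y j))
      total : ∀ Q j → Q + 13 + (j * (Q + 13) + 4) ≡ suc j * (Q + 13) + 4
      total = solve-∀
      next : ∀ {s′} → State′ (suc j) (suc y) s′ → for rowsLeft (query update) ▷ (put rowsLeft (get rowsLeft (proj₁ s′) ∸ 1) (proj₁ s′) , proj₂ s′) [ j * (queryCost + 13) + 4 ] State′ 0 P
      next (ans , e , cl , c , q , a₀ , a₁ , k , p , i , u , v , w , refl , answers , clean) =
        exec-queries j (trans (sym (+-suc y j)) eq) (ans , e , cl , c , q , a₀ , a₁ , k , p , i , u , v , w , refl , answers , clean)

-- A change writes 1 or 2. The values 3 and 0 are strictly above and below both, so each middle edge
-- is changed strictly, whatever its bit.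
initialWeight : Setting → ℕ
initialWeight fullyDynamic = 0
initialWeight decreasing   = 3
initialWeight increasing   = 0

permits-initial : ∀ s {x} → x ≤ 1 → Permits s (initialWeight s) (1 + x)
permits-initial fullyDynamic x≤1 = tt
permits-initial decreasing   x≤1 = s≤s (s≤s x≤1)
permits-initial increasing   x≤1 = s≤s z≤n

initialWeight≤3 : ∀ s → initialWeight s ≤ 3
initialWeight≤3 fullyDynamic = z≤n
initialWeight≤3 decreasing   = ≤-refl
initialWeight≤3 increasing   = z≤n

clauseValue≤1 : ∀ {n} z₀ z₁ (cl : Clause n) → clauseValue z₀ z₁ cl ≤ 1
clauseValue≤1 z₀ z₁ cl = disjoin≤1 z₀ z₁ (map encodeLiteral cl) z≤n

module Changed (N′ m : ℕ) (w : ℕ → ℕ) where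
  open Grid (N′ + suc N′) m
  open Changes N′ m w

  middleEdge-injective : ∀ c c′ .(c< : c < columns) .(c′< : c′ < columns) → middleEdge c c< ≡ middleEdge c′ c′< → c ≡ c′
  middleEdge-injective c c′ c< c′< p = +-cancelˡ-≡ (columns * N′) c c′
    (trans (sym (toℕ-middleEdge c c<)) (trans (cong toℕ p) (toℕ-middleEdge c′ c′<)))

  unchanged : ∀ j c eq ω e → (∀ c′ .(c′< : c′ < columns) → c ≤ c′ → e ≢ middleEdge c′ c′<) → applyAll grid ω (changesFrom j c eq) e ≡ ω e
  unchanged zero    c eq ω e h = refl
  unchanged (suc j) c eq ω e h = trans
    (unchanged j (suc c) (trans (sym (+-suc c j)) eq) _ e (λ c′ c′< c< → h c′ c′< (<⇒≤ c<)))
    (updateAt-minimal e _ ω (h c (subst (suc c ≤_) (trans (sym (+-suc c j)) eq) (s≤s (m≤m+n c j))) ≤-refl))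

  changed : ∀ j c eq ω c′ .(c′< : c′ < columns) → c ≤ c′ → applyAll grid ω (changesFrom j c eq) (middleEdge c′ c′<) ≡ 1 + w c′
  -- The bound on c′ is irrelevant, so the contradiction is too and needs an eliminator with an
  -- irrelevant argument.
  changed zero    c eq ω c′ c′< c≤ = ⊥-elim-irr (<⇒≱ c′< (subst (_≤ c′) (trans (sym (+-identityʳ c)) eq) c≤))
    where
    ⊥-elim-irr : ∀ {A : Set} → .⊥ → A
    ⊥-elim-irr ()
  changed (suc j) c eq ω c′ c′< c≤ with m≤n⇒m<n∨m≡n c≤
  ... | inj₁ c<   = changed j (suc c) (trans (sym (+-suc c j)) eq) _ c′ c′< c<
  ... | inj₂ refl = trans
    (unchanged j (suc c) (trans (sym (+-suc c j)) eq) _ (middleEdge c c′<)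
      (λ c″ c″< c<c″ p → <⇒≢ c<c″ (middleEdge-injective c c″ c′< c″< p)))
    (updateAt-updates (middleEdge c c′<) ω)

  legal : ∀ s W → (∀ c → w c ≤ 1) → 2 ≤ W → ∀ j c eq ω → (∀ c′ .(c′< : c′ < columns) → c ≤ c′ → ω (middleEdge c′ c′<) ≡ initialWeight s) →
          Legal grid s W ω (changesFrom j c eq)
  legal s W w≤1 2≤W zero    c eq ω h = []
  legal s W w≤1 2≤W (suc j) c eq ω h =
    (subst (λ x → Permits s x (1 + w c)) (sym (h c c< ≤-refl)) (permits-initial s (w≤1 c)) , ≤-trans (s≤s (w≤1 c)) 2≤W) ∷
    legal s W w≤1 2≤W j (suc c) (trans (sym (+-suc c j)) eq) _
      (λ c′ c′< c<c′ → trans (updateAt-minimal (middleEdge c′ c′<) (middleEdge c c<) ω (λ p → <⇒≢ c<c′ (sym (middleEdge-injective c′ c c′< c< p)))) (h c′ c′< (<⇒≤ c<c′)))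
    where
    c< : c < columns
    c< = subst (suc c ≤_) (trans (sym (+-suc c j)) eq) (s≤s (m≤m+n c j))

-- The weighted grid of a formula

module Instance {n : ℕ} (φ : CNF n) (N′ P x : ℕ) where

  m : ℕ
  m = suc (length φ)

  open Metric N′ m (s≤s z≤n)
  open Listing (N′ + suc N′) m

  verticalWeightAt horizontalWeightAt : ℕ → ℕ → ℕ
  verticalWeightAt y c = (1 ∸ ((y ∸ N′) + (N′ ∸ y))) * x + (1 ∸ (1 ∸ ((y ∸ N′) + (N′ ∸ y)))) * (2 * m)
  horizontalWeightAt y c = 4 * (2 + N′ ∸ ((N′ ∸ y) + (y ∸ suc N′))) + rowValue N′ φ y (suc c) ∸ rowValue N′ φ y c

  weights₀ : Graph.Weighting grid
  weights₀ = weigh verticalWeightAt horizontalWeightAt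

  columnWeight : ℕ → ℕ → ℕ
  columnWeight y = at 0 (1 ∷ map (clauseValue ((P ∸ 1 ∸ y) * suc N′) (y * suc N′)) φ)

  columnWeight≤1 : ∀ y c → columnWeight y c ≤ 1
  columnWeight≤1 y zero    = ≤-refl
  columnWeight≤1 y (suc c) = at-bound _ z≤n (clauseValue≤1 _ _) φ c

  M : ℕ → ℕ → ℕ
  M k = at 1 (0 ∷ map (clauseValue (N′ ∸ k) k) φ)

  M≤1 : ∀ k c → M k c ≤ 1
  M≤1 k zero    = z≤n
  M≤1 k (suc c) = at-bound _ ≤-refl (clauseValue≤1 _ _) φ c

  verticalWeight-middle : ∀ y c → y ≡ N′ → verticalWeightAt y c ≡ x
  verticalWeight-middle y c refl = trans (cong (λ d → (1 ∸ d) * x + (1 ∸ (1 ∸ d)) * (2 * m)) (cong₂ _+_ (n∸n≡0 N′) (n∸n≡0 N′)))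
    (trans (+-identityʳ (x + 0)) (+-identityʳ x))

  verticalWeight-outer : ∀ y c → y ≢ N′ → verticalWeightAt y c ≡ 2 * m
  verticalWeight-outer y c y≢ with (y ∸ N′) + (N′ ∸ y) in eq
  ... | zero  = contradiction (≤-antisym (m∸n≡0⇒m≤n (m+n≡0⇒m≡0 (y ∸ N′) eq)) (m∸n≡0⇒m≤n (m+n≡0⇒n≡0 (y ∸ N′) eq))) y≢
  ... | suc d rewrite 0∸n≡0 d = *-identityˡ (2 * m)

  horizontalWeight-low : ∀ y c k → y + k ≡ N′ → horizontalWeightAt y c + M k c ≡ H k + M k (suc c)
  horizontalWeight-low y c k refl = trans
    (cong (_+ M k c) (cong₂ (λ a ((r , r′) : ℕ × ℕ) → 4 * (2 + N′ ∸ a) + r ∸ r′) k≡ (cong₂ _,_ (row-value (suc c)) (row-value c))))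
    (m∸n+n≡m (≤-trans (M≤1 k c) (≤-trans (H-pos (m≤n+m k y)) (m≤m+n (H k) (M k (suc c))))))
    where
    k≡ : (y + k ∸ y) + (y ∸ suc (y + k)) ≡ k
    k≡ = trans (cong₂ _+_ (m+n∸m≡n y k) (m≤n⇒m∸n≡0 (≤-trans (m≤m+n y k) (n≤1+n (y + k))))) (+-identityʳ k)
    row-value : ∀ c → rowValue N′ φ y c ≡ M k c
    row-value c = trans (rowValue-low N′ φ c (m≤m+n y k)) (cong (λ k → at 1 (0 ∷ map (clauseValue (N′ ∸ k) k) φ) c) (m+n∸m≡n y k))

  horizontalWeight-up : ∀ y c k → y ≡ suc N′ + k → horizontalWeightAt y c ≡ H k
  horizontalWeight-up y c k refl = trans
    (cong₂ (λ a ((r , r′) : ℕ × ℕ) → 4 * (2 + N′ ∸ a) + r ∸ r′) (cong₂ _+_ (m≤n⇒m∸n≡0 (≤-trans (m≤m+n N′ k) (n≤1+n (N′ + k)))) (m+n∸m≡n (suc N′) k))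
      (cong₂ _,_ (rowValue-up N′ φ {suc N′ + k} (suc c) (<⇒≱ (s≤s (m≤m+n N′ k)))) (rowValue-up N′ φ {suc N′ + k} c (<⇒≱ (s≤s (m≤m+n N′ k))))))
    (+-identityʳ (H k))

  -- The square takes care of the smallest grids: for N′ = 0 and no clauses there are 4 vertices but
  -- an edge of weight 9.
  weights₀≤ : x ≤ 3 → ∀ e → weights₀ e ≤ vertices ^ 2
  weights₀≤ x≤3 = weigh-≤ verticalWeightAt horizontalWeightAt vertical≤ horizontal≤
    where
    l : ℕ
    l = length φ
    bound : ∀ {z} → z ≤ 2 * m ⊔ (4 * (2 + N′) + 1) → z ≤ vertices ^ 2
    bound z≤ = ≤-trans z≤ (⊔-lub (≤-from {2 * m} _ (eq₁ N′ l)) (≤-from {4 * (2 + N′) + 1} _ (eq₂ N′ l)))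
      where
      eq₁ : ∀ N l → suc (N + suc N) * suc (suc l) * (suc (N + suc N) * suc (suc l) * 1) ≡ 2 * suc l +
            (4 * N * N * (2 + l) * (2 + l) + 8 * N * (2 + l) * (2 + l) + 4 * (l * l) + 14 * l + 14)
      eq₁ = solve-∀
      eq₂ : ∀ N l → suc (N + suc N) * suc (suc l) * (suc (N + suc N) * suc (suc l) * 1) ≡ 4 * (2 + N) + 1 +
            (4 * N * N * (2 + l) * (2 + l) + 8 * N * (l * l + 4 * l) + 28 * N + 4 * (l * l) + 16 * l + 7)
      eq₂ = solve-∀
    vertical≤ : ∀ y c → verticalWeightAt y c ≤ vertices ^ 2
    vertical≤ y c with y ≟ N′
    ... | yes y≡ = bound (≤-trans (≤-reflexive (verticalWeight-middle y c y≡)) (≤-trans x≤3 (≤-trans (≤-trans (m≤m+n 3 (4 * (2 + N′) ∸ 2)) (≤-reflexive (three N′))) (m≤n⊔m (2 * m) (4 * (2 + N′) + 1)))))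
      where
      three : ∀ N → 3 + (4 * (2 + N) ∸ 2) ≡ 4 * (2 + N) + 1
      three N = trans (cong (λ z → 3 + (z ∸ 2)) (*-distribˡ-+ 4 2 N)) (eq N)
        where
        eq : ∀ N → 3 + (6 + 4 * N) ≡ 4 * (2 + N) + 1
        eq = solve-∀
    ... | no y≢ = bound (≤-trans (≤-reflexive (verticalWeight-outer y c y≢)) (m≤m⊔n (2 * m) (4 * (2 + N′) + 1)))
    rowValue≤1 : ∀ y c → rowValue N′ φ y c ≤ 1
    rowValue≤1 y c with does (y ≤? N′)
    ... | false = z≤n
    ... | true  = M≤ c
      where
      M≤ : ∀ c → at 1 (0 ∷ map (clauseValue (N′ ∸ (N′ ∸ y)) (N′ ∸ y)) φ) c ≤ 1
      M≤ zero    = z≤n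
      M≤ (suc c) = at-bound _ ≤-refl (clauseValue≤1 _ _) φ c
    horizontal≤ : ∀ y c → horizontalWeightAt y c ≤ vertices ^ 2
    horizontal≤ y c = bound (≤-trans (m∸n≤m _ (rowValue N′ φ y c)) (≤-trans (+-mono-≤ (*-monoʳ-≤ 4 (m∸n≤m (2 + N′) ((N′ ∸ y) + (y ∸ suc N′)))) (rowValue≤1 y (suc c))) (m≤n⊔m (2 * m) (4 * (2 + N′) + 1))))

  module _ (y : ℕ) where
    open Changes N′ m (columnWeight y)
    open Changed N′ m (columnWeight y)

    weights : Graph.Weighting grid
    weights = applyAll grid weights₀ changes

    vertical≢middle : ∀ y c → toℕ y ≢ N′ → ∀ c′ .(c′< : c′ < columns) → 0 ≤ c′ → vertical y c ≢ middleEdge c′ c′<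
    vertical≢middle y c y≢ c′ c′< _ p = y≢ (trans (cong toℕ (Fin.combine-injectiveˡ y c (fromℕ< N′<h) (fromℕ< c′<) (Fin.↑ˡ-injective (rows * m) _ _ p))) (Fin.toℕ-fromℕ< N′<h))

    horizontal≢vertical : ∀ y c y′ c′ → horizontal y c ≢ vertical y′ c′
    horizontal≢vertical y c y′ c′ p with () ← trans (sym (Fin.splitAt-↑ʳ ((N′ + suc N′) * columns) (rows * m) (combine y c))) (trans (cong (splitAt ((N′ + suc N′) * columns)) p) (Fin.splitAt-↑ˡ ((N′ + suc N′) * columns) (combine y′ c′) (rows * m)))

    metric-weights : Weights weights M (columnWeight y)
    metric-weights = record
      { M≤1     = M≤1
      ; w≤1     = columnWeight≤1 y
      ; M-first = λ k → refl
      ; M-last  = λ k → at-end 1 _ φ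
      ; w-first = refl
      ; w-last  = at-end 0 _ φ
      ; middle  = λ z c z≡ → trans (cong weights (cong₂ vertical (Fin.toℕ-injective (trans z≡ (sym (Fin.toℕ-fromℕ< N′<h)))) (sym (Fin.fromℕ<-toℕ c (Fin.toℕ<n c)))))
                               (changed columns 0 refl weights₀ (toℕ c) (Fin.toℕ<n c) z≤n)
      ; outer   = λ z c z≢ → trans (unchanged columns 0 refl weights₀ (vertical z c) (vertical≢middle z c z≢))
                               (trans (weigh-vertical verticalWeightAt horizontalWeightAt z c) (verticalWeight-outer (toℕ z) (toℕ c) z≢))
      ; lower   = λ z c k eq → trans (cong (_+ M k (toℕ c)) (horizontal-weight z c)) (horizontalWeight-low (toℕ z) (toℕ c) k eq)
      ; upper   = λ z c k eq → trans (horizontal-weight z c) (horizontalWeight-up (toℕ z) (toℕ c) k eq)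
      }
      where
      horizontal-weight : ∀ z c → weights (horizontal z c) ≡ horizontalWeightAt (toℕ z) (toℕ c)
      horizontal-weight z c = trans (unchanged columns 0 refl weights₀ (horizontal z c) (λ c′ c′< _ → horizontal≢vertical z c (fromℕ< N′<h) (fromℕ< c′<)))
        (weigh-horizontal verticalWeightAt horizontalWeightAt z c)

    legal-changes : ∀ s W → x ≡ initialWeight s → 2 ≤ W → Legal grid s W weights₀ changes
    legal-changes s W x≡ 2≤W = legal s W (columnWeight≤1 y) 2≤W columns 0 refl weights₀
      λ c c< _ → trans (weigh-vertical verticalWeightAt horizontalWeightAt (fromℕ< N′<h) (fromℕ< c<)) (trans (verticalWeight-middle (toℕ (fromℕ< N′<h)) (toℕ (fromℕ< c<)) (Fin.toℕ-fromℕ< N′<h)) x≡)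

  Good : ℕ → Set
  Good y = ∃ λ k → k ≤ N′ × (∀ j → j ≤ m → 1 ≤ M k j + columnWeight y j)

  diameter-decides : ∀ y D → Graph.IsDiameter grid (weights y) D → D ≤ top × (top ≤ D ⇔ Good y)
  diameter-decides y D dia = diameter≤top dia , mk⇔ (top≤diameter⇒satisfied dia) (λ (k , k≤ , sat) → satisfied⇒top≤diameter dia k≤ sat)
    where open Distances (metric-weights y)

  -- Columns 1 to l are the clauses. The dummy columns have sums 0 + 1 and 1 + 0 and impose no
  -- condition.
  good⇔satisfiable : ∀ {a p} → n ≡ a + p → 2 ^ a ≡ suc N′ → 2 ^ p ≡ P → (∃ λ y → y < P × Good y) ⇔ Satisfiable φ
  good⇔satisfiable {a} {p} n≡ N≡ refl = mk⇔ forth back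
    where
    open Split a p n≡
    f g : ℕ → Clause n → ℕ
    f k = clauseValue (N′ ∸ k) k
    g y = clauseValue ((2 ^ p ∸ 1 ∸ y) * suc N′) (y * suc N′)
    f≡ : ∀ k cl → f k cl ≡ leftValue k cl
    f≡ k cl = cong (λ N → clauseValue (N ∸ 1 ∸ k) k cl) (sym N≡)
    g≡ : ∀ y cl → g y cl ≡ rightValue y cl
    g≡ y cl = cong (λ N → clauseValue ((2 ^ p ∸ 1 ∸ y) * N) (y * N) cl) (sym N≡)
    forth : (∃ λ y → y < 2 ^ p × Good y) → Satisfiable φ
    forth (y , y< , k , k≤ , sat) = covers⇒satisfiable (subst (k <_) (sym N≡) (s≤s k≤)) y<
      (All.map (λ {cl} → subst (1 ≤_) (cong₂ _+_ (f≡ k cl) (g≡ y cl))) (at-all⁻¹ (f k) (g y) φ λ c c< → sat (suc c) (s≤s (<⇒≤ c<))))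
    back : Satisfiable φ → ∃ λ y → y < 2 ^ p × Good y
    back sat with k , y , k< , y< , covers ← satisfiable⇒covers sat =
      y , y< , k , s≤s⁻¹ (subst (k <_) N≡ k<) , column-sum
      where
      column-sum : ∀ j → j ≤ m → 1 ≤ M k j + columnWeight y j
      column-sum zero    _ = ≤-refl
      column-sum (suc c) _ = at-all (f k) (g y) ≤-refl (All.map (λ {cl} → subst (1 ≤_) (sym (cong₂ _+_ (f≡ k cl) (g≡ y cl)))) covers) c

-- Correctness and cost of the decision procedure

module Decide (S X : ℕ) (1≤S : 1 ≤ S) (small : ∀ {x} → x ≤ X → bits x ≤ S) {n : ℕ} (2n≤X : 2 * n ≤ X) (φ : CNF n)
  (L≤X : 2 + length (blocks φ) ≤ X) (D′ N′ P : ℕ) (N≡ : 2 ^ (n / suc D′) ≡ suc N′) (P≡ : 2 ^ (n ∸ n / suc D′) ≡ P)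
  (NP≤X : P * suc N′ ≤ X) (P≤X : suc P ≤ X) (N≤X : N′ + suc (suc N′) ≤ X)
  (list≤X : 2 + (N′ + suc N′) * ((2 + length φ) * 3) + suc (N′ + suc N′) * (suc (length φ) * 3) ≤ X)
  (spare : bits (suc (length φ) * (4 * (2 + N′)) + 2) + 1 ≤ S) (s : Setting) (A : DynamicAlgorithm) where

  open Rules {21} S 1≤S
  open Emission S X 1≤S small
  open DynamicAlgorithm A
  open Instance φ N′ P (initialWeight s) using (m; weights₀; verticalWeightAt; horizontalWeightAt; diameter-decides; good⇔satisfiable; Good)
  open Grid (N′ + suc N′) m using (grid; vertices; size)
  open Listing (N′ + suc N′) m using (encodeGrid)

  l b x₀ : ℕ
  l = length φ
  b = 2 + length (blocks φ)
  x₀ = initialWeight s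

  μ₀ : Memory
  μ₀ = contents (encodeCNF φ)

  module V = EmissionVertical S X 1≤S small n l b N′ P x₀ 0 0 0
  module H = EmissionHorizontal S X 1≤S small 2n≤X φ L≤X N′ P N≤X μ₀ (stored-contents 2 (blocks φ) (λ j j< → refl))
  module Q = Queries S X 1≤S small 2n≤X φ L≤X N′ P NP≤X P≤X spare A

  header : List ℕ
  header = 2 * suc N′ * (2 + l) ∷ (2 * suc N′ ∸ 1) * (2 + l) + 2 * suc N′ * suc l ∷ []

  state : (p u q : ℕ) → Env 21
  state p u q = environment 0 n l b (suc P) 0 (suc N′) P 0 0 0 0 q 0 0 0 p 0 u 0 0

  exec-header : ∀ p u → 2 ≤ X → emitHeader ▷ (state p u 0 , μ₀) [ 93 + 142 ] Lists μ₀ (state p u 2) header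
  exec-header p u 2≤X =
    exec-emit (lit 2 ⊗ var left ⊗ breadth) {state p u 0} {μ₀} {μ₀} {[]} refl (s≤s z≤n) refl (≤-trans (n≤1+n 1) 2≤X) _ (emitted-[] (encodeCNF φ) refl)
      »= λ { (_ , μ₁) (refl , q₁≡ , em₁) →
    exec-emit ((lit 2 ⊗ var left ⊖ lit 1) ⊗ breadth ⊕ lit 2 ⊗ var left ⊗ (lit 1 ⊕ var clauses)) {state p u 1} {μ₁} {μ₀} {_ ∷ []} refl (s≤s z≤n) q₁≡ 2≤X _ em₁ }

  listing : List ℕ
  listing = (header ++ range (V.verticalRow 0 0 0 0 0 μ₀) 0 (N′ + suc N′)) ++ range H.horizontalRow 0 (suc (N′ + suc N′))

  listing≡ : listing ≡ encodeGraph grid weights₀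
  listing≡ = trans (cong₂ (λ v e → v ∷ e ∷ edges) (cong (_* (2 + l)) rows≡) (cong₂ (λ h r → h * (2 + l) + r * suc l) (cong (_∸ 1) rows≡) rows≡))
                   (sym (encodeGrid verticalWeightAt horizontalWeightAt))
    where
    edges : List ℕ
    edges = range (V.verticalRow 0 0 0 0 0 μ₀) 0 (N′ + suc N′) ++ range H.horizontalRow 0 (suc (N′ + suc N′))
    rows≡ : 2 * suc N′ ≡ suc (N′ + suc N′)
    rows≡ = cong (λ z → suc (N′ + suc z)) (+-identityʳ N′)

  module Answer (σ : State) (t₀ T : ℕ) (run₀ : Run preprocess (start (encodeGraph grid weights₀)) σ t₀) (dia₀ : Graph.IsDiameter grid weights₀ (reg σ 0))
    (serves : ∀ y → y < P → ∃ λ t → Serves grid A σ weights₀ (Changes.changes N′ m (Q.columnWeight y)) t × t ≤ T) where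

    queriesCost totalCost : ℕ
    queriesCost = P * (suc (suc l) * (columnCost n (length (blocks φ)) + 156) + overhead update * T + 250 + 13) + 4
    totalCost = Setup.setupCost S X 1≤S small φ 2n≤X L≤X D′ + (93 + 142 + ((N′ + suc N′) * V.rowCost 0 0 0 0 0 μ₀ + 24 +
                (suc (N′ + suc N′) * H.rowCost + 19 + (overhead preprocess * t₀ + (4 + (6 + queriesCost))))))

    Correct : Conf 21 → Set
    Correct (o , _) = get answer o ≡ 1 ⇔ Satisfiable φ

    Built : Conf 21 → Set
    Built (o , μ) = ∃₂ λ y q → ∃₂ λ cl c → ∃₂ λ z₀ z₁ → ∃₂ λ k p → ∃₂ λ i u → ∃₂ λ v w →
      o ≡ environment 0 n l b (suc P) 0 (suc N′) P 0 y cl c q z₀ z₁ k p i u v w × Emitted b (suc P) μ₀ μ (encodeGraph grid weights₀)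

    serve : ∀ {c} → Built c →
      (virtual preprocess ⨾ row ≐ lit 0 ⨾ rowsLeft ≐ var right ⨾ for rowsLeft (query update)) ▷ c [ overhead preprocess * t₀ + (4 + (6 + queriesCost)) ] Correct
    serve {_ , μ} (y , q , cl , c , z₀ , z₁ , k , p , i , u , v , w , refl , emitted none listed elsewhere) =
      after (simulate S 1≤S {o} (s≤s z≤n) run₀ {μ} (simulates none listed))
      where
      o : Env 21
      o = environment 0 n l b (suc P) 0 (suc N′) P 0 y cl c q z₀ z₁ k p i u v w
      after : Simulation S 1≤S {o} (s≤s z≤n) (virtual preprocess) μ σ (overhead preprocess * t₀) →
        (virtual preprocess ⨾ row ≐ lit 0 ⨾ rowsLeft ≐ var right ⨾ for rowsLeft (query update)) ▷ (o , μ) [ overhead preprocess * t₀ + (4 + (6 + queriesCost)) ] Correct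
      after (μ₁ , E , sim , un) =
        E »
        exec-assign row (lit 0) {o} {μ₁} tt (λ _ → small z≤n) »
        exec-assign rowsLeft (var right) {environment 0 n l b (suc P) 0 (suc N′) P 0 0 cl c q z₀ z₁ k p i u v w} {μ₁} tt (λ sm → sm right) »
        ▷-map correct (D.exec-queries P {0} refl (0 , 0 , cl , c , q , z₀ , z₁ , k , p , i , u , v , w , refl , D.answers-zero , λ x _ → refl))
        where
        module D = Q.Decision σ weights₀ dia₀ Good T serves (λ y y<P D dia → diameter-decides y D dia) μ₁
                     (λ x x≢ → trans (un x x≢) (elsewhere x x≢)) (Simulates.registers sim) (Simulates.cells sim)
        correct : ∀ {s} → D.State′ 0 P s → Correct s
        correct (_ , _ , _ , _ , _ , _ , _ , _ , _ , _ , _ , _ , _ , refl , (_ , iff) , _) =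
          mk⇔ (Equivalence.to both ∘ Equivalence.to iff) (Equivalence.from iff ∘ Equivalence.from both)
          where
          both : (∃ λ y → y < P × Good y) ⇔ Satisfiable φ
          both = good⇔satisfiable {n / suc D′} {n ∸ n / suc D′} (sym (m+[n∸m]≡n (m/n≤m n (suc D′)))) N≡ P≡

    build : ∀ p u →
      (emitHeader ⨾ emitVertical x₀ ⨾ emitHorizontal ⨾ virtual preprocess ⨾ row ≐ lit 0 ⨾ rowsLeft ≐ var right ⨾ for rowsLeft (query update))
      ▷ (state p u 0 , μ₀) [ 93 + 142 + ((N′ + suc N′) * V.rowCost 0 0 0 0 0 μ₀ + 24 + (suc (N′ + suc N′) * H.rowCost + 19 + (overhead preprocess * t₀ + (4 + (6 + queriesCost))))) ] Correct
    build p u =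
      exec-header p u (≤-trans (m≤m+n 2 _) list₁≤X) »= λ { (_ , μ₁) (refl , q₁≡ , em₁) →
      V.exec-vertical p 0 u 0 0 μ₀ 0 0 0 0 2 μ₁ header q₁≡ list₁≤X (≤-trans (+-monoʳ-≤ N′ (n≤1+n (suc N′))) N≤X) H.l+2≤X em₁ »= λ { (_ , μ₂) (y₂ , c₂ , cl₂ , refl , q₂≡ , em₂) →
      H.exec-horizontal {0} {y₂} {2 + (N′ + suc N′) * ((2 + l) * 3)} {header ++ range (V.verticalRow 0 0 0 0 0 μ₀) 0 (N′ + suc N′)} {_ , μ₂}
        (cl₂ , c₂ , 0 , 0 , 0 , p , 0 , u , 0 , 0 , refl , q₂≡ , em₂) list≤X »= λ { (_ , μ₃) (cl , c , z₀ , z₁ , k , p , i , u , v , w , refl , _ , em₃) →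
      serve (_ , _ , cl , c , z₀ , z₁ , k , p , i , u , v , w , refl , subst (Emitted b (suc P) μ₀ μ₃) listing≡ em₃) } } }
      where
      list₁≤X : 2 + (N′ + suc N′) * ((2 + l) * 3) ≤ X
      list₁≤X = ≤-trans (m≤m+n _ (suc (N′ + suc N′) * (suc l * 3))) list≤X

    exec-decide : decide (suc D′) x₀ A ▷ (zeros 21 , μ₀) [ totalCost ] Correct
    exec-decide =
      let p , u , E = Setup.exec-setup S X 1≤S small φ 2n≤X L≤X D′ N≤ P< in
      subst₂ (λ N P → Exec S (setup (suc D′)) (zeros 21 , μ₀) (environment 0 n l b (suc P) 0 N P 0 0 0 0 0 0 0 0 p 0 u 0 0 , μ₀) (Setup.setupCost S X 1≤S small φ 2n≤X L≤X D′)) N≡ P≡ E » build p u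
      where
      N≤ : 2 ^ (n / suc D′) ≤ X
      N≤ = ≤-trans (≤-reflexive N≡) (≤-trans (≤-trans (n≤1+n (suc N′)) (m≤n+m (suc (suc N′)) N′)) N≤X)
      P< : suc (2 ^ (n ∸ n / suc D′)) ≤ X
      P< = subst (λ P → suc P ≤ X) (sym P≡) P≤X

    decide-run : ∃₂ λ final t → Run (decide (suc D′) x₀ A) (start (encodeCNF φ)) final t × (reg final 0 ≡ 1 ⇔ Satisfiable φ) × t ≤ totalCost * S
    decide-run =
      let (o , μ) , E , correct = exec-decide
          final , t , run , rep , t≤ = execute E (start (encodeCNF φ))
            (represents (λ i → sym (get-zeros i)) (λ i → ≤-trans (≤-reflexive (cong bits (get-zeros i))) 1≤S) refl)
      in final , t , run , subst (λ a → a ≡ 1 ⇔ Satisfiable φ) (sym (Represents.variables rep answer)) correct , t≤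

-- Running time

^-distribʳ-* : ∀ o m n → (m * n) ^ o ≡ m ^ o * n ^ o
^-distribʳ-* zero    m n = refl
^-distribʳ-* (suc o) m n = trans (cong (m * n *_) (^-distribʳ-* o m n)) (eq m n (m ^ o) (n ^ o))
  where
  eq : ∀ m n x y → m * n * (x * y) ≡ m * x * (n * y)
  eq = solve-∀

module _ {I : Set} (Y : I → ℕ) where

  -- Polynomial growth in Y. The closure lemmas assemble the coefficient and the exponent, so that
  -- neither has to be written down for the full cost.
  Bounded : (I → ℕ) → Set
  Bounded f = ∃₂ λ c e → ∀ i → f i ≤ c * Y i ^ e

  bounded-const : ∀ k → Bounded (λ _ → k)
  bounded-const k = k , 0 , λ i → ≤-reflexive (sym (*-identityʳ k))

  bounded-by : ∀ {f} → (∀ i → f i ≤ Y i) → Bounded f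
  bounded-by f≤ = 1 , 1 , λ i → ≤-trans (f≤ i) (≤-reflexive (sym (trans (*-identityˡ (Y i ^ 1)) (^-identityʳ (Y i)))))

  bounded-* : ∀ {f g} → Bounded f → Bounded g → Bounded (λ i → f i * g i)
  bounded-* {f} {g} (c , e , f≤) (c′ , e′ , g≤) = c * c′ , e + e′ , λ i → begin
    f i * g i                          ≤⟨ *-mono-≤ (f≤ i) (g≤ i) ⟩
    c * Y i ^ e * (c′ * Y i ^ e′)      ≡⟨ eq c c′ (Y i ^ e) (Y i ^ e′) ⟩
    c * c′ * (Y i ^ e * Y i ^ e′)      ≡⟨ cong (c * c′ *_) (^-distribˡ-+-* (Y i) e e′) ⟨
    c * c′ * Y i ^ (e + e′)            ∎
    where
    open ≤-Reasoning
    eq : ∀ c c′ x y → c * x * (c′ * y) ≡ c * c′ * (x * y)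
    eq = solve-∀

  bounded-^ : ∀ {f} k → Bounded f → Bounded (λ i → f i ^ k)
  bounded-^ zero    b = bounded-const 1
  bounded-^ (suc k) b = bounded-* b (bounded-^ k b)

  module _ (1≤Y : ∀ i → 1 ≤ Y i) where

    bounded-+ : ∀ {f g} → Bounded f → Bounded g → Bounded (λ i → f i + g i)
    bounded-+ {f} {g} (c , e , f≤) (c′ , e′ , g≤) = c + c′ , e + e′ , λ i → begin
      f i + g i                                      ≤⟨ +-mono-≤ (f≤ i) (g≤ i) ⟩
      c * Y i ^ e + c′ * Y i ^ e′                    ≤⟨ +-mono-≤ (*-monoʳ-≤ c (raise i (m≤m+n e e′))) (*-monoʳ-≤ c′ (raise i (m≤n+m e′ e))) ⟩
      c * Y i ^ (e + e′) + c′ * Y i ^ (e + e′)       ≡⟨ *-distribʳ-+ (Y i ^ (e + e′)) c c′ ⟨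
      (c + c′) * Y i ^ (e + e′)                      ∎
      where
      open ≤-Reasoning
      raise : ∀ i {e e′} → e ≤ e′ → Y i ^ e ≤ Y i ^ e′
      raise i = ^-monoʳ-≤ (Y i) {{>-nonZero (1≤Y i)}}

n<2^n : ∀ n → n < 2 ^ n
n<2^n zero    = s≤s z≤n
n<2^n (suc n) = ≤-trans (s≤s (n<2^n n)) (≤-trans (+-monoˡ-≤ (2 ^ n) (m^n>0 2 n)) (≤-reflexive (cong (2 ^ n +_) (sym (+-identityʳ (2 ^ n))))))

-- With t = n / e one has n + 1 ≤ e (t + 1) ≤ e 2 ^ t.
polynomial≤exponential : ∀ e → ∃ λ c → ∀ n → suc n ^ e ≤ c * 2 ^ n
polynomial≤exponential zero    = 1 , λ n → ≤-trans (m^n>0 2 n) (≤-reflexive (sym (*-identityˡ (2 ^ n))))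
polynomial≤exponential e@(suc _) = e ^ e , λ n → begin
  suc n ^ e                  ≤⟨ ^-monoˡ-≤ e (n< n) ⟩
  (e * 2 ^ (n / e)) ^ e      ≡⟨ ^-distribʳ-* e e (2 ^ (n / e)) ⟩
  e ^ e * (2 ^ (n / e)) ^ e  ≡⟨ cong (e ^ e *_) (^-*-assoc 2 (n / e) e) ⟩
  e ^ e * 2 ^ (n / e * e)    ≤⟨ *-monoʳ-≤ (e ^ e) (^-monoʳ-≤ 2 (m/n*n≤m n e)) ⟩
  e ^ e * 2 ^ n              ∎
  where
  open ≤-Reasoning
  n< : ∀ n → suc n ≤ e * 2 ^ (n / e)
  n< n = begin
    suc n                    ≡⟨ cong suc (m≡m%n+[m/n]*n n e) ⟩
    suc (n % e) + n / e * e  ≤⟨ +-monoˡ-≤ (n / e * e) (m%n<n n e) ⟩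
    suc (n / e) * e          ≤⟨ *-monoˡ-≤ e (n<2^n (n / e)) ⟩
    2 ^ (n / e) * e          ≡⟨ *-comm (2 ^ (n / e)) e ⟩
    e * 2 ^ (n / e)          ∎

power-max : ∀ q {a b c z} → a ^ q * z ≤ c → b ^ q * z ≤ c → (a ⊔ b) ^ q * z ≤ c
power-max q {a} {b} a≤ b≤ with ⊔-sel a b
... | inj₁ p = subst (λ x → x ^ q * _ ≤ _) (sym p) a≤
... | inj₂ p = subst (λ x → x ^ q * _ ≤ _) (sym p) b≤

+≤2*⊔ : ∀ a b → a + b ≤ 2 * (a ⊔ b)
+≤2*⊔ a b = ≤-trans (+-mono-≤ (m≤m⊔n a b) (m≤n⊔m a b)) (≤-reflexive (cong ((a ⊔ b) +_) (sym (+-identityʳ (a ⊔ b)))))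

-- A is the cost of P queries, each of cost G T, on a graph with r vertices.  The
-- saved factor r ^ (1 / q) of T becomes a saving of 2 ^ (2 n) in A ^ (2 q D).
queries-power : ∀ q D n a {J r z G T P} → T ^ q * r ≤ (J * r) ^ q → r ≡ 2 ^ a * z → 2 ^ a ≤ r → P * 2 ^ a ≡ 2 ^ n → n ≤ a * D + D → 1 ≤ q →
  (P * (G * T)) ^ (q * (2 * D)) * 2 ^ (2 * n) ≤ (2 * (G * (J * z)) * 2 ^ n) ^ (q * (2 * D))
queries-power q D n a {J} {r} {z} {G} {T} {P} T≤ r≡ N≤r PN≡ n≤ 1≤q = begin
  -- Rounding in n / D costs a factor 2 ^ (2 D), which the leading 2 on the right pays for.
  A ^ (q * (2 * D)) * 2 ^ (2 * n)                            ≤⟨ *-monoʳ-≤ (A ^ (q * (2 * D))) (^-monoʳ-≤ 2 2n≤) ⟩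
  A ^ (q * (2 * D)) * 2 ^ (a * (2 * D) + 2 * D)              ≡⟨ cong₂ _*_ (sym (^-*-assoc A q (2 * D))) (trans (^-distribˡ-+-* 2 (a * (2 * D)) (2 * D)) (cong (_* 2 ^ (2 * D)) (sym (^-*-assoc 2 a (2 * D))))) ⟩
  (A ^ q) ^ (2 * D) * ((2 ^ a) ^ (2 * D) * 2 ^ (2 * D))      ≡⟨ *-assoc ((A ^ q) ^ (2 * D)) ((2 ^ a) ^ (2 * D)) (2 ^ (2 * D)) ⟨
  (A ^ q) ^ (2 * D) * (2 ^ a) ^ (2 * D) * 2 ^ (2 * D)        ≡⟨ cong (_* 2 ^ (2 * D)) (sym (^-distribʳ-* (2 * D) (A ^ q) (2 ^ a))) ⟩
  (A ^ q * 2 ^ a) ^ (2 * D) * 2 ^ (2 * D)                    ≤⟨ *-mono-≤ (^-monoˡ-≤ (2 * D) A≤) (^-monoʳ-≤ 2 (m≤n*m (2 * D) q {{>-nonZero 1≤q}})) ⟩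
  ((G * (J * z) * 2 ^ n) ^ q) ^ (2 * D) * 2 ^ (q * (2 * D))  ≡⟨ cong (_* 2 ^ (q * (2 * D))) (^-*-assoc (G * (J * z) * 2 ^ n) q (2 * D)) ⟩
  (G * (J * z) * 2 ^ n) ^ (q * (2 * D)) * 2 ^ (q * (2 * D))  ≡⟨ ^-distribʳ-* (q * (2 * D)) (G * (J * z) * 2 ^ n) 2 ⟨
  (G * (J * z) * 2 ^ n * 2) ^ (q * (2 * D))                  ≡⟨ cong (_^ (q * (2 * D))) (eq₁ (G * (J * z)) (2 ^ n)) ⟩
  (2 * (G * (J * z)) * 2 ^ n) ^ (q * (2 * D))                ∎
  where
  open ≤-Reasoning
  A : ℕ
  A = P * (G * T)
  eq₁ : ∀ x y → x * y * 2 ≡ 2 * x * y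
  eq₁ = solve-∀
  eq₂ : ∀ a D → 2 * (a * D + D) ≡ a * (2 * D) + 2 * D
  eq₂ = solve-∀
  eq₃ : ∀ P G J N z → P * G * (J * (N * z)) ≡ G * (J * z) * (P * N)
  eq₃ = solve-∀
  2n≤ : 2 * n ≤ a * (2 * D) + 2 * D
  2n≤ = ≤-trans (*-monoʳ-≤ 2 n≤) (≤-reflexive (eq₂ a D))
  A≤ : A ^ q * 2 ^ a ≤ (G * (J * z) * 2 ^ n) ^ q
  A≤ = begin
    A ^ q * 2 ^ a                       ≤⟨ *-monoʳ-≤ (A ^ q) {2 ^ a} {r} N≤r ⟩
    A ^ q * r                           ≡⟨ cong (λ x → x ^ q * r) (*-assoc P G T) ⟨
    (P * G * T) ^ q * r                 ≡⟨ cong (_* r) (^-distribʳ-* q (P * G) T) ⟩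
    (P * G) ^ q * T ^ q * r             ≡⟨ *-assoc ((P * G) ^ q) (T ^ q) r ⟩
    (P * G) ^ q * (T ^ q * r)           ≤⟨ *-monoʳ-≤ ((P * G) ^ q) T≤ ⟩
    (P * G) ^ q * (J * r) ^ q           ≡⟨ ^-distribʳ-* q (P * G) (J * r) ⟨
    (P * G * (J * r)) ^ q               ≡⟨ cong (λ r → (P * G * (J * r)) ^ q) r≡ ⟩
    (P * G * (J * (2 ^ a * z))) ^ q     ≡⟨ cong (_^ q) (eq₃ P G J (2 ^ a) z) ⟩
    (G * (J * z) * (P * 2 ^ a)) ^ q     ≡⟨ cong (λ x → (G * (J * z) * x) ^ q) PN≡ ⟩
    (G * (J * z) * 2 ^ n) ^ q           ∎

-- M is at most 2 ^ (n / 2), so its power 2 k leaves a factor 2 ^ (n k), which covers 2 ^ (2 n) as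
-- soon as k ≥ 2.
preparation-power : ∀ k n {M G} → M ^ 2 ≤ 2 ^ n → 2 ≤ k → (G * M) ^ (k * 2) * 2 ^ (2 * n) ≤ (G * 2 ^ n) ^ (k * 2)
preparation-power k n {M} {G} M≤ 2≤k = begin
  (G * M) ^ (k * 2) * 2 ^ (2 * n)            ≡⟨ cong (_* 2 ^ (2 * n)) (^-distribʳ-* (k * 2) G M) ⟩
  G ^ (k * 2) * M ^ (k * 2) * 2 ^ (2 * n)    ≡⟨ *-assoc (G ^ (k * 2)) (M ^ (k * 2)) (2 ^ (2 * n)) ⟩
  G ^ (k * 2) * (M ^ (k * 2) * 2 ^ (2 * n))  ≤⟨ *-monoʳ-≤ (G ^ (k * 2)) M-part ⟩
  G ^ (k * 2) * (2 ^ n) ^ (k * 2)            ≡⟨ ^-distribʳ-* (k * 2) G (2 ^ n) ⟨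
  (G * 2 ^ n) ^ (k * 2)                      ∎
  where
  open ≤-Reasoning
  eq : ∀ n k → n * k + n * k ≡ n * (k * 2)
  eq = solve-∀
  M-part : M ^ (k * 2) * 2 ^ (2 * n) ≤ (2 ^ n) ^ (k * 2)
  M-part = begin
    M ^ (k * 2) * 2 ^ (2 * n)         ≡⟨ cong₂ _*_ (trans (cong (M ^_) (*-comm k 2)) (sym (^-*-assoc M 2 k))) (cong (2 ^_) (*-comm 2 n)) ⟩
    (M ^ 2) ^ k * 2 ^ (n * 2)         ≤⟨ *-mono-≤ {(M ^ 2) ^ k} {(2 ^ n) ^ k} {2 ^ (n * 2)} {2 ^ (n * k)} (^-monoˡ-≤ k M≤) (^-monoʳ-≤ 2 (*-monoʳ-≤ n 2≤k)) ⟩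
    (2 ^ n) ^ k * 2 ^ (n * k)         ≡⟨ cong (_* 2 ^ (n * k)) (^-*-assoc 2 n k) ⟩
    2 ^ (n * k) * 2 ^ (n * k)         ≡⟨ ^-distribˡ-+-* 2 (n * k) (n * k) ⟨
    2 ^ (n * k + n * k)               ≡⟨ cong (2 ^_) (eq n k) ⟩
    2 ^ (n * (k * 2))                 ≡⟨ ^-*-assoc 2 n (k * 2) ⟨
    (2 ^ n) ^ (k * 2)                 ∎

-- A sum is at most twice the maximum, and the maximum is one of the two terms; this avoids
-- expanding a power of a sum.
sum-power : ∀ Q n {A B G H} → A ^ Q * 2 ^ (2 * n) ≤ (G * 2 ^ n) ^ Q → B ^ Q * 2 ^ (2 * n) ≤ (H * 2 ^ n) ^ Q →
            (A + B) ^ Q * 2 ^ (2 * n) ≤ (2 * (G + H) * 2 ^ n) ^ Q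
sum-power Q n {A} {B} {G} {H} A≤ B≤ = begin
  (A + B) ^ Q * 2 ^ (2 * n)                ≤⟨ *-monoˡ-≤ (2 ^ (2 * n)) (^-monoˡ-≤ Q (+≤2*⊔ A B)) ⟩
  (2 * (A ⊔ B)) ^ Q * 2 ^ (2 * n)          ≡⟨ cong (_* 2 ^ (2 * n)) (^-distribʳ-* Q 2 (A ⊔ B)) ⟩
  2 ^ Q * (A ⊔ B) ^ Q * 2 ^ (2 * n)        ≡⟨ *-assoc (2 ^ Q) ((A ⊔ B) ^ Q) (2 ^ (2 * n)) ⟩
  2 ^ Q * ((A ⊔ B) ^ Q * 2 ^ (2 * n))      ≤⟨ *-monoʳ-≤ (2 ^ Q) (power-max Q (≤-trans A≤ (^-monoˡ-≤ Q (*-monoˡ-≤ (2 ^ n) (m≤m+n G H)))) (≤-trans B≤ (^-monoˡ-≤ Q (*-monoˡ-≤ (2 ^ n) (m≤n+m H G))))) ⟩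
  2 ^ Q * ((G + H) * 2 ^ n) ^ Q            ≡⟨ ^-distribʳ-* Q 2 ((G + H) * 2 ^ n) ⟨
  (2 * ((G + H) * 2 ^ n)) ^ Q              ≡⟨ cong (_^ Q) (*-assoc 2 (G + H) (2 ^ n)) ⟨
  (2 * (G + H) * 2 ^ n) ^ Q                ∎
  where open ≤-Reasoning

-- One factor 2 ^ n of the savings pays for the powers of n.
absorb : ∀ Q .{{_ : NonZero Q}} c e → ∃ λ k → ∀ n L G t → G ≤ c * (8 * suc n * L) ^ e →
         t ^ Q * 2 ^ (2 * n) ≤ (G * 2 ^ n) ^ Q → t ^ Q * 2 ^ n ≤ (k * L ^ e * 2 ^ n) ^ Q
absorb Q c e with c₂ , poly ← polynomial≤exponential (e * Q) = suc c₂ * (c * 8 ^ e) , λ n L G t G≤ t≤ →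
  *-cancelʳ-≤ (t ^ Q * 2 ^ n) ((suc c₂ * (c * 8 ^ e) * L ^ e * 2 ^ n) ^ Q) (2 ^ n) {{m^n≢0 2 n}} (begin
    t ^ Q * 2 ^ n * 2 ^ n                                          ≡⟨ trans (*-assoc (t ^ Q) (2 ^ n) (2 ^ n)) (cong (t ^ Q *_) (trans (sym (^-distribˡ-+-* 2 n n)) (cong (λ z → 2 ^ (n + z)) (sym (+-identityʳ n))))) ⟩
    t ^ Q * 2 ^ (2 * n)                                            ≤⟨ t≤ ⟩
    (G * 2 ^ n) ^ Q                                                ≤⟨ ^-monoˡ-≤ Q (*-monoˡ-≤ (2 ^ n) G≤) ⟩
    (c * (8 * suc n * L) ^ e * 2 ^ n) ^ Q                          ≡⟨ cong (_^ Q) (trans (cong (λ z → c * z * 2 ^ n) (trans (^-distribʳ-* e (8 * suc n) L) (cong (_* L ^ e) (^-distribʳ-* e 8 (suc n))))) (eq c (8 ^ e) (suc n ^ e) (L ^ e) (2 ^ n))) ⟩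
    (suc n ^ e * (c * 8 ^ e * L ^ e * 2 ^ n)) ^ Q                  ≡⟨ ^-distribʳ-* Q (suc n ^ e) (c * 8 ^ e * L ^ e * 2 ^ n) ⟩
    (suc n ^ e) ^ Q * (c * 8 ^ e * L ^ e * 2 ^ n) ^ Q              ≡⟨ cong (_* (c * 8 ^ e * L ^ e * 2 ^ n) ^ Q) (^-*-assoc (suc n) e Q) ⟩
    suc n ^ (e * Q) * (c * 8 ^ e * L ^ e * 2 ^ n) ^ Q              ≤⟨ *-monoˡ-≤ ((c * 8 ^ e * L ^ e * 2 ^ n) ^ Q) (≤-trans (poly n) (*-monoˡ-≤ (2 ^ n) c₂≤)) ⟩
    suc c₂ ^ Q * 2 ^ n * (c * 8 ^ e * L ^ e * 2 ^ n) ^ Q           ≡⟨ eq′ (suc c₂ ^ Q) (2 ^ n) ((c * 8 ^ e * L ^ e * 2 ^ n) ^ Q) ⟩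
    suc c₂ ^ Q * (c * 8 ^ e * L ^ e * 2 ^ n) ^ Q * 2 ^ n           ≡⟨ cong (_* 2 ^ n) (^-distribʳ-* Q (suc c₂) (c * 8 ^ e * L ^ e * 2 ^ n)) ⟨
    (suc c₂ * (c * 8 ^ e * L ^ e * 2 ^ n)) ^ Q * 2 ^ n             ≡⟨ cong (λ z → z ^ Q * 2 ^ n) (eq″ (suc c₂) (c * 8 ^ e) (L ^ e) (2 ^ n)) ⟩
    (suc c₂ * (c * 8 ^ e) * L ^ e * 2 ^ n) ^ Q * 2 ^ n             ∎)
  where
  open ≤-Reasoning
  c₂≤ : c₂ ≤ suc c₂ ^ Q
  c₂≤ = ≤-trans (n≤1+n c₂) (≤-trans (≤-reflexive (sym (^-identityʳ (suc c₂)))) (^-monoʳ-≤ (suc c₂) (>-nonZero⁻¹ Q)))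
  eq : ∀ c x y z u → c * (x * y * z) * u ≡ y * (c * x * z * u)
  eq = solve-∀
  eq′ : ∀ x y z → x * y * z ≡ x * z * y
  eq′ = solve-∀
  eq″ : ∀ x y z u → x * (y * z * u) ≡ x * y * z * u
  eq″ = solve-∀

final-power : ∀ q D n a F M P G T rate r z → 1 ≤ q → 2 ≤ D → M ^ 2 ≤ 2 ^ n → T ^ q * r ≤ (rate * r) ^ q → r ≡ 2 ^ a * z → 2 ^ a ≤ r →
  P * 2 ^ a ≡ 2 ^ n → n ≤ a * D + D → ∀ Q {B t} → Q ≡ q * (2 * D) → B ≡ 2 * (F + 2 * (G * (rate * z))) → t ≤ F * M + P * (G * T) →
  t ^ Q * 2 ^ (2 * n) ≤ (B * 2 ^ n) ^ Q
final-power q D n a F M P G T rate r z 1≤q 2≤D M≤ T≤ r≡ N≤r PN≡ n≤ Q refl refl t≤ =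
  ≤-trans (*-monoˡ-≤ (2 ^ (2 * n)) (^-monoˡ-≤ Q t≤))
    (sum-power Q n {F * M} {P * (G * T)} {F} {2 * (G * (rate * z))}
      (subst (λ e → (F * M) ^ e * 2 ^ (2 * n) ≤ (F * 2 ^ n) ^ e) (eq q D) (preparation-power (q * D) n {M} {F} M≤ (*-mono-≤ 1≤q 2≤D)))
      (queries-power q D n a {rate} {r} {z} {G} {T} {P} T≤ r≡ N≤r PN≡ n≤ 1≤q))
  where
  eq : ∀ q D → q * D * 2 ≡ q * (2 * D)
  eq = solve-∀

bound-from-power : ∀ ε Q t a b → ℚ.↧ₙ ε ≡ Q → ℤ.∣ ℚ.↥ ε ∣ ≡ 1 → t ^ Q * b ≤ (a * b) ^ Q → t ≤ a · b ^[1- ε ]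
bound-from-power ε Q t a b refl p t≤ = subst (λ e → t ^ Q * e ≤ (a * b) ^ Q) (trans (sym (^-identityʳ b)) (cong (b ^_) (sym p))) t≤

-- Work done once is charged to M, work of the queries to P · T. The constant parts are absorbed by
-- 1 ≤ M and 1 ≤ T.
cost-split : ∀ su {h} rv {R} rh ov {t₀} P pc ou {T M} t₁ → 1 ≤ M → h ≤ 2 * M → R ≤ 2 * M → t₀ ≤ t₁ * M → 1 ≤ T →
  su + (93 + 142 + (h * rv + 24 + (R * rh + 19 + (ov * t₀ + (4 + (6 + (P * (pc + ou * T + 250 + 13) + 4)))))))
  ≤ (su + 292 + 2 * rv + 2 * rh + ov * t₁) * M + P * ((pc + ou + 263) * T)
cost-split su {h} rv {R} rh ov {t₀} P pc ou {T} {M} t₁ 1≤M h≤ R≤ t≤ 1≤T =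
  ≤-by (+-mono-≤ (*-monoʳ-≤ (su + 292) 1≤M) (+-mono-≤ (*-monoˡ-≤ rv h≤) (+-mono-≤ (*-monoˡ-≤ rh R≤) (+-mono-≤ (*-monoʳ-≤ ov t≤) (*-monoʳ-≤ (P * (pc + 263)) 1≤T)))))
    0 (eq su h rv R rh ov t₀ P pc ou T M t₁)
  where
  eq : ∀ su h rv R rh ov t₀ P pc ou T M t₁ →
    (su + 292 + 2 * rv + 2 * rh + ov * t₁) * M + P * ((pc + ou + 263) * T) + ((su + 292) * 1 + (h * rv + (R * rh + (ov * t₀ + P * (pc + 263) * 1))))
    ≡ su + (93 + 142 + (h * rv + 24 + (R * rh + 19 + (ov * t₀ + (4 + (6 + (P * (pc + ou * T + 250 + 13) + 4)))))))
      + ((su + 292) * M + (2 * M * rv + (2 * M * rh + (ov * (t₁ * M) + P * (pc + 263) * T)))) + 0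
  eq = solve-∀

-- The time of each query is bounded only through an inequality between powers, from which no
-- explicit natural number can be read off. The maximum over the P queries satisfies the same
-- inequality and serves as the common bound.
uniform : ∀ (Q : ℕ → Set) (R : ℕ → ℕ → Set) P → Q 1 → (∀ {t t′} → Q t → Q t′ → Q (t ⊔ t′)) →
          (∀ y → y < P → ∃ λ t → R y t × Q t) → ∃ λ T → 1 ≤ T × Q T × (∀ y → y < P → ∃ λ t → R y t × t ≤ T)
uniform Q R zero    q₁ q⊔ f = 1 , ≤-refl , q₁ , λ _ ()
uniform Q R (suc P) q₁ q⊔ f
  with T , 1≤T , qT , g ← uniform Q R P q₁ q⊔ (λ y y<P → f y (m<n⇒m<1+n y<P))
  with t , r , qt ← f P ≤-refl = T ⊔ t , ≤-trans 1≤T (m≤m⊔n T t) , q⊔ qT qt , bound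
  where
  bound : ∀ y → y < suc P → ∃ λ t′ → R y t′ × t′ ≤ T ⊔ t
  bound y (s≤s y≤P) with m≤n⇒m<n∨m≡n y≤P
  ... | inj₁ y<P with t′ , r′ , t′≤ ← g y y<P = t′ , r′ , ≤-trans t′≤ (m≤m⊔n T t)
  ... | inj₂ refl = t , r , m≤n⊔m T t

bits≤ : ∀ x → 1 ≤ x → bits x ≤ x
bits≤ x 1≤x = <2^⇒bits≤ x 1≤x (n<2^n x)

numerator-positive : ∀ ε → 0ℚ ℚ.< ε → 1 ≤ ℤ.∣ ℚ.↥ ε ∣
numerator-positive (mkℚ (ℤ.+ suc k) _ _) _ = s≤s z≤n
numerator-positive ε@(mkℚ (ℤ.+ zero) _ _) 0<ε with () ← ℚ.positive 0<ε
numerator-positive ε@(mkℚ (ℤ.-[1+ k ]) _ _) 0<ε with () ← ℚ.positive 0<ε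

-- From a dynamic algorithm to a SAT algorithm

module Reduction (ε : ℚ) (0<ε : 0ℚ ℚ.< ε) (s : Setting) (A : DynamicAlgorithm) (K d : ℕ)
  (maintains : ∀ n .{{_ : NonZero n}} (G : Graph n) → Planar G → Graph.Connected G →
    (ω : Graph.Weighting G) → (∀ e → ω e ≤ n ^ 2) →
    ∃₂ λ σ t → Run (DynamicAlgorithm.preprocess A) (start (encodeGraph G ω)) σ t × t ≤ K * n ^ d × Graph.IsDiameter G ω (reg σ 0)
             × (∀ cs → Legal G s (n ^ 2) ω cs → ∃[ T ] Serves G A σ ω cs T × T ≤ K * length cs · n ^[1- ε ])) where

  open DynamicAlgorithm A

  -- 2 ^ a rows make the preprocessing take about 2 ^ (n / 2) steps.
  D′ D q Q : ℕ
  D′ = suc (2 * d)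
  D = suc D′
  q = ℚ.denominatorℕ ε
  Q = q * (2 * D)

  Inst : Set
  Inst = ∃ λ n → CNF n

  module _ (i : Inst) where

    private
      n : ℕ
      n = proj₁ i
      φ : CNF n
      φ = proj₂ i

    L l a N N′ P z X S Y : ℕ
    L = length (encodeCNF φ)
    l = length φ
    a = n / D
    N = 2 ^ a
    N′ = N ∸ 1
    P = 2 ^ (n ∸ a)
    z = 2 * (2 + l)
    -- With the factor 16 this exceeds the length of the encoded graph, the bound `top` and every
    -- value of a variable.
    X = 16 * (2 ^ n * L)
    -- One bit more than for X, because cells hold successors.
    S = suc (bits X)
    -- Bounds S as well: 5 bits for 16, n + 1 for 2 ^ n, at most L for L, and the extra bit.
    Y = n + L + 7

    rowCost₁ rowCost₂ setupCost fixedCost queryCost rate : ℕ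
    rowCost₁ = (2 + l) * (emitCost (verticalWeight (initialWeight s)) + 213) + 41
    rowCost₂ = suc l * (columnCost n (length (blocks φ)) + 385) + 73
    setupCost = l * 30 + (n * 24 + (bits D * 5 + 89))
    fixedCost = setupCost + 292 + 2 * rowCost₁ + 2 * rowCost₂ + overhead preprocess * (K * z ^ d)
    queryCost = (2 + l) * (columnCost n (length (blocks φ)) + 156) + overhead update + 263
    -- The successor keeps the rate positive even if K is 0, so that time 1 always counts as fast.
    rate = suc K * (2 + l)

    overall : ℕ
    overall = 2 * (fixedCost * S + 2 * (queryCost * S * (rate * z)))

    l≤L : 2 + l ≤ L
    l≤L = +-monoʳ-≤ 2 (clauses≤blocks φ)

    1≤L : 1 ≤ L
    1≤L = s≤s z≤n

    L≤Y : L ≤ Y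
    L≤Y = ≤-trans (m≤n+m L n) (m≤m+n (n + L) 7)

    S≤Y : S ≤ Y
    S≤Y = ≤-trans (s≤s (begin
      bits X                              ≤⟨ bits-* 16 (2 ^ n * L) ⟩
      5 + bits (2 ^ n * L)                ≤⟨ +-monoʳ-≤ 5 (bits-* (2 ^ n) L) ⟩
      5 + (bits (2 ^ n) + bits L)         ≤⟨ +-monoʳ-≤ 5 (+-mono-≤ (≤-reflexive (bits-2^ n)) (bits≤ L 1≤L)) ⟩
      5 + (suc n + L)                     ∎))
      (≤-reflexive (eq n L))
      where
      open ≤-Reasoning
      eq : ∀ n L → suc (5 + (suc n + L)) ≡ n + L + 7
      eq = solve-∀

    a≤n : a ≤ n
    a≤n = m/n≤m n D

    N≡ : N ≡ suc N′
    N≡ = sym (suc-pred N {{m^n≢0 2 a}})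

    PN≡ : P * N ≡ 2 ^ n
    PN≡ = trans (sym (^-distribˡ-+-* 2 (n ∸ a) a)) (cong (2 ^_) (m∸n+n≡m a≤n))

    n≤ : n ≤ a * D + D
    n≤ = ≤-trans (≤-reflexive (m≡m%n+[m/n]*n n D)) (≤-trans (+-monoˡ-≤ (n / D * D) (<⇒≤ (m%n<n n D))) (≤-reflexive (+-comm D (a * D))))

    power≤ : (N ^ suc d) ^ 2 ≤ 2 ^ n
    power≤ = begin
      (N ^ suc d) ^ 2          ≡⟨ cong (_^ 2) (^-*-assoc 2 a (suc d)) ⟩
      (2 ^ (a * suc d)) ^ 2    ≡⟨ ^-*-assoc 2 (a * suc d) 2 ⟩
      2 ^ (a * suc d * 2)      ≡⟨ cong (2 ^_) (eq a d) ⟩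
      2 ^ (a * D)              ≤⟨ ^-monoʳ-≤ 2 (m/n*n≤m n D) ⟩
      2 ^ n                    ∎
      where
      open ≤-Reasoning
      eq : ∀ a d → a * suc d * 2 ≡ a * suc (suc (2 * d))
      eq = solve-∀

  1≤Y : ∀ i → 1 ≤ Y i
  1≤Y (n , φ) = ≤-trans (s≤s z≤n) (m≤n+m 7 (n + L (n , φ)))

  overall-bounded : Bounded Y overall
  overall-bounded = fix 2 ⊛ (prep ⊛ size ⊞ fix 2 ⊛ (query′ ⊛ size ⊛ (fix (suc K) ⊛ l+2 ⊛ (fix 2 ⊛ l+2))))
    where
    infixl 6 _⊞_
    infixl 7 _⊛_
    _⊞_ : ∀ {f g} → Bounded Y f → Bounded Y g → Bounded Y (λ i → f i + g i)
    _⊞_ = bounded-+ Y 1≤Y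
    _⊛_ : ∀ {f g} → Bounded Y f → Bounded Y g → Bounded Y (λ i → f i * g i)
    _⊛_ = bounded-* Y
    fix : ∀ k → Bounded Y (λ _ → k)
    fix = bounded-const Y
    l+2 : Bounded Y (λ i → 2 + l i)
    l+2 = bounded-by Y (λ i → ≤-trans (l≤L i) (L≤Y i))
    l+1 : Bounded Y (λ i → suc (l i))
    l+1 = bounded-by Y (λ i → ≤-trans (n≤1+n _) (≤-trans (l≤L i) (L≤Y i)))
    l+0 : Bounded Y l
    l+0 = bounded-by Y (λ i → ≤-trans (≤-trans (n≤1+n _) (n≤1+n _)) (≤-trans (l≤L i) (L≤Y i)))
    n+0 : Bounded Y proj₁
    n+0 = bounded-by Y (λ i → ≤-trans (m≤m+n (proj₁ i) (L i)) (m≤m+n _ 7))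
    size : Bounded Y S
    size = bounded-by Y S≤Y
    column′ : Bounded Y (λ i → columnCost (proj₁ i) (length (blocks (proj₂ i))))
    column′ = bounded-by Y (λ i → ≤-trans (≤-trans (n≤1+n _) (n≤1+n _)) (L≤Y i)) ⊛ (n+0 ⊛ fix 24 ⊞ fix 233) ⊞ fix 48
    prep : Bounded Y fixedCost
    prep = l+0 ⊛ fix 30 ⊞ (n+0 ⊛ fix 24 ⊞ fix (bits D * 5 + 89)) ⊞ fix 292
      ⊞ fix 2 ⊛ (l+2 ⊛ fix (emitCost (verticalWeight (initialWeight s)) + 213) ⊞ fix 41)
      ⊞ fix 2 ⊛ (l+1 ⊛ (column′ ⊞ fix 385) ⊞ fix 73)
      ⊞ fix (overhead preprocess) ⊛ (fix K ⊛ bounded-^ Y d (fix 2 ⊛ l+2))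
    query′ : Bounded Y queryCost
    query′ = l+2 ⊛ (column′ ⊞ fix 156) ⊞ fix (overhead update) ⊞ fix 263

  module Solve (n : ℕ) (φ : CNF n) where

    i : Inst
    i = n , φ

    l′ N″ P′ M r U top : ℕ
    l′ = l i
    N″ = N′ i
    P′ = P i
    -- The exponent d + 1 makes M bound both the factor N ^ d of the preprocessing and the linear
    -- number of rows to be written.
    M = N i ^ suc d
    r = suc (N″ + suc N″) * suc (suc l′)
    U = 2 ^ n * L i
    top = suc l′ * (4 * (2 + N″)) + 2

    1≤2^n : 1 ≤ 2 ^ n
    1≤2^n = m^n>0 2 n

    2^n≤U : 2 ^ n ≤ U
    2^n≤U = m≤m*n (2 ^ n) (L i)

    L≤U : L i ≤ U
    L≤U = m≤n*m (L i) (2 ^ n) {{m^n≢0 2 n}}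

    1≤U : 1 ≤ U
    1≤U = ≤-trans 1≤2^n 2^n≤U

    scaled : ∀ k {x} → k ≤ 16 → x ≤ k * U → x ≤ X i
    scaled k k≤16 x≤ = ≤-trans x≤ (*-monoˡ-≤ U k≤16)

    N≤2^n : suc N″ ≤ 2 ^ n
    N≤2^n = ≤-trans (≤-reflexive (sym (N≡ i))) (^-monoʳ-≤ 2 (a≤n i))

    NL≤U : suc N″ * (2 + l′) ≤ U
    NL≤U = *-mono-≤ N≤2^n (l≤L i)

    2n≤X : 2 * n ≤ X i
    2n≤X = scaled 2 (m≤m+n 2 14) (*-monoʳ-≤ 2 (≤-trans (<⇒≤ (n<2^n n)) 2^n≤U))

    L≤X : 2 + length (blocks φ) ≤ X i
    L≤X = scaled 1 (m≤m+n 1 15) (≤-trans L≤U (≤-reflexive (sym (*-identityˡ U))))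

    NP≡ : P′ * suc N″ ≡ 2 ^ n
    NP≡ = trans (cong (P′ *_) (sym (N≡ i))) (PN≡ i)

    NP≤X : P′ * suc N″ ≤ X i
    NP≤X = scaled 1 (m≤m+n 1 15) (≤-trans (≤-reflexive NP≡) (≤-trans 2^n≤U (≤-reflexive (sym (*-identityˡ U)))))

    P≤X : suc P′ ≤ X i
    P≤X = scaled 2 (m≤m+n 2 14) (≤-trans (+-mono-≤ 1≤U (≤-trans (m≤m*n P′ (suc N″)) (≤-trans (≤-reflexive NP≡) 2^n≤U))) (≤-reflexive (cong (U +_) (sym (+-identityʳ U)))))

    N≤X : N″ + suc (suc N″) ≤ X i
    N≤X = scaled 2 (m≤m+n 2 14) (≤-trans (≤-reflexive (eq N″)) (*-monoʳ-≤ 2 (≤-trans N≤2^n 2^n≤U)))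
      where
      eq : ∀ N → N + suc (suc N) ≡ 2 * suc N
      eq = solve-∀

    list≤X : 2 + (N″ + suc N″) * ((2 + l′) * 3) + suc (N″ + suc N″) * (suc l′ * 3) ≤ X i
    list≤X = ≤-by (+-mono-≤ (*-monoˡ-≤ 12 NL≤U) (*-monoʳ-≤ 2 1≤U)) _ (eq N″ l′ U)
      where
      eq : ∀ N l U → 16 * U + (suc N * (2 + l) * 12 + 2 * 1) ≡
           2 + (N + suc N) * ((2 + l) * 3) + suc (N + suc N) * (suc l * 3) + (U * 12 + 2 * U) + (2 * U + 3 * l + 6 * N + 12)
      eq = solve-∀

    top≤X : top ≤ X i
    top≤X = ≤-by (+-mono-≤ (*-monoˡ-≤ 8 NL≤U) (*-monoʳ-≤ 2 1≤U)) _ (eq N″ l′ U)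
      where
      eq : ∀ N l U → 16 * U + (suc N * (2 + l) * 8 + 2 * 1) ≡ suc l * (4 * (2 + N)) + 2 + (U * 8 + 2 * U) + (6 * U + 4 * N * l + 12 * N + 8)
      eq = solve-∀

    small : ∀ {x} → x ≤ X i → bits x ≤ S i
    small x≤ = ≤-trans (bits-mono x≤) (n≤1+n (bits (X i)))

    spare : bits top + 1 ≤ S i
    spare = ≤-trans (≤-reflexive (+-comm (bits top) 1)) (s≤s (bits-mono top≤X))

    open Instance φ N″ P′ (initialWeight s) using (m; weights₀; weights₀≤; metric-weights; legal-changes; columnWeight)
    open Metric N″ m (s≤s z≤n) using (module Distances)
    open Grid (N″ + suc N″) m using (grid; planar; vertices; columns)
    open Changes N″ m using (changes; length-changesFrom)

    maintained : _
    -- Connectedness does not refer to weights, so the weighting reached in query 0 can provide the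
    -- walks.
    maintained = maintains vertices grid planar (Distances.connected (metric-weights 0)) weights₀ (weights₀≤ (initialWeight≤3 s))

    σ : State
    σ = proj₁ maintained

    t₀ : ℕ
    t₀ = proj₁ (proj₂ maintained)

    r≡ : r ≡ N i * z i
    r≡ = trans (eq N″ l′) (cong (_* z i) (sym (N≡ i)))
      where
      eq : ∀ N l → suc (N + suc N) * suc (suc l) ≡ suc N * (2 * (2 + l))
      eq = solve-∀

    power-increasing : ∀ x {k} → 1 ≤ k → x ≤ x ^ k
    power-increasing zero    _   = z≤n
    power-increasing (suc x) 1≤k = ≤-trans (≤-reflexive (sym (^-identityʳ (suc x)))) (^-monoʳ-≤ (suc x) 1≤k)

    -- This is t ≤ `rate` · r ^ (1 - 1 / q) without roots.
    Fast : ℕ → Set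
    Fast t = t ^ q * r ≤ (rate i * r) ^ q

    fast-1 : Fast 1
    fast-1 = begin
      1 ^ q * r           ≡⟨ cong (_* r) (^-zeroˡ q) ⟩
      1 * r               ≡⟨ *-identityˡ r ⟩
      r                   ≤⟨ m≤n*m r (rate i) ⟩
      rate i * r          ≤⟨ power-increasing (rate i * r) {q} (s≤s z≤n) ⟩
      (rate i * r) ^ q    ∎
      where open ≤-Reasoning

    serves-changes : ∀ y → y < P′ → ∃ λ t → Serves grid A σ weights₀ (changes (columnWeight y)) t × Fast t
    serves-changes y _ = t , serves , (begin
        -- The numerator of ε is at least 1, so a saving of r ^ (1 / q) is guaranteed.
        t ^ q * r                                                ≤⟨ *-monoʳ-≤ (t ^ q) (power-increasing r {ℤ.∣ ℚ.↥ ε ∣} (numerator-positive ε 0<ε)) ⟩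
        t ^ q * r ^ ℤ.∣ ℚ.↥ ε ∣                                  ≤⟨ t≤ ⟩
        (K * length (changes (columnWeight y)) * r) ^ q          ≡⟨ cong (λ c → (K * c * r) ^ q) (length-changesFrom (columnWeight y) columns 0 refl) ⟩
        (K * (2 + l′) * r) ^ q                                   ≤⟨ ^-monoˡ-≤ q (*-monoˡ-≤ r (*-monoˡ-≤ (2 + l′) (n≤1+n K))) ⟩
        (rate i * r) ^ q                                         ∎)
      where
      open ≤-Reasoning
      served : ∃[ T ] Serves grid A σ weights₀ (changes (columnWeight y)) T × T ≤ K * length (changes (columnWeight y)) · r ^[1- ε ]
      served = proj₂ (proj₂ (proj₂ (proj₂ (proj₂ maintained)))) (changes (columnWeight y))
                 (legal-changes y s (vertices ^ 2) refl (s≤s (s≤s z≤n)))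
      t = proj₁ served
      serves = proj₁ (proj₂ served)
      t≤ = proj₂ (proj₂ served)

    uniformly : _
    uniformly = uniform Fast (λ y → Serves grid A σ weights₀ (changes (columnWeight y))) P′ fast-1 (λ {t} {t′} → power-max q {t} {t′} {(rate i * r) ^ q} {r}) serves-changes

    T : ℕ
    T = proj₁ uniformly

    module Decided = Decide.Answer (S i) (X i) (s≤s z≤n) small 2n≤X φ L≤X D′ N″ P′ (N≡ i) refl NP≤X P≤X N≤X list≤X spare s A
      σ t₀ T (proj₁ (proj₂ (proj₂ maintained))) (proj₁ (proj₂ (proj₂ (proj₂ (proj₂ maintained))))) (proj₂ (proj₂ (proj₂ uniformly)))

    G : ℕ
    G = queryCost i * S i

    N≤M : suc N″ ≤ M
    N≤M = ≤-trans (≤-reflexive (sym (N≡ i))) (m≤m*n (N i) (N i ^ d) {{m^n≢0 (N i) d {{m^n≢0 2 (a i)}}}})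

    preparation≤ : t₀ ≤ K * z i ^ d * M
    preparation≤ = begin
      t₀                          ≤⟨ proj₁ (proj₂ (proj₂ (proj₂ maintained))) ⟩
      K * r ^ d                   ≡⟨ cong (λ r → K * r ^ d) r≡ ⟩
      K * (N i * z i) ^ d         ≡⟨ cong (K *_) (trans (^-distribʳ-* d (N i) (z i)) (*-comm (N i ^ d) (z i ^ d))) ⟩
      K * (z i ^ d * N i ^ d)     ≡⟨ *-assoc K (z i ^ d) (N i ^ d) ⟨
      K * z i ^ d * N i ^ d       ≤⟨ *-monoʳ-≤ (K * z i ^ d) (m≤n*m (N i ^ d) (N i) {{m^n≢0 2 (a i)}}) ⟩
      K * z i ^ d * M             ∎
      where open ≤-Reasoning

    total≤ : Decided.totalCost * S i ≤ fixedCost i * S i * M + P′ * (G * T)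
    total≤ = ≤-trans
      (*-monoˡ-≤ (S i) (cost-split (setupCost i) (rowCost₁ i) (rowCost₂ i) (overhead preprocess) P′ ((2 + l′) * (columnCost n (length (blocks φ)) + 156)) (overhead update)
        (K * z i ^ d) (≤-trans (s≤s z≤n) N≤M) (≤-trans (n≤1+n _) rows≤) rows≤ preparation≤ (proj₁ (proj₂ uniformly))))
      (≤-reflexive (eq (fixedCost i) M P′ (queryCost i) T (S i)))
      where
      rows : ∀ N → suc (N + suc N) ≡ 2 * suc N
      rows = solve-∀
      rows≤ : suc (N″ + suc N″) ≤ 2 * M
      rows≤ = ≤-trans (≤-reflexive (rows N″)) (*-monoʳ-≤ 2 N≤M)
      eq : ∀ F M P Q T S → (F * M + P * (Q * T)) * S ≡ F * S * M + P * (Q * S * T)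
      eq = solve-∀

    N≤r : N i ≤ r
    N≤r = ≤-trans (m≤m*n (N i) (z i)) (≤-reflexive (sym r≡))

    time≤ : ∀ {t} → t ≤ Decided.totalCost * S i → t ^ Q * 2 ^ (2 * n) ≤ (overall i * 2 ^ n) ^ Q
    time≤ t≤ = final-power q D n (a i) (fixedCost i * S i) M P′ G T (rate i) r (z i) (s≤s z≤n) (s≤s (s≤s z≤n)) (power≤ i)
      (proj₁ (proj₂ (proj₂ uniformly))) r≡ N≤r (PN≡ i) (n≤ i) Q {overall i} refl refl (≤-trans t≤ total≤)

    solution : ∃₂ λ final t → Run (decide D (initialWeight s) A) (start (encodeCNF φ)) final t × (reg final 0 ≡ 1 ⇔ Satisfiable φ)
                            × t ^ Q * 2 ^ (2 * n) ≤ (overall i * 2 ^ n) ^ Q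
    solution = let final , t , run , correct , t≤ = Decided.decide-run in final , t , run , correct , time≤ t≤

  -- The saving in the Q-th power of the time is 2 ^ (2 n). One half is spent by `absorb`, and the
  -- remaining 2 ^ n is the exponent 1 / Q.
  gain : ℚ
  gain = mkℚ (ℤ.+ 1) (pred Q) (Coprime.1-coprimeTo Q)

  gain-positive : 0ℚ ℚ.< gain
  gain-positive = ℚ.positive⁻¹ gain

  -- The sum is replaced by a product so that powers of n, which the savings must pay, separate from
  -- powers of L, which the polynomial factor may contain.
  Y≤ : ∀ i → Y i ≤ 8 * suc (proj₁ i) * L i
  Y≤ (n , φ) = ≤-from (8 * n * b + 15 * n + 7 * b + 7) (eq n b)
    where
    b : ℕ
    b = length (blocks φ)
    eq : ∀ n b → 8 * suc n * (2 + b) ≡ n + (2 + b) + 7 + (8 * n * b + 15 * n + 7 * b + 7)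
    eq = solve-∀

  decides-SAT : ∀ k → DecidesSAT k gain (decide D (initialWeight s) A)
  decides-SAT k = polynomial overall-bounded
    where
    polynomial : Bounded Y overall → DecidesSAT k gain (decide D (initialWeight s) A)
    polynomial (c , e , overall≤) = conclude (absorb Q c e)
      where
      conclude : (∃ λ k → ∀ n L G t → G ≤ c * (8 * suc n * L) ^ e → t ^ Q * 2 ^ (2 * n) ≤ (G * 2 ^ n) ^ Q → t ^ Q * 2 ^ n ≤ (k * L ^ e * 2 ^ n) ^ Q) →
                 DecidesSAT k gain (decide D (initialWeight s) A)
      conclude (k′ , absorbed) = k′ , e , λ n φ _ → finish n φ (Solve.solution n φ)
        where
        finish : ∀ n φ → (∃₂ λ final t → Run (decide D (initialWeight s) A) (start (encodeCNF φ)) final t × (reg final 0 ≡ 1 ⇔ Satisfiable φ)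
                            × t ^ Q * 2 ^ (2 * n) ≤ (overall (n , φ) * 2 ^ n) ^ Q) →
          ∃₂ λ final t → Run (decide D (initialWeight s) A) (start (encodeCNF φ)) final t × (reg final 0 ≡ 1 ⇔ Satisfiable φ)
                       × t ≤ k′ * length (encodeCNF φ) ^ e · 2 ^ n ^[1- gain ]
        finish n φ (final , t , run , correct , t≤) = final , t , run , correct ,
          bound-from-power gain Q t (k′ * L i ^ e) (2 ^ n) refl refl
            (absorbed n (L i) (overall i) t (≤-trans (overall≤ i) (*-monoʳ-≤ c (^-monoˡ-≤ e (Y≤ i)))) t≤)
          where
          i : Inst
          i = n , φ

theorem1 : SETH → (ε : ℚ) → 0ℚ ℚ.< ε → (s : Setting) →
           ∃[ C ] ¬ (∃[ A ] MaintainsDiameter s C ε A)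
-- The same exponent 2 serves every ε and every setting. The order of choices matters: `gain`
-- depends on the exponent d of the given algorithm, and only then does SETH supply k.
theorem1 seth ε 0<ε s = 2 , λ (A , K , d , maintains) →
  let open Reduction ε 0<ε s A K d maintains
      k , unsolvable = seth gain gain-positive
  in unsolvable (decide D (initialWeight s) A , decides-SAT k)
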